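{- Let $n\ge 1$ and let $\Gamma$ be a simple graph on the vertex set $\{P,Q\}\cup[n]$ in which $P$ and $Q$ are dominating vertices, i.e. each of $P,Q$ is adjacent to every other vertex of $\Gamma$. Let $\mathrm{Tree}(\Gamma)$ be the set of $\Gamma$-stable trees and, for $T\in\mathrm{Tree}(\Gamma)$, let $i(T)$ be its number of internal edges. Let $\mathrm{ACO}(\Gamma)$ be the set of acyclic orientations of the induced subgraph $\Gamma\smallsetminus\{P,Q\}$ on $[n]$. Then, up to sign, $$\sum_{T\in\mathrm{Tree}(\Gamma)}(-1)^{i(T)}=\pm|\mathrm{ACO}(\Gamma)|,\qquad\text{i.e.}\qquad \Big|\sum_{T\in\mathrm{Tree}(\Gamma)}(-1)^{i(T)}\Big|=|\mathrm{ACO}(\Gamma)|.$$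
   Context: A $\Gamma$-stable tree (the dual tree of a point of Fry's graphically stable moduli space $\overline{M}_{0,\Gamma}$ whose marked points are pairwise distinct) is, up to isomorphism preserving leaf labels, a finite tree $T$ whose degree-one vertices (leaves) are labeled bijectively by the vertices of $\Gamma$, all of whose other vertices (internal vertices) have degree at least $3$, and such that for every internal edge $e$ (an edge joining two internal vertices), each of the two connected components of $T\smallsetminus e$ contains two leaves whose labels are adjacent in $\Gamma$. The tree with a single internal vertex (and no internal edges) is included. $i(T)$ is the number of internal edges of $T$. Equivalently, $\mathrm{Tree}(\Gamma)$ indexes the boundary strata of $\overline{M}_{0,\Gamma}$ and $i(T)$ is the codimension of the stratum. -}

module Defs where

open import Data.Nat using (ℕ; zero; suc; _+_; _≤_; _<_)
open import Data.Fin using (Fin; toℕ) renaming (zero to fz; suc to fs)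
open import Data.Bool using (Bool; true; false; not; if_then_else_)
open import Data.Sum using (_⊎_; inj₁; inj₂)
open import Data.Product using (Σ; ∃; ∃-syntax; _×_; _,_)
open import Data.List using (List; []; _∷_; _++_; _∷ʳ_; length; map; filterᵇ; foldr; lookup)
open import Data.List.Relation.Unary.All using (All)
open import Data.List.Relation.Unary.Unique.Propositional using (Unique)
open import Data.List.Relation.Unary.Linked using (Linked)
open import Data.List.Membership.Propositional using (_∈_)
open import Data.Vec using (Vec) renaming (lookup to vlookup)
open import Data.Integer using (ℤ; +_; -_; _*_)
open import Data.Integer renaming (_+_ to _+ℤ_) using ()
open import Relation.Binary.PropositionalEquality using (_≡_; _≢_)
open import Relation.Binary.Construct.Closure.ReflexiveTransitive using (Star)
open import Relation.Nullary using (¬_)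
open import Function.Bundles using (_↔_; Inverse)

Adj : {V : Set} → (V → V → Bool) → V → V → Set
Adj E u v = E u v ≡ true

IsSimpleGraph : {V : Set} → (V → V → Bool) → Set
IsSimpleGraph E = (∀ u v → E u v ≡ E v u) × (∀ u → E u u ≡ false)

HasCycle : {V : Set} → (V → V → Set) → ℕ → Set
HasCycle {V} R r =
  Σ V λ v → Σ (List V) λ vs →
    Unique (v ∷ vs) × (r ≤ length (v ∷ vs)) × Linked R ((v ∷ vs) ∷ʳ v)

HasCard : {A : Set} → (A → Set) → ℕ → Set
HasCard {A} P c =
  Σ (List A) λ L → Unique L × All P L × (∀ x → P x → x ∈ L) × (length L ≡ c)

-- Leaf-labelled trees.  Leaves are the m labels (Fin m), internal vertices Fin k.

record LTree (m : ℕ) : Set where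
  field
    k : ℕ
    E : Fin m ⊎ Fin k → Fin m ⊎ Fin k → Bool

open LTree public

Vtx : ∀ {m} → LTree m → Set
Vtx {m} T = Fin m ⊎ Fin (k T)

allFin : ∀ n → List (Fin n)
allFin zero = []
allFin (suc n) = fz ∷ map fs (allFin n)

allVtx : ∀ {m} (T : LTree m) → List (Vtx T)
allVtx {m} T = map inj₁ (allFin m) ++ map inj₂ (allFin (k T))

degree : ∀ {m} (T : LTree m) → Vtx T → ℕ
degree T v = length (filterᵇ (E T v) (allVtx T))

IsTree : ∀ {m} → LTree m → Set
IsTree T =
  IsSimpleGraph (E T) ×
  (∀ u v → Star (Adj (E T)) u v) ×
  ¬ HasCycle (Adj (E T)) 3

_∖edge_,_ : ∀ {m} (T : LTree m) → Vtx T → Vtx T → Vtx T → Vtx T → Set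
(T ∖edge x , y) u v =
  Adj (E T) u v × ¬ ((u ≡ x × v ≡ y) ⊎ (u ≡ y × v ≡ x))

IsStable : ∀ {m} → (Fin m → Fin m → Bool) → LTree m → Set
IsStable {m} Γ T =
  IsTree T ×
  (∀ (a : Fin m) → degree T (inj₁ a) ≡ 1) ×
  (∀ (x : Fin (k T)) → 3 ≤ degree T (inj₂ x)) ×
  -- for every internal edge {x,y}: the component of T ∖ {x,y} containing x
  -- (both orientations are quantified) contains two Γ-adjacent leaves
  (∀ (x y : Fin (k T)) → Adj (E T) (inj₂ x) (inj₂ y) →
     Σ (Fin m) λ a → Σ (Fin m) λ b → Adj Γ a b ×
       Star (T ∖edge inj₂ x , inj₂ y) (inj₂ x) (inj₁ a) ×
       Star (T ∖edge inj₂ x , inj₂ y) (inj₂ x) (inj₁ b))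

_≅_ : ∀ {m} → LTree m → LTree m → Set
_≅_ {m} T T' =
  Σ (Vtx T ↔ Vtx T') λ φ →
    (∀ (a : Fin m) → Inverse.to φ (inj₁ a) ≡ inj₁ a) ×
    (∀ u v → E T' (Inverse.to φ u) (Inverse.to φ v) ≡ E T u v)

iE : ∀ {m} → LTree m → ℕ
iE T = length (filterᵇ (λ p → edge (Data.Product.proj₁ p) (Data.Product.proj₂ p)) pairs)
  where
  open import Data.Nat using (_<ᵇ_)
  import Data.Product
  pairs : List (Fin (k T) × Fin (k T))
  pairs = Data.List.concatMap (λ x → map (λ y → x , y) (allFin (k T))) (allFin (k T))
    where import Data.List
  edge : Fin (k T) → Fin (k T) → Bool
  edge x y = if toℕ x <ᵇ toℕ y then E T (inj₂ x) (inj₂ y) else false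

IsTreeRepSystem : ∀ {m} → (Fin m → Fin m → Bool) → List (LTree m) → Set
IsTreeRepSystem {m} Γ L =
  All (IsStable Γ) L ×
  (∀ T → IsStable Γ T →
     Σ (Fin (length L)) λ i → (T ≅ lookup L i) ×
       (∀ j → T ≅ lookup L j → j ≡ i))

signPow : ℕ → ℤ
signPow zero = + 1
signPow (suc n) = - signPow n

signedSum : ∀ {m} → List (LTree m) → ℤ
signedSum = foldr (λ T s → signPow (iE T) +ℤ s) (+ 0)

-- Γ on {P,Q} ∪ [n], encoded as Fin (2 + n): P = 0, Q = 1, i ∈ [n] ↦ 2 + i

P Q : ∀ {n} → Fin (suc (suc n))
P = fz
Q = fs fz

emb : ∀ {n} → Fin n → Fin (suc (suc n))
emb i = fs (fs i)

restrict : ∀ {n} → (Fin (suc (suc n)) → Fin (suc (suc n)) → Bool) → Fin n → Fin n → Bool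
restrict Γ i j = Γ (emb i) (emb j)

IsDominating : ∀ {m} → (Fin m → Fin m → Bool) → Fin m → Set
IsDominating Γ v = ∀ w → w ≢ v → Adj Γ v w

-- Orientations of a graph G on Fin n, as Bool matrices: o i j = true means i → j

orient : ∀ {n} → Vec (Vec Bool n) n → Fin n → Fin n → Bool
orient O i j = vlookup (vlookup O i) j

IsOrientation : ∀ {n} → (Fin n → Fin n → Bool) → Vec (Vec Bool n) n → Set
IsOrientation G O =
  (∀ i j → orient O i j ≡ true → G i j ≡ true) ×
  (∀ i j → G i j ≡ true → orient O i j ≡ not (orient O j i))

IsACO : ∀ {n} → (Fin n → Fin n → Bool) → Vec (Vec Bool n) n → Set
IsACO G O = IsOrientation G O × ¬ HasCycle (Adj (orient O)) 1

{-# OPTIONS --safe #-}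

-- Root every tree at the leaf P.  The leaf sets below its internal vertices form a laminar family
-- F ∋ ⊤ of subsets of {Q} ∪ [n], each containing a Γ-edge; F determines the tree up to isomorphism,
-- every such family occurs, and i(T) = |F| - 1.  (Sides containing P or Q impose no condition beyond
-- having two leaves, as these vertices dominate.)  The members of F containing Q form a chain, that
-- is, an ordered set partition of [n].  For a fixed chain, if some block contains an edge then adding
-- or removing that block as a cluster is a sign-reversing involution; if all blocks are independent
-- there is no further cluster.  What remains is the alternating sum over ordered partitions of [n]
-- into independent blocks.  Writing K(S) for the analogous sum over a subset S, removing the last
-- block gives Σ K(B) = 0 over all B ⊆ S with S ∖ B independent, for S ≠ ∅.  The numbers
-- (-1)^|S| |ACO(S)| satisfy the same recursion, because each acyclic orientation of S has a source
-- and the alternating sum over all sets S ∖ B of sources vanishes.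

module Submission where

open import Defs
open import Data.Nat using (ℕ; zero; suc; _+_; _*_; _∸_; _≤_; _<_; z≤n; s≤s; _≤?_; _<ᵇ_; _≤′_; ≤′-reflexive; ≤′-step)
import Data.Nat.Properties as ℕₚ
open import Data.Fin using (Fin; zero; suc; toℕ)
import Data.Fin.Properties as Finₚ
open import Data.Bool using (Bool; true; false; not; _∧_; _xor_; if_then_else_)
import Data.Bool.Properties as Boolₚ
open import Data.Empty using (⊥-elim)
open import Data.Sum using (_⊎_; inj₁; inj₂; [_,_]′)
import Data.Sum.Properties as Sumₚ
open import Data.Product using (Σ; ∃; _×_; _,_; proj₁; proj₂)
open import Data.List using (List; []; _∷_; _++_; _∷ʳ_; length; map; filter; filterᵇ; lookup; concatMap; cartesianProduct)
import Data.List.Properties as Listₚ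
open import Data.List.Extrema ℕₚ.≤-totalOrder using (argmin; argmin-all; f[argmin]≤f[xs]; max; xs≤max)
open import Data.List.Relation.Unary.All using (All; []; _∷_)
import Data.List.Relation.Unary.All as All
import Data.List.Relation.Unary.All.Properties as Allₚ
open import Data.List.Relation.Unary.Any using (here; there; index)
open import Data.List.Relation.Unary.Any.Properties using (lookup-index)
open import Data.List.Relation.Unary.AllPairs using ([]; _∷_)
open import Data.List.Relation.Unary.Unique.Propositional using (Unique)
import Data.List.Relation.Unary.Unique.Propositional.Properties as Uniqueₚ
import Data.List.Relation.Unary.Unique.DecPropositional as DecUnique
open import Data.List.Relation.Unary.Linked using (Linked; []; [-]; _∷_; linked?)
open import Data.List.Membership.Propositional using (_∈_)
open import Data.List.Membership.Propositional.Properties using (∈-map⁺; ∈-map⁻; ∈-++⁺ˡ; ∈-++⁺ʳ; ∈-++⁻; ∈-filter⁺; ∈-filter⁻; ∈-cartesianProduct⁺; ∈-tabulate⁺; ∈-tabulate⁻; ∈-lookup; ∈-∃++)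
import Data.List.Membership.DecPropositional as DecMembership
open import Data.List.Membership.Propositional.Properties.WithK using (unique∧set⇒bag)
open import Data.List.Relation.Binary.BagAndSetEquality using (∼bag⇒↭)
open import Data.List.Relation.Binary.Permutation.Propositional using (_↭_; refl; prep; swap) renaming (trans to ↭-trans)
open import Data.List.Relation.Binary.Permutation.Propositional.Properties using (↭-length)
open import Data.Vec using (Vec; []; _∷_; here; there; tabulate)
import Data.Vec.Properties as Vecₚ
open import Data.Vec.Relation.Binary.Pointwise.Extensional using (ext; Pointwise-≡⇒≡)
open import Data.Fin.Subset using (Subset; ⊤; ⊥; ⁅_⁆; _⊆_; _⊂_; Nonempty) renaming (_∈_ to _∊_; _∉_ to _∌_; ∣_∣ to ∥_∥)
import Data.Fin.Subset.Properties as Subₚ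
open import Data.Integer using (ℤ; +_; -[1+_]; ∣_∣) renaming (_+_ to _+ℤ_; _*_ to _*ℤ_; -_ to -ℤ_)
import Data.Integer.Properties as ℤₚ
open import Function using (_∘_; id; mk⇔; Equivalence; Inverse; mk↔ₛ′)
open import Relation.Binary.PropositionalEquality using (_≡_; _≢_; refl; sym; trans; cong; cong₂; subst; subst₂; module ≡-Reasoning)
open import Relation.Binary.Construct.Closure.ReflexiveTransitive using (Star; ε; _◅_; _◅◅_)
import Relation.Binary.Construct.Closure.ReflexiveTransitive as Star
open import Relation.Binary.Definitions using (DecidableEquality; tri<; tri≈; tri>)
open import Relation.Nullary using (¬_; Dec; yes; no; does)
open import Relation.Nullary.Decidable using (_×-dec_; _⊎-dec_; _→-dec_; ¬?; map′; dec-true; dec-false)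

open Equivalence using (to; from)

-- Trees come only up to isomorphism, with arbitrary vertex sets, so a sum over them cannot be
-- rearranged directly. Families of subsets serve as normal forms: they make up a finite type on
-- which each cancellation is a total involution, while side conditions become factors 0 or 1. The
-- order P, Q, [n] of the labels helps: P is 0, and once P is deleted Q is again 0, so the pair
-- structure of `Fam (suc n)` is already the division into clusters without and with Q. The obstacle
-- is the passage from trees as connected acyclic graphs to families. Acyclicity supplies no
-- parents; they are obtained from the distance to P. The degree bound at internal vertices gives
-- each of them two children, and this makes inclusion of clusters equivalent to ancestry, so that
-- the clusters determine the tree. The sign left open in the theorem is (-1)^(n+1): the signed sum
-- over nested families is (-1)^n |ACO|, and a tree has one cluster more than internal edges.

record Finite (A : Set) : Set where
  field
    elements : List A
    unique   : Unique elements
    complete : ∀ x → x ∈ elements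

open Finite

unique-↭ : {A : Set} {xs ys : List A} → Unique xs → Unique ys →
  (∀ {x} → x ∈ xs → x ∈ ys) → (∀ {x} → x ∈ ys → x ∈ xs) → xs ↭ ys
unique-↭ u v f g = ∼bag⇒↭ (unique∧set⇒bag u v (mk⇔ f g))

-- Integer sums over lists, and sign-reversing involutions

∑ : {A : Set} → List A → (A → ℤ) → ℤ
∑ []       f = + 0
∑ (x ∷ xs) f = f x +ℤ ∑ xs f

+ℤ-interchange : ∀ a b c d → (a +ℤ b) +ℤ (c +ℤ d) ≡ (a +ℤ c) +ℤ (b +ℤ d)
+ℤ-interchange a b c d = begin
  (a +ℤ b) +ℤ (c +ℤ d) ≡⟨ ℤₚ.+-assoc a b (c +ℤ d) ⟩
  a +ℤ (b +ℤ (c +ℤ d)) ≡⟨ cong (a +ℤ_) (ℤₚ.+-assoc b c d) ⟨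
  a +ℤ ((b +ℤ c) +ℤ d) ≡⟨ cong (λ z → a +ℤ (z +ℤ d)) (ℤₚ.+-comm b c) ⟩
  a +ℤ ((c +ℤ b) +ℤ d) ≡⟨ cong (a +ℤ_) (ℤₚ.+-assoc c b d) ⟩
  a +ℤ (c +ℤ (b +ℤ d)) ≡⟨ ℤₚ.+-assoc a c (b +ℤ d) ⟨
  (a +ℤ c) +ℤ (b +ℤ d) ∎
  where open ≡-Reasoning

module _ {A : Set} where

  ∑-cong : (xs : List A) {f g : A → ℤ} → (∀ x → f x ≡ g x) → ∑ xs f ≡ ∑ xs g
  ∑-cong []       h = refl
  ∑-cong (x ∷ xs) h = cong₂ _+ℤ_ (h x) (∑-cong xs h)

  ∑-zero : (xs : List A) {f : A → ℤ} → (∀ x → x ∈ xs → f x ≡ + 0) → ∑ xs f ≡ + 0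
  ∑-zero []       h = refl
  ∑-zero (x ∷ xs) h = cong₂ _+ℤ_ (h x (here refl)) (∑-zero xs (λ y → h y ∘ there))

  ∑-+ : (xs : List A) (f g : A → ℤ) → ∑ xs (λ x → f x +ℤ g x) ≡ ∑ xs f +ℤ ∑ xs g
  ∑-+ []       f g = refl
  ∑-+ (x ∷ xs) f g =
    trans (cong ((f x +ℤ g x) +ℤ_) (∑-+ xs f g)) (+ℤ-interchange (f x) (g x) _ _)

  ∑-*ˡ : (c : ℤ) (xs : List A) (f : A → ℤ) → ∑ xs (λ x → c *ℤ f x) ≡ c *ℤ ∑ xs f
  ∑-*ˡ c []       f = sym (ℤₚ.*-zeroʳ c)
  ∑-*ˡ c (x ∷ xs) f =
    trans (cong (c *ℤ f x +ℤ_) (∑-*ˡ c xs f)) (sym (ℤₚ.*-distribˡ-+ c (f x) (∑ xs f)))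

  ∑-*ʳ : (c : ℤ) (xs : List A) (f : A → ℤ) → ∑ xs (λ x → f x *ℤ c) ≡ ∑ xs f *ℤ c
  ∑-*ʳ c xs f = trans (∑-cong xs (λ x → ℤₚ.*-comm (f x) c))
    (trans (∑-*ˡ c xs f) (ℤₚ.*-comm c (∑ xs f)))

  ∑-neg : (xs : List A) (f : A → ℤ) → ∑ xs (λ x → -ℤ f x) ≡ -ℤ ∑ xs f
  ∑-neg []       f = refl
  ∑-neg (x ∷ xs) f =
    trans (cong (-ℤ f x +ℤ_) (∑-neg xs f)) (sym (ℤₚ.neg-distrib-+ (f x) (∑ xs f)))

  ∑-↭ : {xs ys : List A} (f : A → ℤ) → xs ↭ ys → ∑ xs f ≡ ∑ ys f
  ∑-↭ f refl = refl
  ∑-↭ f (prep x p) = cong (f x +ℤ_) (∑-↭ f p)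
  ∑-↭ {x ∷ y ∷ xs} {_ ∷ _ ∷ ys} f (swap _ _ p) = begin
    f x +ℤ (f y +ℤ ∑ xs f) ≡⟨ ℤₚ.+-assoc (f x) (f y) _ ⟨
    (f x +ℤ f y) +ℤ ∑ xs f ≡⟨ cong₂ _+ℤ_ (ℤₚ.+-comm (f x) (f y)) (∑-↭ f p) ⟩
    (f y +ℤ f x) +ℤ ∑ ys f ≡⟨ ℤₚ.+-assoc (f y) (f x) _ ⟩
    f y +ℤ (f x +ℤ ∑ ys f) ∎
    where open ≡-Reasoning
  ∑-↭ f (↭-trans p q) = trans (∑-↭ f p) (∑-↭ f q)

  ∑-++ : (xs ys : List A) (f : A → ℤ) → ∑ (xs ++ ys) f ≡ ∑ xs f +ℤ ∑ ys f
  ∑-++ []       ys f = sym (ℤₚ.+-identityˡ _)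
  ∑-++ (x ∷ xs) ys f =
    trans (cong (f x +ℤ_) (∑-++ xs ys f)) (sym (ℤₚ.+-assoc (f x) (∑ xs f) (∑ ys f)))

  ∑-map : {B : Set} (h : B → A) (xs : List B) (f : A → ℤ) → ∑ (map h xs) f ≡ ∑ xs (f ∘ h)
  ∑-map h []       f = refl
  ∑-map h (x ∷ xs) f = cong (f (h x) +ℤ_) (∑-map h xs f)

∑-cartesianProduct : {A B : Set} (xs : List A) (ys : List B) (f : A × B → ℤ) →
  ∑ (cartesianProduct xs ys) f ≡ ∑ xs (λ x → ∑ ys (λ y → f (x , y)))
∑-cartesianProduct []       ys f = refl
∑-cartesianProduct (x ∷ xs) ys f =
  trans (∑-++ (map (x ,_) ys) (cartesianProduct xs ys) f)
    (cong₂ _+ℤ_ (∑-map (x ,_) ys f) (∑-cartesianProduct xs ys f))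

∑-swap : {A B : Set} (xs : List A) (ys : List B) (f : A → B → ℤ) →
  ∑ xs (λ x → ∑ ys (f x)) ≡ ∑ ys (λ y → ∑ xs (λ x → f x y))
∑-swap []       ys f = sym (∑-zero ys (λ _ _ → refl))
∑-swap (x ∷ xs) ys f =
  trans (cong (∑ ys (f x) +ℤ_) (∑-swap xs ys f)) (sym (∑-+ ys (f x) _))

module _ {A : Set} (fin : Finite A) where

  ∑-involution : (τ : A → A) → (∀ x → τ (τ x) ≡ x) → (f : A → ℤ) →
    ∑ (elements fin) f ≡ ∑ (elements fin) (f ∘ τ)
  ∑-involution τ inv f = trans (sym (∑-↭ f perm)) (∑-map τ (elements fin) f)
    where
    τ-injective : ∀ {x y} → τ x ≡ τ y → x ≡ y
    τ-injective {x} {y} eq = trans (sym (inv x)) (trans (cong τ eq) (inv y))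
    perm : map τ (elements fin) ↭ elements fin
    perm = unique-↭ (Uniqueₚ.map⁺ τ-injective (unique fin)) (unique fin)
      (λ _ → complete fin _)
      (λ {x} _ → subst (_∈ map τ (elements fin)) (inv x) (∈-map⁺ τ (complete fin (τ x))))

  -- The change of variable `τ` makes the sum equal to its own negative. A fixed point causes no
  -- trouble, because `rev` forces `f` to vanish there.
  ∑-reversing : (τ : A → A) → (∀ x → τ (τ x) ≡ x) → (f : A → ℤ) →
    (∀ x → f (τ x) ≡ -ℤ f x) → ∑ (elements fin) f ≡ + 0
  ∑-reversing τ inv f rev = self-negative _ (trans (∑-involution τ inv f)
      (trans (∑-cong (elements fin) rev) (∑-neg (elements fin) f)))
    where
    self-negative : ∀ i → i ≡ -ℤ i → i ≡ + 0
    self-negative (+ zero)    _  = refl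
    self-negative (+ suc n)   ()
    self-negative (-[1+ n ]) ()

-- The Iverson bracket. With conditions as factors, sums run over whole finite types, and an
-- involution only has to respect the bracket.
⟦_⟧ : {A : Set} → Dec A → ℤ
⟦ d ⟧ = if does d then + 1 else + 0

⟦⟧-true : {A : Set} (d : Dec A) → A → ⟦ d ⟧ ≡ + 1
⟦⟧-true d a rewrite dec-true d a = refl

⟦⟧-false : {A : Set} (d : Dec A) → ¬ A → ⟦ d ⟧ ≡ + 0
⟦⟧-false d a rewrite dec-false d a = refl

⟦⟧-cong : {A B : Set} (d : Dec A) (e : Dec B) → (A → B) → (B → A) → ⟦ d ⟧ ≡ ⟦ e ⟧
⟦⟧-cong (yes a) e f g = sym (⟦⟧-true e (f a))
⟦⟧-cong (no ¬a) e f g = sym (⟦⟧-false e (¬a ∘ g))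

⟦⟧-× : {A B C : Set} (d : Dec A) (e : Dec B) (c : Dec C) → (A → B → C) → (C → A × B) →
  ⟦ d ⟧ *ℤ ⟦ e ⟧ ≡ ⟦ c ⟧
⟦⟧-× (yes a) (yes b) c f g = sym (⟦⟧-true c (f a b))
⟦⟧-× (yes a) (no ¬b) c f g = sym (⟦⟧-false c (¬b ∘ proj₂ ∘ g))
⟦⟧-× (no ¬a) e       c f g = sym (⟦⟧-false c (¬a ∘ proj₁ ∘ g))

∑-filter : {A : Set} {P : A → Set} (P? : ∀ x → Dec (P x)) (xs : List A) (f : A → ℤ) →
  ∑ (filter P? xs) f ≡ ∑ xs (λ x → ⟦ P? x ⟧ *ℤ f x)
∑-filter P? []       f = refl
∑-filter P? (x ∷ xs) f with P? x
... | yes _ = cong₂ _+ℤ_ (sym (ℤₚ.*-identityˡ (f x))) (∑-filter P? xs f)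
... | no  _ = trans (∑-filter P? xs f) (sym (ℤₚ.+-identityˡ _))

∑-length : {A : Set} (xs : List A) → ∑ xs (λ _ → + 1) ≡ + length xs
∑-length []       = refl
∑-length (x ∷ xs) = cong (+ 1 +ℤ_) (∑-length xs)

module _ {A : Set} (fin : Finite A) {P : A → Set} (P? : ∀ x → Dec (P x)) where

  ∑-indicator-unique : ∀ a → P a → (∀ x → P x → x ≡ a) → (f : A → ℤ) →
    ∑ (elements fin) (λ x → ⟦ P? x ⟧ *ℤ f x) ≡ f a
  ∑-indicator-unique a pa only f = go (elements fin) (unique fin) (complete fin a)
    where
    vanish : ∀ x → x ≢ a → ⟦ P? x ⟧ *ℤ f x ≡ + 0
    vanish x x≢a rewrite ⟦⟧-false (P? x) (x≢a ∘ only x) = refl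
    go : ∀ xs → Unique xs → a ∈ xs → ∑ xs (λ x → ⟦ P? x ⟧ *ℤ f x) ≡ f a
    go (.a ∷ xs) (a∉ ∷ _) (here refl) rewrite ⟦⟧-true (P? a) pa = begin
      + 1 *ℤ f a +ℤ ∑ xs _
        ≡⟨ cong₂ _+ℤ_ (ℤₚ.*-identityˡ (f a))
             (∑-zero xs (λ x x∈ → vanish x (λ x≡a → All.lookup a∉ x∈ (sym x≡a)))) ⟩
      f a +ℤ + 0 ≡⟨ ℤₚ.+-identityʳ (f a) ⟩
      f a ∎
      where open ≡-Reasoning
    go (x ∷ xs) (x∉ ∷ u) (there a∈) =
      trans (cong₂ _+ℤ_ (vanish x (All.lookup x∉ a∈)) (go xs u a∈)) (ℤₚ.+-identityˡ _)

  ∑-indicator-none : (∀ x → ¬ P x) → (f : A → ℤ) →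
    ∑ (elements fin) (λ x → ⟦ P? x ⟧ *ℤ f x) ≡ + 0
  ∑-indicator-none none f = ∑-zero (elements fin) vanish
    where
    vanish : ∀ x → x ∈ elements fin → ⟦ P? x ⟧ *ℤ f x ≡ + 0
    vanish x _ rewrite ⟦⟧-false (P? x) (none x) = refl

-- Enumerations

×-finite : {A B : Set} → Finite A → Finite B → Finite (A × B)
×-finite a b = record
  { elements = cartesianProduct (elements a) (elements b)
  ; unique   = Uniqueₚ.cartesianProduct⁺ (unique a) (unique b)
  ; complete = λ (x , y) → ∈-cartesianProduct⁺ (complete a x) (complete b y)
  }

Bool-finite : Finite Bool
Bool-finite = record
  { elements = false ∷ true ∷ []
  ; unique   = ((λ ()) ∷ []) ∷ [] ∷ []
  ; complete = λ { false → here refl ; true → there (here refl) }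
  }

map-finite : {A B : Set} (f : A → B) (g : B → A) →
  (∀ x → g (f x) ≡ x) → (∀ y → f (g y) ≡ y) → Finite A → Finite B
map-finite f g gf fg a = record
  { elements = map f (elements a)
  ; unique   = Uniqueₚ.map⁺ (λ {x} {y} eq → trans (sym (gf x)) (trans (cong g eq) (gf y))) (unique a)
  ; complete = λ y → subst (_∈ map f (elements a)) (fg y) (∈-map⁺ f (complete a (g y)))
  }

Vec-finite : {A : Set} → Finite A → ∀ n → Finite (Vec A n)
Vec-finite a zero = record
  { elements = [] ∷ [] ; unique = [] ∷ [] ; complete = λ { [] → here refl } }
Vec-finite a (suc n) = map-finite (λ (x , xs) → x ∷ xs) (λ { (x ∷ xs) → x , xs })
  (λ _ → refl) (λ { (_ ∷ _) → refl }) (×-finite a (Vec-finite a n))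

allFin-complete : ∀ {n} (i : Fin n) → i ∈ allFin n
allFin-complete zero    = here refl
allFin-complete (suc i) = there (∈-map⁺ suc (allFin-complete i))

allFin-unique : ∀ n → Unique (allFin n)
allFin-unique zero    = []
allFin-unique (suc n) =
  Allₚ.map⁺ (All.universal (λ _ ()) _) ∷ Uniqueₚ.map⁺ Finₚ.suc-injective (allFin-unique n)

Subset-finite : ∀ n → Finite (Subset n)
Subset-finite = Vec-finite Bool-finite

∀-subset? : ∀ {n} {P : Subset n → Set} → (∀ A → Dec (P A)) → Dec (∀ A → P A)
∀-subset? P? with Subₚ.anySubset? (λ A → ¬? (P? A))
... | yes (A , ¬p) = no (λ h → ¬p (h A))
... | no  none     = yes decide
  where
  decide : ∀ A → _
  decide A with P? A
  ... | yes p = p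
  ... | no ¬p = ⊥-elim (none (A , ¬p))

unique-⊆-length : {A : Set} {xs ys : List A} → Unique xs → (∀ {x} → x ∈ xs → x ∈ ys) →
  length xs ≤ length ys
unique-⊆-length {xs = []} u sub = z≤n
unique-⊆-length {xs = x ∷ xs} (x∉ ∷ u) sub with ∈-∃++ (sub (here refl))
... | ps , qs , refl = subst (suc (length xs) ≤_) (sym len)
    (s≤s (unique-⊆-length u shrink))
  where
  len : length (ps ++ x ∷ qs) ≡ suc (length (ps ++ qs))
  len = trans (Listₚ.length-++ ps) (trans (ℕₚ.+-suc (length ps) (length qs))
    (cong suc (sym (Listₚ.length-++ ps))))
  shrink : ∀ {y} → y ∈ xs → y ∈ ps ++ qs
  shrink y∈ with ∈-++⁻ ps (sub (there y∈))
  ... | inj₁ p            = ∈-++⁺ˡ p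
  ... | inj₂ (here refl)  = ⊥-elim (All.lookup x∉ y∈ refl)
  ... | inj₂ (there q)    = ∈-++⁺ʳ ps q

map-unique : {A B : Set} {f : A → B} {xs : List A} → Unique xs →
  (∀ {x y} → x ∈ xs → y ∈ xs → f x ≡ f y → x ≡ y) → Unique (map f xs)
map-unique [] inj = []
map-unique {f = f} (x∉ ∷ u) inj =
  Allₚ.map⁺ (All.tabulate (λ y∈ eq → All.lookup x∉ y∈ (inj (here refl) (there y∈) eq)))
  ∷ map-unique u (λ x∈ y∈ → inj (there x∈) (there y∈))

signPow-+ : ∀ m n → signPow (m + n) ≡ signPow m *ℤ signPow n
signPow-+ zero    n = sym (ℤₚ.*-identityˡ _)
signPow-+ (suc m) n = trans (cong -ℤ_ (signPow-+ m n)) (ℤₚ.neg-distribˡ-* (signPow m) (signPow n))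

signPow-abs : ∀ m → ∣ signPow m ∣ ≡ 1
signPow-abs zero    = refl
signPow-abs (suc m) = trans (ℤₚ.∣-i∣≡∣i∣ (signPow m)) (signPow-abs m)

-- Families of subsets of Fin n, as binary decision trees: unlike Bool-valued functions they have
-- extensional propositional equality.

Fam : ℕ → Set
Fam zero    = Bool
Fam (suc n) = Fam n × Fam n

mem : ∀ {n} → Fam n → Subset n → Bool
mem {zero}  b       []          = b
mem {suc n} (F , G) (false ∷ A) = mem F A
mem {suc n} (F , G) (true ∷ A)  = mem G A

infix 4 _∈ᶠ_

_∈ᶠ_ : ∀ {n} → Subset n → Fam n → Set
A ∈ᶠ F = mem F A ≡ true

_∈ᶠ?_ : ∀ {n} (A : Subset n) (F : Fam n) → Dec (A ∈ᶠ F)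
A ∈ᶠ? F = mem F A Boolₚ.≟ true

fam-ext : ∀ {n} {F G : Fam n} → (∀ A → mem F A ≡ mem G A) → F ≡ G
fam-ext {zero}  h = h []
fam-ext {suc n} h = cong₂ _,_ (fam-ext (h ∘ (false ∷_))) (fam-ext (h ∘ (true ∷_)))

⇔-true : ∀ {b c : Bool} → (b ≡ true → c ≡ true) → (c ≡ true → b ≡ true) → b ≡ c
⇔-true {true}  {c}     f g = sym (f refl)
⇔-true {false} {true}  f g = g refl
⇔-true {false} {false} f g = refl

fam-ext-⇔ : ∀ {n} {F G : Fam n} → (∀ A → A ∈ᶠ F → A ∈ᶠ G) → (∀ A → A ∈ᶠ G → A ∈ᶠ F) → F ≡ G
fam-ext-⇔ f g = fam-ext (λ A → ⇔-true (f A) (g A))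

comprehend : ∀ {n} → (Subset n → Bool) → Fam n
comprehend {zero}  p = p []
comprehend {suc n} p = comprehend (p ∘ (false ∷_)) , comprehend (p ∘ (true ∷_))

mem-comprehend : ∀ {n} (p : Subset n → Bool) A → mem (comprehend p) A ≡ p A
mem-comprehend {zero}  p []          = refl
mem-comprehend {suc n} p (false ∷ A) = mem-comprehend (p ∘ (false ∷_)) A
mem-comprehend {suc n} p (true ∷ A)  = mem-comprehend (p ∘ (true ∷_)) A

-- Symmetric difference with the family whose only member is `A`. Every involution of families in
-- this proof has this form.
toggle : ∀ {n} → Subset n → Fam n → Fam n
toggle {zero}  []          b       = not b
toggle {suc n} (false ∷ A) (F , G) = toggle A F , G
toggle {suc n} (true ∷ A)  (F , G) = F , toggle A G

toggle-involutive : ∀ {n} (A : Subset n) F → toggle A (toggle A F) ≡ F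
toggle-involutive []          b       = Boolₚ.not-involutive b
toggle-involutive (false ∷ A) (F , G) = cong (_, G) (toggle-involutive A F)
toggle-involutive (true ∷ A)  (F , G) = cong (F ,_) (toggle-involutive A G)

mem-toggle-≡ : ∀ {n} (A : Subset n) F → mem (toggle A F) A ≡ not (mem F A)
mem-toggle-≡ []          b       = refl
mem-toggle-≡ (false ∷ A) (F , G) = mem-toggle-≡ A F
mem-toggle-≡ (true ∷ A)  (F , G) = mem-toggle-≡ A G

mem-toggle-≢ : ∀ {n} (A : Subset n) F B → B ≢ A → mem (toggle A F) B ≡ mem F B
mem-toggle-≢ []          b       []          B≢A = ⊥-elim (B≢A refl)
mem-toggle-≢ (false ∷ A) (F , G) (false ∷ B) B≢A = mem-toggle-≢ A F B (B≢A ∘ cong (false ∷_))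
mem-toggle-≢ (false ∷ A) (F , G) (true ∷ B)  B≢A = refl
mem-toggle-≢ (true ∷ A)  (F , G) (false ∷ B) B≢A = refl
mem-toggle-≢ (true ∷ A)  (F , G) (true ∷ B)  B≢A = mem-toggle-≢ A G B (B≢A ∘ cong (true ∷_))

members : ∀ {n} → Fam n → List (Subset n)
members {zero}  true    = [] ∷ []
members {zero}  false   = []
members {suc n} (F , G) = map (false ∷_) (members F) ++ map (true ∷_) (members G)

members-∈ : ∀ {n} (F : Fam n) A → A ∈ᶠ F → A ∈ members F
members-∈ {zero}  true    []          _ = here refl
members-∈ {suc n} (F , G) (false ∷ A) m = ∈-++⁺ˡ (∈-map⁺ (false ∷_) (members-∈ F A m))
members-∈ {suc n} (F , G) (true ∷ A)  m = ∈-++⁺ʳ _ (∈-map⁺ (true ∷_) (members-∈ G A m))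

∈-members : ∀ {n} (F : Fam n) A → A ∈ members F → A ∈ᶠ F
∈-members {zero}  true    []      _ = refl
∈-members {suc n} (F , G) A A∈ with ∈-++⁻ (map (false ∷_) (members F)) A∈
... | inj₁ p with ∈-map⁻ (false ∷_) p
...   | B , B∈ , refl = ∈-members F B B∈
∈-members {suc n} (F , G) A A∈ | inj₂ p with ∈-map⁻ (true ∷_) p
...   | B , B∈ , refl = ∈-members G B B∈

members-unique : ∀ {n} (F : Fam n) → Unique (members F)
members-unique {zero}  true    = [] ∷ []
members-unique {zero}  false   = []
members-unique {suc n} (F , G) = Uniqueₚ.++⁺
  (Uniqueₚ.map⁺ Vecₚ.∷-injectiveʳ (members-unique F))
  (Uniqueₚ.map⁺ Vecₚ.∷-injectiveʳ (members-unique G))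
  disjoint
  where
  disjoint : ∀ {A} → ¬ (A ∈ map (false ∷_) (members F) × A ∈ map (true ∷_) (members G))
  disjoint (p , q) with ∈-map⁻ (false ∷_) p | ∈-map⁻ (true ∷_) q
  ... | _ , _ , refl | _ , _ , ()

card : ∀ {n} → Fam n → ℕ
card F = length (members F)

card-pair : ∀ {n} (F G : Fam n) → card {suc n} (F , G) ≡ card F + card G
card-pair F G = trans (Listₚ.length-++ (map (false ∷_) (members F)))
  (cong₂ _+_ (Listₚ.length-map _ (members F)) (Listₚ.length-map _ (members G)))

sgn : ∀ {n} → Fam n → ℤ
sgn F = signPow (card F)

sgn-pair : ∀ {n} (F G : Fam n) → sgn {suc n} (F , G) ≡ sgn F *ℤ sgn G
sgn-pair F G = trans (cong signPow (card-pair F G)) (signPow-+ (card F) (card G))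

sgn-toggle : ∀ {n} (A : Subset n) F → sgn (toggle A F) ≡ -ℤ sgn F
sgn-toggle []          true    = refl
sgn-toggle []          false   = refl
sgn-toggle (false ∷ A) (F , G) = begin
  sgn (toggle A F , G)      ≡⟨ sgn-pair (toggle A F) G ⟩
  sgn (toggle A F) *ℤ sgn G ≡⟨ cong (_*ℤ sgn G) (sgn-toggle A F) ⟩
  -ℤ sgn F *ℤ sgn G         ≡⟨ ℤₚ.neg-distribˡ-* (sgn F) (sgn G) ⟨
  -ℤ (sgn F *ℤ sgn G)       ≡⟨ cong -ℤ_ (sgn-pair F G) ⟨
  -ℤ sgn (F , G)            ∎
  where open ≡-Reasoning
sgn-toggle (true ∷ A)  (F , G) = begin
  sgn (F , toggle A G)      ≡⟨ sgn-pair F (toggle A G) ⟩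
  sgn F *ℤ sgn (toggle A G) ≡⟨ cong (sgn F *ℤ_) (sgn-toggle A G) ⟩
  sgn F *ℤ -ℤ sgn G         ≡⟨ ℤₚ.neg-distribʳ-* (sgn F) (sgn G) ⟨
  -ℤ (sgn F *ℤ sgn G)       ≡⟨ cong -ℤ_ (sgn-pair F G) ⟨
  -ℤ sgn (F , G)            ∎
  where open ≡-Reasoning

Fam-finite : ∀ n → Finite (Fam n)
Fam-finite zero    = Bool-finite
Fam-finite (suc n) = ×-finite (Fam-finite n) (Fam-finite n)

∅ᶠ : ∀ {n} → Fam n
∅ᶠ = comprehend (λ _ → false)

∉∅ᶠ : ∀ {n} (A : Subset n) → ¬ (A ∈ᶠ ∅ᶠ)
∉∅ᶠ A A∈ with trans (sym (mem-comprehend (λ _ → false) A)) A∈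
... | ()

sgn-∅ᶠ : ∀ n → sgn (∅ᶠ {n}) ≡ + 1
sgn-∅ᶠ zero    = refl
sgn-∅ᶠ (suc n) = trans (sgn-pair {n} ∅ᶠ ∅ᶠ) (cong₂ _*ℤ_ (sgn-∅ᶠ n) (sgn-∅ᶠ n))

toggle-∈ : ∀ {n} (A : Subset n) {F} B → B ≢ A → B ∈ᶠ toggle A F → B ∈ᶠ F
toggle-∈ A {F} B ne = trans (sym (mem-toggle-≢ A F B ne))

∈-toggle : ∀ {n} (A : Subset n) {F} B → B ≢ A → B ∈ᶠ F → B ∈ᶠ toggle A F
∈-toggle A {F} B ne = trans (mem-toggle-≢ A F B ne)

_≟ˢ_ : ∀ {n} → DecidableEquality (Subset n)
_≟ˢ_ = Vecₚ.≡-dec Boolₚ._≟_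

-- Acyclic orientations

length-allFin : ∀ n → length (allFin n) ≡ n
length-allFin zero    = refl
length-allFin (suc n) = cong suc (trans (Listₚ.length-map suc (allFin n)) (length-allFin n))

unique-length≤ : ∀ {n} {xs : List (Fin n)} → Unique xs → length xs ≤ n
unique-length≤ {n} {xs} u =
  subst (length xs ≤_) (length-allFin n) (unique-⊆-length u (λ _ → allFin-complete _))

∃-boundedList? : ∀ {n} m {P : List (Fin n) → Set} → (∀ xs → Dec (P xs)) →
  Dec (∃ λ xs → length xs ≤ m × P xs)
∃-boundedList? zero P? = map′ (λ p → [] , z≤n , p) (λ { ([] , _ , p) → p }) (P? [])
∃-boundedList? (suc m) P? = map′
  (λ { (inj₁ p) → [] , z≤n , p ; (inj₂ (x , xs , le , p)) → x ∷ xs , s≤s le , p })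
  (λ { ([] , _ , p) → inj₁ p ; (x ∷ xs , s≤s le , p) → inj₂ (x , xs , le , p) })
  (P? [] ⊎-dec Finₚ.any? (λ x → ∃-boundedList? m (λ xs → P? (x ∷ xs))))

-- The vertices of a cycle are distinct, so by the pigeonhole principle a search among lists of
-- length at most `n` is exhaustive.
hasCycle? : ∀ {n} {R : Fin n → Fin n → Set} → (∀ x y → Dec (R x y)) → ∀ r → Dec (HasCycle R r)
hasCycle? {n} R? r = map′
  (λ (v , vs , _ , c) → v , vs , c)
  (λ { (v , vs , u , c) → v , vs , bound u , u , c })
  (Finₚ.any? λ v → ∃-boundedList? n λ vs →
    DecUnique.unique? Finₚ._≟_ (v ∷ vs) ×-dec (r ≤? length (v ∷ vs)) ×-dec linked? R? ((v ∷ vs) ∷ʳ v))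
  where
  bound : ∀ {v vs} → Unique (v ∷ vs) → length vs ≤ n
  bound u = ℕₚ.≤-trans (ℕₚ.n≤1+n _) (unique-length≤ u)

isACO? : ∀ {n} (G : Fin n → Fin n → Bool) O → Dec (IsACO G O)
isACO? G O =
  ((Finₚ.all? λ i → Finₚ.all? λ j → (orient O i j Boolₚ.≟ true) →-dec (G i j Boolₚ.≟ true)) ×-dec
   (Finₚ.all? λ i → Finₚ.all? λ j → (G i j Boolₚ.≟ true) →-dec (orient O i j Boolₚ.≟ not (orient O j i))))
  ×-dec ¬? (hasCycle? (λ x y → orient O x y Boolₚ.≟ true) 1)

Linked-map-All : {A : Set} {P : A → Set} {R S : A → A → Set} {xs : List A} →
  (∀ {x y} → P x → R x y → S x y) → All P xs → Linked R xs → Linked S xs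
Linked-map-All f ps       []       = []
Linked-map-All f ps       [-]      = [-]
Linked-map-All f (p ∷ ps) (r ∷ rs) = f p r ∷ Linked-map-All f ps rs

∷ʳ-All : {A : Set} {P : A → Set} (xs : List A) {y : A} → All P (xs ∷ʳ y) → P y × All P xs
∷ʳ-All xs ps with Allₚ.++⁻ xs ps
... | qs , (p ∷ []) = p , qs

cycle-All : {A : Set} {P : A → Set} {R : A → A → Set} → (∀ {x y} → R x y → P y) →
  ∀ v vs → Linked R ((v ∷ vs) ∷ʳ v) → All P ((v ∷ vs) ∷ʳ v)
cycle-All {P = P} {R} f v vs l = let ps = targets vs l in proj₁ (∷ʳ-All vs ps) ∷ ps
  where
  targets : ∀ {x} ys {z} → Linked R ((x ∷ ys) ∷ʳ z) → All P (ys ∷ʳ z)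
  targets []       (r ∷ [-]) = f r ∷ []
  targets (y ∷ ys) (r ∷ rs)  = f r ∷ targets ys rs

-- Every vertex of a cycle is the head of one of its arcs, so a property of all heads holds along
-- the whole cycle. Thus a cycle avoids sources.
HasCycle-map : {V : Set} {P : V → Set} {R S : V → V → Set} {r : ℕ} →
  (∀ {x y} → R x y → P y) → (∀ {x y} → P x → R x y → S x y) → HasCycle R r → HasCycle S r
HasCycle-map tgt f (v , vs , u , len , l) =
  v , vs , u , len , Linked-map-All f (cycle-All tgt v vs l) l

-- `ps` is the part of the walk before `u`; an arc from `u` to the head `v` then closes it to a
-- cycle. The start `w` of that arc is kept general so that the recursion can insert the preceding
-- vertex of the walk.
cut : ∀ {V : Set} {R : V → V → Set} {u v : V} {vs} → u ∈ v ∷ vs → Unique (v ∷ vs) → Linked R (v ∷ vs) →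
  ∃ λ ps → Unique (u ∷ ps) × All (_∈ v ∷ vs) ps × (∀ {w} → R w v → Linked R (w ∷ (ps ∷ʳ u)))
cut (here refl) _ _ = [] , [] ∷ [] , [] , (λ r → r ∷ [-])
cut {u = u} {v} {v' ∷ vs} (there u∈) (v∉ ∷ un) (r ∷ l) with cut u∈ un l
... | ps , u∉ ∷ ps! , ps⊆ , close =
  v ∷ ps ,
  (((λ u≡v → All.lookup v∉ u∈ (sym u≡v)) ∷ u∉) ∷ (All.map (All.lookup v∉) ps⊆ ∷ ps!)) ,
  here refl ∷ All.map there ps⊆ ,
  (λ s → s ∷ close r)

-- A walk backwards inside `S` must repeat a vertex. Fuel plus length stays above `n`, so exhausted
-- fuel would mean more than `n` distinct vertices.
predecessors⇒cycle : ∀ {n} {R : Fin n → Fin n → Set} {S : Fin n → Set} →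
  (∀ v → S v → ∃ λ u → S u × R u v) → ∀ v → S v → HasCycle R 1
predecessors⇒cycle {n} {R} {S} pre v₀ s₀ = grow n v₀ [] s₀ ([] ∷ []) [-] (ℕₚ.≤-reflexive (sym (ℕₚ.+-comm n 1)))
  where
  open DecMembership (Finₚ._≟_ {n}) using (_∈?_)
  grow : ∀ fuel v vs → S v → Unique (v ∷ vs) → Linked R (v ∷ vs) → n < fuel + length (v ∷ vs) → HasCycle R 1
  grow zero v vs s un l lt = ⊥-elim (ℕₚ.<⇒≱ lt (unique-length≤ un))
  grow (suc fuel) v vs s un l lt with pre v s
  ... | u , su , r with u ∈? (v ∷ vs)
  ...   | yes u∈ = let (ps , un' , _ , close) = cut u∈ un l in
          u , ps , un' , s≤s z≤n , close r
  ...   | no  u∉ = grow fuel u (v ∷ vs) su (Allₚ.¬Any⇒All¬ _ u∉ ∷ un) (r ∷ l)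
          (subst (n <_) (sym (ℕₚ.+-suc fuel _)) lt)

-- The recursion for the numbers of acyclic orientations

flip : ∀ {n} → Fin n → Subset n → Subset n
flip zero    (b ∷ B) = not b ∷ B
flip (suc i) (b ∷ B) = b ∷ flip i B

flip-involutive : ∀ {n} (i : Fin n) B → flip i (flip i B) ≡ B
flip-involutive zero    (b ∷ B) = cong (_∷ B) (Boolₚ.not-involutive b)
flip-involutive (suc i) (b ∷ B) = cong (b ∷_) (flip-involutive i B)

flip-sign : ∀ {n} (i : Fin n) B → signPow ∥ flip i B ∥ ≡ -ℤ signPow ∥ B ∥
flip-sign zero    (true ∷ B)  = sym (ℤₚ.neg-involutive _)
flip-sign zero    (false ∷ B) = refl
flip-sign (suc i) (true ∷ B)  = cong -ℤ_ (flip-sign i B)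
flip-sign (suc i) (false ∷ B) = flip-sign i B

flip-∊ : ∀ {n} {i j : Fin n} {B} → j ≢ i → j ∊ B → j ∊ flip i B
flip-∊ {i = zero}  {zero}  ne m         = ⊥-elim (ne refl)
flip-∊ {i = zero}  {suc j} ne (there m) = there m
flip-∊ {i = suc i} {zero}  ne here      = here
flip-∊ {i = suc i} {suc j} ne (there m) = there (flip-∊ (ne ∘ cong suc) m)

∊-flip : ∀ {n} {i j : Fin n} {B} → j ≢ i → j ∊ flip i B → j ∊ B
∊-flip {i = i} {j} {B} ne m = subst (j ∊_) (flip-involutive i B) (flip-∊ ne m)

Matrix : ℕ → Set
Matrix n = Vec (Vec Bool n) n

Matrix-finite : ∀ n → Finite (Matrix n)
Matrix-finite n = Vec-finite (Vec-finite Bool-finite n) n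

matrix : ∀ {n} → (Fin n → Fin n → Bool) → Matrix n
matrix f = tabulate (λ i → tabulate (f i))

orient-matrix : ∀ {n} (f : Fin n → Fin n → Bool) i j → orient (matrix f) i j ≡ f i j
orient-matrix f i j rewrite Vecₚ.lookup∘tabulate (λ i → tabulate (f i)) i = Vecₚ.lookup∘tabulate (f i) j

matrix-ext : ∀ {n} {O O' : Matrix n} → (∀ i j → orient O i j ≡ orient O' i j) → O ≡ O'
matrix-ext h = Pointwise-≡⇒≡ (ext (λ i → Pointwise-≡⇒≡ (ext (h i))))

_∊?_ : ∀ {n} (i : Fin n) (A : Subset n) → Dec (i ∊ A)
_∊?_ = Subₚ._∈?_

module _ {n : ℕ} (G : Fin n → Fin n → Bool) where

  -- Vertices outside `S` remain as isolated vertices, so the orientations of all induced subgraphs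
  -- share the type `Matrix n` and one can be toggled into another.
  induced : Subset n → Fin n → Fin n → Bool
  induced S i j = does (i ∊? S) ∧ does (j ∊? S) ∧ G i j

  induced⁺ : ∀ {S i j} → i ∊ S → j ∊ S → G i j ≡ true → induced S i j ≡ true
  induced⁺ {S} {i} {j} p q g rewrite dec-true (i ∊? S) p | dec-true (j ∊? S) q = g

  induced⁻ : ∀ {S i j} → induced S i j ≡ true → i ∊ S × j ∊ S × G i j ≡ true
  induced⁻ {S} {i} {j} e with i ∊? S | j ∊? S
  ... | yes p | yes q = p , q , e

  ACO : Subset n → Matrix n → Set
  ACO S = IsACO (induced S)

  acoCount : Subset n → ℤ
  acoCount S = ∑ (elements (Matrix-finite n)) (λ O → ⟦ isACO? (induced S) O ⟧)

  IndependentOutside : Subset n → Subset n → Set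
  IndependentOutside S B = ∀ i j → i ∊ S → i ∌ B → j ∊ S → j ∌ B → G i j ≢ true

  independentOutside? : ∀ S B → Dec (IndependentOutside S B)
  independentOutside? S B = Finₚ.all? λ i → Finₚ.all? λ j →
    (i ∊? S) →-dec ¬? (i ∊? B) →-dec (j ∊? S) →-dec ¬? (j ∊? B) →-dec ¬? (G i j Boolₚ.≟ true)

  SourcesOutside : Subset n → Subset n → Matrix n → Set
  SourcesOutside S B O = ∀ v → v ∊ S → v ∌ B → ∀ i → orient O i v ≢ true

  sourcesOutside? : ∀ S B O → Dec (SourcesOutside S B O)
  sourcesOutside? S B O = Finₚ.all? λ v → (v ∊? S) →-dec ¬? (v ∊? B) →-dec
    Finₚ.all? λ i → ¬? (orient O i v Boolₚ.≟ true)

  -- Without a source in `S`, each vertex of `S` would have a predecessor, again in `S` because arcs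
  -- of `O` are edges of the induced graph; the backward walk would close up.
  acyclic⇒source : ∀ S O → Nonempty S → ACO S O → ∃ λ s → s ∊ S × (∀ i → orient O i s ≢ true)
  acyclic⇒source S O (v , v∊S) ((O⊆ , _) , acyclic)
    with Finₚ.any? (λ s → (s ∊? S) ×-dec Finₚ.all? (λ i → ¬? (orient O i s Boolₚ.≟ true)))
  ... | yes (s , s∊S , src) = s , s∊S , src
  ... | no none = ⊥-elim (acyclic (predecessors⇒cycle {S = _∊ S} pre v v∊S))
    where
    pre : ∀ s → s ∊ S → ∃ λ u → u ∊ S × orient O u s ≡ true
    pre s s∊S with Finₚ.any? (λ i → orient O i s Boolₚ.≟ true)
    ... | yes (u , o) = u , proj₁ (induced⁻ (O⊆ u s o)) , o
    ... | no ¬o = ⊥-elim (none (s , s∊S , λ i o → ¬o (i , o)))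

  -- `B` is what remains when an independent block is removed from `S`. The empty block, that is
  -- `B = S`, is allowed here and excluded in `StrictlyBelow`.
  Below : Subset n → Subset n → Set
  Below S B = B ⊆ S × IndependentOutside S B

  below? : ∀ S B → Dec (Below S B)
  below? S B = (B Subₚ.⊆? S) ×-dec independentOutside? S B

  acoCount-⊥ : acoCount ⊥ ≡ + 1
  acoCount-⊥ = trans (∑-cong (elements (Matrix-finite n)) (λ O → sym (ℤₚ.*-identityʳ _)))
    (∑-indicator-unique (Matrix-finite n) (isACO? (induced ⊥)) (matrix (λ _ _ → false)) aco only (λ _ → + 1))
    where
    no-edge : ∀ {i j} → ¬ (orient (matrix {n} (λ _ _ → false)) i j ≡ true)
    no-edge {i} {j} o with trans (sym (orient-matrix (λ _ _ → false) i j)) o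
    ... | ()
    aco : ACO ⊥ (matrix (λ _ _ → false))
    aco = ((λ i j o → ⊥-elim (no-edge {i} {j} o)) , (λ i j e → ⊥-elim (Subₚ.∉⊥ (proj₁ (induced⁻ {⊥} {i} {j} e))))) , acyclic
      where
      acyclic : ¬ HasCycle (Adj (orient (matrix {n} (λ _ _ → false)))) 1
      acyclic (v , [] , _ , _ , (o ∷ _)) = no-edge {v} {v} o
      acyclic (v , w ∷ _ , _ , _ , (o ∷ _)) = no-edge {v} {w} o
    only : ∀ O → ACO ⊥ O → O ≡ matrix (λ _ _ → false)
    only O ((O⊆ , _) , _) = matrix-ext (λ i j → trans
      (Boolₚ.¬-not (λ o → Subₚ.∉⊥ (proj₁ (induced⁻ {⊥} {i} {j} (O⊆ i j o))))) (sym (orient-matrix _ i j)))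

module _ {n : ℕ} (G : Fin n → Fin n → Bool) (simple : IsSimpleGraph G) where

  private
    G-sym : ∀ {i j} → G i j ≡ true → G j i ≡ true
    G-sym {i} {j} = trans (proj₁ simple j i)

  -- Toggling all edges from S ∖ B into B turns an acyclic orientation of G[B] into one of G[S] in
  -- which the vertices of S ∖ B are sources, and back.
  module _ (S B : Subset n) (B⊆S : B ⊆ S) where

    New : Fin n → Fin n → Set
    New i j = (i ∊ S × i ∌ B) × (j ∊ B × G i j ≡ true)

    new? : ∀ i j → Dec (New i j)
    new? i j = ((i ∊? S) ×-dec ¬? (i ∊? B)) ×-dec ((j ∊? B) ×-dec (G i j Boolₚ.≟ true))

    addSources : Matrix n → Matrix n
    addSources O = matrix (λ i j → orient O i j xor does (new? i j))

    addSources-old : ∀ O {i j} → ¬ New i j → orient (addSources O) i j ≡ orient O i j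
    addSources-old O {i} {j} ¬e = trans (orient-matrix _ i j)
      (trans (cong (orient O i j xor_) (dec-false (new? i j) ¬e)) (Boolₚ.xor-identityʳ _))

    addSources-new : ∀ O {i j} → New i j → orient (addSources O) i j ≡ not (orient O i j)
    addSources-new O {i} {j} e = trans (orient-matrix _ i j)
      (trans (cong (orient O i j xor_) (dec-true (new? i j) e)) (Boolₚ.xor-comm (orient O i j) true))

    addSources-involutive : ∀ O → addSources (addSources O) ≡ O
    addSources-involutive O = matrix-ext λ i j → pointwise i j (new? i j)
      where
      pointwise : ∀ i j → Dec (New i j) → orient (addSources (addSources O)) i j ≡ orient O i j
      pointwise i j (yes e) = trans (addSources-new (addSources O) e)
        (trans (cong not (addSources-new O e)) (Boolₚ.not-involutive _))
      pointwise i j (no ¬e) = trans (addSources-old (addSources O) ¬e) (addSources-old O ¬e)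

    private
      not-true : ∀ {b} → b ≢ true → b ≡ false
      not-true = Boolₚ.¬-not

    addSources⁺ : ∀ O → IndependentOutside G S B → ACO G B O →
      ACO G S (addSources O) × SourcesOutside G S B (addSources O)
    addSources⁺ O indep ((O⊆ , O≡) , acyclic) =
      -- All arcs of the new orientation end in `B`, so a cycle would lie inside `B`, where nothing
      -- was toggled.
      (((λ i j → edge⊆ i j (new? i j)) , opposite) , acyclic ∘ HasCycle-map target∊B keep) ,
      (λ v _ v∌B i o → v∌B (target∊B o))
      where
      O' = addSources O
      in-B : ∀ {i j} → orient O i j ≡ true → i ∊ B × j ∊ B × G i j ≡ true
      in-B o = induced⁻ G (O⊆ _ _ o)
      edge⊆ : ∀ i j → Dec (New i j) → orient O' i j ≡ true → induced G S i j ≡ true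
      edge⊆ i j (yes ((i∊S , _) , j∊B , g)) o = induced⁺ G i∊S (B⊆S j∊B) g
      edge⊆ i j (no ¬e) o with in-B (trans (sym (addSources-old O ¬e)) o)
      ... | i∊B , j∊B , g = induced⁺ G (B⊆S i∊B) (B⊆S j∊B) g
      target∊B : ∀ {i j} → orient O' i j ≡ true → j ∊ B
      target∊B {i} {j} o with new? i j
      ... | yes (_ , j∊B , _) = j∊B
      ... | no ¬e = proj₁ (proj₂ (in-B (trans (sym (addSources-old O ¬e)) o)))
      keep : ∀ {i j} → i ∊ B → orient O' i j ≡ true → orient O i j ≡ true
      keep i∊B o = trans (sym (addSources-old O (λ e → proj₂ (proj₁ e) i∊B))) o
      from-B : ∀ {i j} → i ∊ B → orient O' i j ≡ orient O i j
      from-B i∊B = addSources-old O (λ e → proj₂ (proj₁ e) i∊B)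
      forward : ∀ {i j} → i ∊ S → i ∌ B → j ∊ B → G i j ≡ true →
        orient O' i j ≡ true × orient O' j i ≡ false
      forward i∊S i∌B j∊B g =
        trans (addSources-new O ((i∊S , i∌B) , j∊B , g))
          (cong not (not-true (λ o → i∌B (proj₁ (in-B o))))) ,
        trans (from-B j∊B) (not-true (λ o → i∌B (proj₁ (proj₂ (in-B o)))))
      opposite : ∀ i j → induced G S i j ≡ true → orient O' i j ≡ not (orient O' j i)
      opposite i j s with induced⁻ G s
      ... | i∊S , j∊S , g with i ∊? B | j ∊? B
      ...   | yes i∊B | yes j∊B = trans (from-B i∊B)
                (trans (O≡ i j (induced⁺ G i∊B j∊B g)) (cong not (sym (from-B j∊B))))
      ...   | yes i∊B | no  j∌B = let (p , q) = forward j∊S j∌B i∊B (G-sym g) in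
                trans q (cong not (sym p))
      ...   | no  i∌B | yes j∊B = let (p , q) = forward i∊S i∌B j∊B g in
                trans p (cong not (sym q))
      ...   | no  i∌B | no  j∌B = ⊥-elim (indep i j i∊S i∌B j∊S j∌B g)

    -- An edge with both ends in `S ∖ B` would have to enter one of two sources. All edges from
    -- `S ∖ B` to `B` point into `B`, so toggling erases exactly these and leaves the arcs inside
    -- `B`.
    addSources⁻ : ∀ O → ACO G S O → SourcesOutside G S B O →
      IndependentOutside G S B × ACO G B (addSources O)
    addSources⁻ O ((O⊆ , O≡) , acyclic) sources =
      independent ,
      (((λ i j → edge⊆ i j) , opposite) ,
       -- Erasing arcs creates no cycle. The predicate `P` is a trivial one, witnessed by the vertex
       -- itself.
       acyclic ∘ HasCycle-map {P = λ _ → Fin n} (λ {x} _ → x) (λ _ o → proj₁ (proj₂ (old o))))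
      where
      O' = addSources O
      independent : IndependentOutside G S B
      independent i j i∊S i∌B j∊S j∌B g
        with trans (sym (not-true (sources j j∊S j∌B i)))
               (trans (O≡ i j (induced⁺ G i∊S j∊S g)) (cong not (not-true (sources i i∊S i∌B j))))
      ... | ()
      new-O : ∀ {i j} → New i j → orient O i j ≡ true
      new-O {i} {j} ((i∊S , i∌B) , j∊B , g) =
        trans (O≡ i j (induced⁺ G i∊S (B⊆S j∊B) g)) (cong not (not-true (sources i i∊S i∌B j)))
      old : ∀ {i j} → orient O' i j ≡ true → ¬ New i j × orient O i j ≡ true × induced G S i j ≡ true
      old {i} {j} o with new? i j
      ... | no ¬e = ¬e , trans (sym (addSources-old O ¬e)) o , O⊆ i j (trans (sym (addSources-old O ¬e)) o)
      ... | yes e with trans (sym o) (trans (addSources-new O e) (cong not (new-O e)))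
      ...   | ()
      edge⊆ : ∀ i j → orient O' i j ≡ true → induced G B i j ≡ true
      edge⊆ i j o with old o
      ... | ¬e , o₁ , s with induced⁻ G s
      ...   | i∊S , j∊S , g = inside (i ∊? B) (j ∊? B)
        where
        inside : Dec (i ∊ B) → Dec (j ∊ B) → induced G B i j ≡ true
        inside _         (no j∌B)  = ⊥-elim (sources j j∊S j∌B i o₁)
        inside (no i∌B)  (yes j∊B) = ⊥-elim (¬e ((i∊S , i∌B) , j∊B , g))
        inside (yes i∊B) (yes j∊B) = induced⁺ G i∊B j∊B g
      opposite : ∀ i j → induced G B i j ≡ true → orient O' i j ≡ not (orient O' j i)
      opposite i j s with induced⁻ G s
      ... | i∊B , j∊B , g = trans (addSources-old O (λ e → proj₂ (proj₁ e) i∊B))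
        (trans (O≡ i j (induced⁺ G (B⊆S i∊B) (B⊆S j∊B) g))
          (cong not (sym (addSources-old O (λ e → proj₂ (proj₁ e) j∊B)))))

    -- `addSources` is an involution of all matrices that exchanges the two conditions, so it serves
    -- as a change of variable.
    acoCount-sources : ⟦ independentOutside? G S B ⟧ *ℤ acoCount G B ≡
      ∑ (elements (Matrix-finite n)) (λ O → ⟦ isACO? (induced G S) O ×-dec sourcesOutside? G S B O ⟧)
    acoCount-sources = begin
      ⟦ independentOutside? G S B ⟧ *ℤ acoCount G B
        ≡⟨ ∑-*ˡ ⟦ independentOutside? G S B ⟧ Os _ ⟨
      ∑ Os (λ O → ⟦ independentOutside? G S B ⟧ *ℤ ⟦ isACO? (induced G B) O ⟧)
        ≡⟨ ∑-cong Os (λ O → ⟦⟧-× (independentOutside? G S B) (isACO? (induced G B) O)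
             (isACO? (induced G S) (addSources O) ×-dec sourcesOutside? G S B (addSources O))
             (addSources⁺ O) (λ (aco , src) → let (i , a) = addSources⁻ (addSources O) aco src in
               i , subst (ACO G B) (addSources-involutive O) a)) ⟩
      ∑ Os (λ O → ⟦ isACO? (induced G S) (addSources O) ×-dec sourcesOutside? G S B (addSources O) ⟧)
        ≡⟨ ∑-involution (Matrix-finite n) addSources addSources-involutive _ ⟨
      ∑ Os (λ O → ⟦ isACO? (induced G S) O ×-dec sourcesOutside? G S B O ⟧) ∎
      where
      open ≡-Reasoning
      Os = elements (Matrix-finite n)

  -- After the sums are exchanged, `O` is fixed and `B` varies subject to `S ∖ B` consisting of
  -- sources of `O`. Flipping the membership in `B` of one source, chosen from `O` alone, preserves
  -- this and reverses the sign.
  acoCount-recursion : ∀ S → Nonempty S →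
    ∑ (elements (Subset-finite n)) (λ B → ⟦ below? G S B ⟧ *ℤ (signPow ∥ B ∥ *ℤ acoCount G B)) ≡ + 0
  acoCount-recursion S ne = begin
    ∑ Bs (λ B → ⟦ below? G S B ⟧ *ℤ (signPow ∥ B ∥ *ℤ acoCount G B))
      ≡⟨ ∑-cong Bs (λ B → expand B (B Subₚ.⊆? S)) ⟩
    ∑ Bs (λ B → ∑ Os (λ O → term O B))
      ≡⟨ ∑-swap Bs Os (λ B O → term O B) ⟩
    ∑ Os (λ O → ∑ Bs (term O))
      ≡⟨ ∑-zero Os (λ O _ → cancel O (isACO? (induced G S) O)) ⟩
    + 0 ∎
    where
    open ≡-Reasoning
    Bs = elements (Subset-finite n)
    Os = elements (Matrix-finite n)
    Good : Matrix n → Subset n → Set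
    Good O B = B ⊆ S × (ACO G S O × SourcesOutside G S B O)
    good? : ∀ O B → Dec (Good O B)
    good? O B = (B Subₚ.⊆? S) ×-dec (isACO? (induced G S) O ×-dec sourcesOutside? G S B O)
    term : Matrix n → Subset n → ℤ
    term O B = ⟦ good? O B ⟧ *ℤ signPow ∥ B ∥
    expand : ∀ B → Dec (B ⊆ S) → ⟦ below? G S B ⟧ *ℤ (signPow ∥ B ∥ *ℤ acoCount G B) ≡ ∑ Os (λ O → term O B)
    expand B (no B⊈S) = trans (cong (_*ℤ (signPow ∥ B ∥ *ℤ acoCount G B)) (⟦⟧-false (below? G S B) (λ b → B⊈S (proj₁ b))))
      (sym (∑-zero Os (λ O _ → cong (_*ℤ signPow ∥ B ∥) (⟦⟧-false (good? O B) (λ g → B⊈S (proj₁ g))))))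
    expand B (yes B⊆S) = begin
      ⟦ below? G S B ⟧ *ℤ (signPow ∥ B ∥ *ℤ acoCount G B)
        ≡⟨ cong₂ _*ℤ_ (⟦⟧-cong (below? G S B) (independentOutside? G S B) proj₂ (λ i → (λ {x} → B⊆S {x}) , i))
             (ℤₚ.*-comm (signPow ∥ B ∥) (acoCount G B)) ⟩
      ⟦ independentOutside? G S B ⟧ *ℤ (acoCount G B *ℤ signPow ∥ B ∥)
        ≡⟨ ℤₚ.*-assoc ⟦ independentOutside? G S B ⟧ (acoCount G B) (signPow ∥ B ∥) ⟨
      (⟦ independentOutside? G S B ⟧ *ℤ acoCount G B) *ℤ signPow ∥ B ∥
        ≡⟨ cong (_*ℤ signPow ∥ B ∥) (acoCount-sources S B B⊆S) ⟩
      ∑ Os (λ O → ⟦ isACO? (induced G S) O ×-dec sourcesOutside? G S B O ⟧) *ℤ signPow ∥ B ∥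
        ≡⟨ ∑-*ʳ (signPow ∥ B ∥) Os _ ⟨
      ∑ Os (λ O → ⟦ isACO? (induced G S) O ×-dec sourcesOutside? G S B O ⟧ *ℤ signPow ∥ B ∥)
        ≡⟨ ∑-cong Os (λ O → cong (_*ℤ signPow ∥ B ∥) (⟦⟧-cong
             (isACO? (induced G S) O ×-dec sourcesOutside? G S B O) (good? O B) (λ x → (λ {y} → B⊆S {y}) , x) proj₂)) ⟩
      ∑ Os (λ O → term O B) ∎
    cancel : ∀ O → Dec (ACO G S O) → ∑ Bs (term O) ≡ + 0
    cancel O (no ¬aco) = ∑-indicator-none (Subset-finite n) (good? O) (λ B g → ¬aco (proj₁ (proj₂ g))) _
    cancel O (yes aco) with acyclic⇒source G S O ne aco
    ... | s , s∊S , src = ∑-reversing (Subset-finite n) (flip s) (flip-involutive s) (term O) reverse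
      where
      good-flip : ∀ B → Good O B → Good O (flip s B)
      good-flip B (B⊆S , _ , sources) = (λ {x} → sub x) , aco , sources'
        where
        sub : ∀ x → x ∊ flip s B → x ∊ S
        sub x x∊ with x Finₚ.≟ s
        ... | yes refl = s∊S
        ... | no x≢s = B⊆S (∊-flip x≢s x∊)
        sources' : SourcesOutside G S (flip s B) O
        sources' v v∊S v∌ with v Finₚ.≟ s
        ... | yes refl = src
        ... | no v≢s = sources v v∊S (v∌ ∘ flip-∊ v≢s)
      reverse : ∀ B → term O (flip s B) ≡ -ℤ term O B
      reverse B = trans (cong₂ _*ℤ_
          (⟦⟧-cong (good? O (flip s B)) (good? O B)
            (λ g → subst (Good O) (flip-involutive s B) (good-flip (flip s B) g)) (good-flip B))
          (flip-sign s B))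
        (sym (ℤₚ.neg-distribʳ-* ⟦ good? O B ⟧ (signPow ∥ B ∥)))

-- Chains of subsets

⊆∧≢⇒⊂ : ∀ {n} {A B : Subset n} → A ⊆ B → A ≢ B → A ⊂ B
⊆∧≢⇒⊂ {A = A} {B} A⊆B A≢B with Finₚ.any? (λ x → (x ∊? B) ×-dec ¬? (x ∊? A))
... | yes w   = A⊆B , w
... | no none = ⊥-elim (A≢B (Subₚ.⊆-antisym A⊆B B⊆A))
  where
  B⊆A : B ⊆ A
  B⊆A {x} x∊B with x ∊? A
  ... | yes x∊A = x∊A
  ... | no  x∌A = ⊥-elim (none (x , x∊B , x∌A))

⊈⇒∃ : ∀ {n} {A B : Subset n} → ¬ (A ⊆ B) → ∃ λ x → x ∊ A × x ∌ B
⊈⇒∃ {A = A} {B} A⊈B with Finₚ.any? (λ x → (x ∊? A) ×-dec ¬? (x ∊? B))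
... | yes w   = w
... | no none = ⊥-elim (A⊈B sub)
  where
  sub : A ⊆ B
  sub {x} x∊A with x ∊? B
  ... | yes x∊B = x∊B
  ... | no  x∌B = ⊥-elim (none (x , x∊A , x∌B))

Comparable : ∀ {n} → Subset n → Subset n → Set
Comparable A B = A ⊆ B ⊎ B ⊆ A

-- The default `⊥` for the empty list is the intended one: the empty family is the chain that
-- belongs to the empty set.
chain-max : ∀ {n} (xs : List (Subset n)) → (∀ {C D} → C ∈ xs → D ∈ xs → Comparable C D) →
  ∃ λ B → (∀ C → C ∈ xs → C ⊆ B) × (B ∈ xs ⊎ B ≡ ⊥)
chain-max []       cmp = ⊥ , (λ _ ()) , inj₂ refl
chain-max (A ∷ xs) cmp with chain-max xs (λ p q → cmp (there p) (there q))
... | B , bound , inj₂ refl = A , above , inj₁ (here refl)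
  where
  above : ∀ C → C ∈ A ∷ xs → C ⊆ A
  above C (here refl) x∊C = x∊C
  above C (there C∈)  x∊C = ⊥-elim (Subₚ.∉⊥ (bound C C∈ x∊C))
... | B , bound , inj₁ B∈ with cmp (here refl) (there B∈)
...   | inj₁ A⊆B = B , above , inj₁ (there B∈)
  where
  above : ∀ C → C ∈ A ∷ xs → C ⊆ B
  above C (here refl) x∊C = A⊆B x∊C
  above C (there C∈)  x∊C = bound C C∈ x∊C
...   | inj₂ B⊆A = A , above , inj₁ (here refl)
  where
  above : ∀ C → C ∈ A ∷ xs → C ⊆ A
  above C (here refl) x∊C = x∊C
  above C (there C∈)  x∊C = B⊆A (bound C C∈ x∊C)

Separates : ∀ {n} → Subset n → Fin n → Fin n → Set
Separates C i j = (i ∊ C × j ∌ C) ⊎ (i ∌ C × j ∊ C)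

separates? : ∀ {n} (C : Subset n) i j → Dec (Separates C i j)
separates? C i j = ((i ∊? C) ×-dec ¬? (j ∊? C)) ⊎-dec (¬? (i ∊? C) ×-dec (j ∊? C))

Separated : ∀ {n} → Fam n → Fin n → Fin n → Set
Separated F i j = ∃ λ C → C ∈ᶠ F × Separates C i j

separated? : ∀ {n} (F : Fam n) i j → Dec (Separated F i j)
separated? F i j = Subₚ.anySubset? (λ C → (C ∈ᶠ? F) ×-dec separates? C i j)

-- The ordered set partitions of S correspond to the chains of nonempty subsets of S that contain S
-- (the empty chain if S is empty); a colour class contains no edge if every edge is separated.
record IsChain {n} (S : Subset n) (F : Fam n) : Set where
  constructor mkChain
  field
    nonempty   : ∀ C → C ∈ᶠ F → Nonempty C
    bounded    : ∀ C → C ∈ᶠ F → C ⊆ S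
    comparable : ∀ C D → C ∈ᶠ F → D ∈ᶠ F → Comparable C D
    top        : Nonempty S → S ∈ᶠ F

open IsChain

isChain? : ∀ {n} (S : Subset n) F → Dec (IsChain S F)
isChain? S F = map′ (λ (a , b , c , d) → mkChain a b c d) (λ (mkChain a b c d) → a , b , c , d)
  ((∀-subset? λ C → (C ∈ᶠ? F) →-dec Subₚ.nonempty? C) ×-dec
   (∀-subset? λ C → (C ∈ᶠ? F) →-dec (C Subₚ.⊆? S)) ×-dec
   (∀-subset? λ C → ∀-subset? λ D → (C ∈ᶠ? F) →-dec (D ∈ᶠ? F) →-dec ((C Subₚ.⊆? D) ⊎-dec (D Subₚ.⊆? C))) ×-dec
   (Subₚ.nonempty? S →-dec (S ∈ᶠ? F)))

-- The signed sum over ordered partitions into independent blocks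

module _ {n : ℕ} (G : Fin n → Fin n → Bool) where

  SeparatesEdges : Subset n → Fam n → Set
  SeparatesEdges S F = ∀ i j → i ∊ S → j ∊ S → G i j ≡ true → Separated F i j

  separatesEdges? : ∀ S F → Dec (SeparatesEdges S F)
  separatesEdges? S F = Finₚ.all? λ i → Finₚ.all? λ j →
    (i ∊? S) →-dec (j ∊? S) →-dec (G i j Boolₚ.≟ true) →-dec separated? F i j

  IsColouring : Subset n → Fam n → Set
  IsColouring S F = IsChain S F × SeparatesEdges S F

  isColouring? : ∀ S F → Dec (IsColouring S F)
  isColouring? S F = isChain? S F ×-dec separatesEdges? S F

  colouringSum : Subset n → ℤ
  colouringSum S = ∑ (elements (Fam-finite n)) (λ F → ⟦ isColouring? S F ⟧ *ℤ sgn F)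

  private
    Fs = elements (Fam-finite n)
    Bs = elements (Subset-finite n)

  StrictlyBelow : Subset n → Subset n → Set
  StrictlyBelow S B = Below G S B × B ≢ S

  strictlyBelow? : ∀ S B → Dec (StrictlyBelow S B)
  strictlyBelow? S B = below? G S B ×-dec ¬? (B ≟ˢ S)

  module _ (S : Subset n) (S≢∅ : Nonempty S) (F : Fam n) where

    private
      F' = toggle S F
      S∉F : S ∈ᶠ F' → ¬ (S ∈ᶠ F)
      S∉F S∈F' S∈F with trans (sym S∈F') (trans (mem-toggle-≡ S F) (cong not S∈F))
      ... | ()
      kept : S ∈ᶠ F' → ∀ C → C ∈ᶠ F → C ∈ᶠ F'
      kept S∈F' C C∈F = ∈-toggle S C (λ { refl → S∉F S∈F' C∈F }) C∈F

    -- `B` is the largest member left, or `⊥` if `S` was alone. A member that separates an edge of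
    -- `S` differs from `S`, since `S` contains both ends; hence it survives, lies in `B`, and puts
    -- an end of the edge into `B`.
    removeTop : IsColouring S F' → ∃ λ B → StrictlyBelow S B × IsColouring B F
    removeTop (ch , sep) with chain-max (members F) (λ {C} {D} C∈ D∈ →
      comparable ch C D (kept (top ch S≢∅) C (∈-members F C C∈)) (kept (top ch S≢∅) D (∈-members F D D∈)))
    ... | B , bound , B-max = B , (((λ {x} → B⊆S {x}) , indep) , B≢S) , mkChain
        (λ C C∈ → nonempty ch C (up C C∈))
        (λ C C∈ → bound C (members-∈ F C C∈))
        (λ C D C∈ D∈ → comparable ch C D (up C C∈) (up D D∈))
        B-top , sep-B
      where
      up : ∀ C → C ∈ᶠ F → C ∈ᶠ F'
      up = kept (top ch S≢∅)
      B-top : Nonempty B → B ∈ᶠ F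
      B-top (x , x∊B) = [ ∈-members F B , (λ B≡⊥ → ⊥-elim (Subₚ.∉⊥ (subst (x ∊_) B≡⊥ x∊B))) ]′ B-max
      B⊆S : B ⊆ S
      B⊆S {x} x∊B = bounded ch B (up B (B-top (x , x∊B))) x∊B
      B≢S : B ≢ S
      B≢S B≡S = S∉F (top ch S≢∅) (subst (_∈ᶠ F) B≡S (B-top (subst Nonempty (sym B≡S) S≢∅)))
      indep : IndependentOutside G S B
      indep i j i∊S i∌B j∊S j∌B g with sep i j i∊S j∊S g
      ... | C , C∈ , inj₁ (i∊C , j∌C) =
        i∌B (bound C (members-∈ F C (toggle-∈ S C (λ { refl → j∌C j∊S }) C∈)) i∊C)
      ... | C , C∈ , inj₂ (i∌C , j∊C) =
        j∌B (bound C (members-∈ F C (toggle-∈ S C (λ { refl → i∌C i∊S }) C∈)) j∊C)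
      sep-B : SeparatesEdges B F
      sep-B i j i∊B j∊B g with sep i j (B⊆S i∊B) (B⊆S j∊B) g
      ... | C , C∈ , s@(inj₁ (_ , j∌C)) = C , toggle-∈ S C (λ { refl → j∌C (B⊆S j∊B) }) C∈ , s
      ... | C , C∈ , s@(inj₂ (i∌C , _)) = C , toggle-∈ S C (λ { refl → i∌C (B⊆S i∊B) }) C∈ , s

    -- An edge with one end in `B` is separated by `B` itself, a member because it is then nonempty;
    -- an edge with no end in `B` is excluded by independence.
    addTop : ∀ B → StrictlyBelow S B → IsColouring B F → IsColouring S F'
    addTop B ((B⊆S , indep) , B≢S) (ch , sep) = mkChain
      (λ C C∈ → [ (λ { refl → S≢∅ }) , nonempty ch C ]′ (down C C∈))
      (λ C C∈ → sub (down C C∈))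
      (λ C D C∈ D∈ → cmp (down C C∈) (down D D∈))
      (λ _ → S∈F') , sep-S
      where
      S∉ : ¬ (S ∈ᶠ F)
      S∉ S∈ = B≢S (Subₚ.⊆-antisym B⊆S (bounded ch S S∈))
      S∈F' : S ∈ᶠ F'
      S∈F' = trans (mem-toggle-≡ S F) (cong not (Boolₚ.¬-not S∉))
      down : ∀ C → C ∈ᶠ F' → C ≡ S ⊎ C ∈ᶠ F
      down C C∈ with C ≟ˢ S
      ... | yes C≡S = inj₁ C≡S
      ... | no  C≢S = inj₂ (toggle-∈ S C C≢S C∈)
      up : ∀ C → C ∈ᶠ F → C ∈ᶠ F'
      up C C∈ = ∈-toggle S C (λ { refl → S∉ C∈ }) C∈
      sub : ∀ {C} → C ≡ S ⊎ C ∈ᶠ F → C ⊆ S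
      sub (inj₁ refl) x = x
      sub (inj₂ C∈)   x = B⊆S (bounded ch _ C∈ x)
      cmp : ∀ {C D} → C ≡ S ⊎ C ∈ᶠ F → D ≡ S ⊎ D ∈ᶠ F → Comparable C D
      cmp p (inj₁ refl) = inj₁ (sub p)
      cmp (inj₁ refl) q = inj₂ (sub q)
      cmp (inj₂ C∈) (inj₂ D∈) = comparable ch _ _ C∈ D∈
      sep-S : SeparatesEdges S F'
      sep-S i j i∊S j∊S g with i ∊? B | j ∊? B
      ... | yes i∊B | yes j∊B = let (C , C∈ , s) = sep i j i∊B j∊B g in C , up C C∈ , s
      ... | yes i∊B | no  j∌B = B , up B (top ch (i , i∊B)) , inj₁ (i∊B , j∌B)
      ... | no  i∌B | yes j∊B = B , up B (top ch (j , j∊B)) , inj₂ (i∌B , j∊B)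
      ... | no  i∌B | no  j∌B = ⊥-elim (indep i j i∊S i∌B j∊S j∌B g)

    private
      below-top : ∀ {B B'} → IsChain B F → IsChain B' F → B ⊆ B'
      below-top {B} {B'} ch ch' {x} x∊B = bounded ch' B (top ch (x , x∊B)) x∊B

    -- `F` determines `B`, since two tops of the same chain contain each other; the sum therefore
    -- has at most one nonzero term.
    ⟦⟧-removeTop : ⟦ isColouring? S F' ⟧ ≡
      ∑ Bs (λ B → ⟦ strictlyBelow? S B ⟧ *ℤ ⟦ isColouring? B F ⟧)
    ⟦⟧-removeTop = trans (by-cases (isColouring? S F')) (sym (∑-cong Bs (λ B →
        trans (⟦⟧-× (strictlyBelow? S B) (isColouring? B F) (both? B) _,_ id) (sym (ℤₚ.*-identityʳ _)))))
      where
      both? : ∀ B → Dec (StrictlyBelow S B × IsColouring B F)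
      both? B = strictlyBelow? S B ×-dec isColouring? B F
      by-cases : Dec (IsColouring S F') → ⟦ isColouring? S F' ⟧ ≡ ∑ Bs (λ B → ⟦ both? B ⟧ *ℤ + 1)
      by-cases (yes c) = let (B , b) = removeTop c in trans (⟦⟧-true (isColouring? S F') c)
        (sym (∑-indicator-unique (Subset-finite n) both? B b
          (λ B' b' → Subₚ.⊆-antisym (below-top (proj₁ (proj₂ b')) (proj₁ (proj₂ b)))
                                    (below-top (proj₁ (proj₂ b)) (proj₁ (proj₂ b')))) (λ _ → + 1)))
      by-cases (no ¬c) = trans (⟦⟧-false (isColouring? S F') ¬c)
        (sym (∑-indicator-none (Subset-finite n) both? (λ B (s , c) → ¬c (addTop B s c)) (λ _ → + 1)))

  -- Toggling `S` as a change of variable replaces a chain with top `S` by one with a smaller top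
  -- and one member fewer, whence the minus sign.
  colouringSum-recursion : ∀ S → Nonempty S →
    colouringSum S ≡ -ℤ ∑ Bs (λ B → ⟦ strictlyBelow? S B ⟧ *ℤ colouringSum B)
  colouringSum-recursion S ne = begin
    ∑ Fs (λ F → ⟦ isColouring? S F ⟧ *ℤ sgn F)
      ≡⟨ ∑-involution (Fam-finite n) (toggle S) (toggle-involutive S) _ ⟩
    ∑ Fs (λ F → ⟦ isColouring? S (toggle S F) ⟧ *ℤ sgn (toggle S F))
      ≡⟨ ∑-cong Fs (λ F → trans
           (cong₂ _*ℤ_ (⟦⟧-removeTop S ne F) (sgn-toggle S F))
           (trans (sym (ℤₚ.neg-distribʳ-* (∑ Bs (pairs F)) (sgn F)))
             (cong -ℤ_ (sym (∑-*ʳ (sgn F) Bs (pairs F)))))) ⟩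
    ∑ Fs (λ F → -ℤ ∑ Bs (λ B → ⟦ strictlyBelow? S B ⟧ *ℤ ⟦ isColouring? B F ⟧ *ℤ sgn F))
      ≡⟨ ∑-neg Fs _ ⟩
    -ℤ ∑ Fs (λ F → ∑ Bs (λ B → ⟦ strictlyBelow? S B ⟧ *ℤ ⟦ isColouring? B F ⟧ *ℤ sgn F))
      ≡⟨ cong -ℤ_ (∑-swap Fs Bs _) ⟩
    -ℤ ∑ Bs (λ B → ∑ Fs (λ F → ⟦ strictlyBelow? S B ⟧ *ℤ ⟦ isColouring? B F ⟧ *ℤ sgn F))
      ≡⟨ cong -ℤ_ (∑-cong Bs (λ B → trans
           (∑-cong Fs (λ F → ℤₚ.*-assoc ⟦ strictlyBelow? S B ⟧ ⟦ isColouring? B F ⟧ (sgn F)))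
           (∑-*ˡ ⟦ strictlyBelow? S B ⟧ Fs (λ F → ⟦ isColouring? B F ⟧ *ℤ sgn F)))) ⟩
    -ℤ ∑ Bs (λ B → ⟦ strictlyBelow? S B ⟧ *ℤ colouringSum B) ∎
    where
    open ≡-Reasoning
    pairs : Fam n → Subset n → ℤ
    pairs F B = ⟦ strictlyBelow? S B ⟧ *ℤ ⟦ isColouring? B F ⟧

  colouringSum-⊥ : colouringSum ⊥ ≡ + 1
  colouringSum-⊥ = trans (∑-indicator-unique (Fam-finite n) (isColouring? ⊥) ∅ᶠ
      (mkChain (λ C → ⊥-elim ∘ ∉∅ᶠ C) (λ C C∈ → ⊥-elim (∉∅ᶠ C C∈)) (λ C D C∈ → ⊥-elim (∉∅ᶠ C C∈))
        (λ (x , x∊) → ⊥-elim (Subₚ.∉⊥ x∊)) , (λ i j i∊ → ⊥-elim (Subₚ.∉⊥ i∊)))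
      (λ F (ch , _) → fam-ext-⇔
        (λ A A∈ → let (x , x∊) = nonempty ch A A∈ in ⊥-elim (Subₚ.∉⊥ (bounded ch A A∈ x∊)))
        (λ A A∈ → ⊥-elim (∉∅ᶠ A A∈)))
      sgn) (sgn-∅ᶠ n)

module _ {n : ℕ} (G : Fin n → Fin n → Bool) (simple : IsSimpleGraph G) where

  private
    Bs = elements (Subset-finite n)

  -- Stanley's theorem on the value at -1 of the chromatic polynomial: both sides satisfy the same
  -- recursion over the proper subsets with independent complement.
  colouringSum≡acoCount : ∀ S → colouringSum G S ≡ signPow ∥ S ∥ *ℤ acoCount G S
  colouringSum≡acoCount S₀ = go ∥ S₀ ∥ S₀ ℕₚ.≤-refl (Subₚ.nonempty? S₀)
    where
    open ≡-Reasoning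
    h : Subset n → ℤ
    h B = signPow ∥ B ∥ *ℤ acoCount G B
    split : ∀ S B → ⟦ below? G S B ⟧ *ℤ h B ≡ ⟦ strictlyBelow? G S B ⟧ *ℤ h B +ℤ ⟦ B ≟ˢ S ⟧ *ℤ h B
    split S B = trans (cong (_*ℤ h B) (cases (below? G S B) (B ≟ˢ S)))
      (ℤₚ.*-distribʳ-+ (h B) ⟦ strictlyBelow? G S B ⟧ ⟦ B ≟ˢ S ⟧)
      where
      cases : Dec (Below G S B) → Dec (B ≡ S) →
        ⟦ below? G S B ⟧ ≡ ⟦ strictlyBelow? G S B ⟧ +ℤ ⟦ B ≟ˢ S ⟧
      cases _ (yes refl) = trans (⟦⟧-true (below? G S B) ((λ {x} m → m) , λ i j i∊ i∌ → ⊥-elim (i∌ i∊)))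
        (sym (cong₂ _+ℤ_ (⟦⟧-false (strictlyBelow? G S B) (λ s → proj₂ s refl)) (⟦⟧-true (B ≟ˢ S) refl)))
      cases (yes b) (no ne) = trans (⟦⟧-true (below? G S B) b)
        (sym (cong₂ _+ℤ_ (⟦⟧-true (strictlyBelow? G S B) (b , ne)) (⟦⟧-false (B ≟ˢ S) ne)))
      cases (no ¬b) (no ne) = trans (⟦⟧-false (below? G S B) ¬b)
        (sym (cong₂ _+ℤ_ (⟦⟧-false (strictlyBelow? G S B) (¬b ∘ proj₁)) (⟦⟧-false (B ≟ˢ S) ne)))
    go : ∀ m S → ∥ S ∥ ≤ m → Dec (Nonempty S) → colouringSum G S ≡ h S
    go m S le (no empty) = subst (λ S → colouringSum G S ≡ h S) (sym (Subₚ.Empty-unique empty))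
      (trans (colouringSum-⊥ G) (sym (trans (cong₂ (λ k a → signPow k *ℤ a) (Subₚ.∣⊥∣≡0 n) (acoCount-⊥ G)) refl)))
    go zero S le (yes (x , x∊S)) = ⊥-elim (ℕₚ.<⇒≱ (ℕₚ.≤-<-trans z≤n
      (Subₚ.x∈p⇒∣p-x∣<∣p∣ x∊S)) le)
    go (suc m) S le (yes ne) = begin
      colouringSum G S
        ≡⟨ colouringSum-recursion G S ne ⟩
      -ℤ ∑ Bs (λ B → ⟦ strictlyBelow? G S B ⟧ *ℤ colouringSum G B)
        ≡⟨ cong -ℤ_ (∑-cong Bs (λ B → smaller B (strictlyBelow? G S B))) ⟩
      -ℤ lower
        ≡⟨ ℤₚ.+-identityʳ (-ℤ lower) ⟨
      -ℤ lower +ℤ + 0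
        -- Zero is rewritten as the vanishing sum for `h`, split into `lower` and the term `B = S`,
        -- which only that recursion contains.
        ≡⟨ cong (-ℤ lower +ℤ_) (trans (sym (acoCount-recursion G simple S ne))
             (trans (∑-cong Bs (split S)) (trans (∑-+ Bs _ _)
               (cong (lower +ℤ_) (∑-indicator-unique (Subset-finite n) (_≟ˢ S) S refl (λ _ e → e) h))))) ⟩
      -ℤ lower +ℤ (lower +ℤ h S)
        ≡⟨ ℤₚ.+-assoc (-ℤ lower) lower (h S) ⟨
      (-ℤ lower +ℤ lower) +ℤ h S
        ≡⟨ cong (_+ℤ h S) (ℤₚ.+-inverseˡ lower) ⟩
      + 0 +ℤ h S
        ≡⟨ ℤₚ.+-identityˡ (h S) ⟩
      h S ∎
      where
      lower = ∑ Bs (λ B → ⟦ strictlyBelow? G S B ⟧ *ℤ h B)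
      smaller : ∀ B → Dec (StrictlyBelow G S B) →
        ⟦ strictlyBelow? G S B ⟧ *ℤ colouringSum G B ≡ ⟦ strictlyBelow? G S B ⟧ *ℤ h B
      smaller B (no ¬s) = trans (cong (_*ℤ colouringSum G B) (⟦⟧-false (strictlyBelow? G S B) ¬s))
        (sym (cong (_*ℤ h B) (⟦⟧-false (strictlyBelow? G S B) ¬s)))
      smaller B (yes ((B⊆S , _) , B≢S)) = cong (⟦ strictlyBelow? G S B ⟧ *ℤ_)
        (go m B (ℕₚ.≤-pred (ℕₚ.≤-trans (Subₚ.p⊂q⇒∣p∣<∣q∣ (⊆∧≢⇒⊂ B⊆S B≢S)) le)) (Subₚ.nonempty? B))

-- Nested families of clusters

Disjoint : ∀ {n} → Subset n → Subset n → Set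
Disjoint A B = ∀ x → x ∊ A → x ∌ B

disjoint? : ∀ {n} (A B : Subset n) → Dec (Disjoint A B)
disjoint? A B = Finₚ.all? λ x → (x ∊? A) →-dec ¬? (x ∊? B)

Laminar : ∀ {n} → Subset n → Subset n → Set
Laminar A B = A ⊆ B ⊎ B ⊆ A ⊎ Disjoint A B

laminar? : ∀ {n} (A B : Subset n) → Dec (Laminar A B)
laminar? A B = (A Subₚ.⊆? B) ⊎-dec (B Subₚ.⊆? A) ⊎-dec disjoint? A B

laminar-sym : ∀ {n} {A B : Subset n} → Laminar A B → Laminar B A
laminar-sym (inj₁ A⊆B)        = inj₂ (inj₁ A⊆B)
laminar-sym (inj₂ (inj₁ B⊆A)) = inj₁ B⊆A
laminar-sym (inj₂ (inj₂ d))   = inj₂ (inj₂ (λ x x∊B x∊A → d x x∊A x∊B))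

ContainsEdge : ∀ {n} → (Fin n → Fin n → Bool) → Subset n → Set
ContainsEdge G A = ∃ λ i → ∃ λ j → i ∊ A × j ∊ A × G i j ≡ true

containsEdge? : ∀ {n} (G : Fin n → Fin n → Bool) A → Dec (ContainsEdge G A)
containsEdge? G A = Finₚ.any? λ i → Finₚ.any? λ j → (i ∊? A) ×-dec (j ∊? A) ×-dec (G i j Boolₚ.≟ true)

record IsNested {n} (G : Fin n → Fin n → Bool) (F : Fam n) : Set where
  constructor mkNested
  field
    ground  : ⊤ ∈ᶠ F
    edge    : ∀ A → A ∈ᶠ F → ContainsEdge G A
    laminar : ∀ A B → A ∈ᶠ F → B ∈ᶠ F → Laminar A B

isNested? : ∀ {n} (G : Fin n → Fin n → Bool) F → Dec (IsNested G F)
isNested? G F = map′ (λ (a , b , c) → mkNested a b c) (λ (mkNested a b c) → a , b , c)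
  ((⊤ ∈ᶠ? F) ×-dec (∀-subset? λ A → (A ∈ᶠ? F) →-dec containsEdge? G A) ×-dec
   (∀-subset? λ A → ∀-subset? λ B → (A ∈ᶠ? F) →-dec (B ∈ᶠ? F) →-dec laminar? A B))

-- A nested family on Fin (suc n) splits into the clusters containing the vertex zero, which form a
-- chain F₁, and the other clusters F₀, which must refine the blocks of F₁.
record Refines {n} (G : Fin n → Fin n → Bool) (F₁ F₀ : Fam n) : Set where
  constructor mkRefines
  field
    edge    : ∀ A → A ∈ᶠ F₀ → ContainsEdge G A
    laminar : ∀ A B → A ∈ᶠ F₀ → B ∈ᶠ F₀ → Laminar A B
    inBlock : ∀ A C → A ∈ᶠ F₀ → C ∈ᶠ F₁ → A ⊆ C ⊎ Disjoint A C

refines? : ∀ {n} (G : Fin n → Fin n → Bool) F₁ F₀ → Dec (Refines G F₁ F₀)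
refines? G F₁ F₀ = map′ (λ (a , b , c) → mkRefines a b c) (λ (mkRefines a b c) → a , b , c)
  ((∀-subset? λ A → (A ∈ᶠ? F₀) →-dec containsEdge? G A) ×-dec
   (∀-subset? λ A → ∀-subset? λ B → (A ∈ᶠ? F₀) →-dec (B ∈ᶠ? F₀) →-dec laminar? A B) ×-dec
   (∀-subset? λ A → ∀-subset? λ C → (A ∈ᶠ? F₀) →-dec (C ∈ᶠ? F₁) →-dec ((A Subₚ.⊆? C) ⊎-dec disjoint? A C)))

-- Read contrapositively: being unseparated is transitive, as befits lying in the same block.
sep-trans : ∀ {n} {F : Fam n} {i j k} → Separated F i k → Separated F i j ⊎ Separated F j k
sep-trans {j = j} (C , C∈ , inj₁ (i∊ , k∌)) with j ∊? C
... | yes j∊ = inj₂ (C , C∈ , inj₁ (j∊ , k∌))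
... | no  j∌ = inj₁ (C , C∈ , inj₁ (i∊ , j∌))
sep-trans {j = j} (C , C∈ , inj₂ (i∌ , k∊)) with j ∊? C
... | yes j∊ = inj₁ (C , C∈ , inj₂ (i∌ , j∊))
... | no  j∌ = inj₂ (C , C∈ , inj₂ (j∌ , k∊))

sep-irrefl : ∀ {n} {F : Fam n} {i} → ¬ Separated F i i
sep-irrefl (C , C∈ , inj₁ (i∊ , i∌)) = i∌ i∊
sep-irrefl (C , C∈ , inj₂ (i∌ , i∊)) = i∌ i∊

∊-tabulate⁺ : ∀ {n} {P : Fin n → Set} (P? : ∀ i → Dec (P i)) {i} → P i → i ∊ tabulate (does ∘ P?)
∊-tabulate⁺ P? {i} p = Vecₚ.lookup⇒[]= i _ (trans (Vecₚ.lookup∘tabulate _ i) (dec-true (P? i) p))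

∊-tabulate⁻ : ∀ {n} {P : Fin n → Set} (P? : ∀ i → Dec (P i)) {i} → i ∊ tabulate (does ∘ P?) → P i
∊-tabulate⁻ P? {i} m with P? i | trans (sym (Vecₚ.lookup∘tabulate (does ∘ P?) i)) (Vecₚ.[]=⇒lookup m)
... | yes p | _ = p
... | no _  | ()

-- Cancellation of the clusters inside the blocks of a chain

module _ {n : ℕ} (G : Fin n → Fin n → Bool) (F₁ : Fam n) where

  private
    Fs = elements (Fam-finite n)

  refines-∅ : Refines G F₁ ∅ᶠ
  refines-∅ = mkRefines (λ A A∈ → ⊥-elim (∉∅ᶠ A A∈)) (λ A B A∈ → ⊥-elim (∉∅ᶠ A A∈))
    (λ A C A∈ → ⊥-elim (∉∅ᶠ A A∈))

  -- A member of `F₀` contains an edge, yet each member of `F₁` contains it or misses it entirely,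
  -- so that edge is not separated.
  separated⇒∅ : SeparatesEdges G ⊤ F₁ → ∀ F₀ → Refines G F₁ F₀ → F₀ ≡ ∅ᶠ
  separated⇒∅ sep F₀ (mkRefines edge _ inBlock) =
    fam-ext-⇔ (λ A A∈ → ⊥-elim (absurd A A∈)) (λ A A∈ → ⊥-elim (∉∅ᶠ A A∈))
    where
    absurd : ∀ A → ¬ (A ∈ᶠ F₀)
    absurd A A∈ with edge A A∈
    ... | i , j , i∊ , j∊ , g with sep i j Subₚ.∈⊤ Subₚ.∈⊤ g
    ...   | C , C∈ , s with inBlock A C A∈ C∈ | s
    ...     | inj₁ A⊆C | inj₁ (_ , j∌) = j∌ (A⊆C j∊)
    ...     | inj₁ A⊆C | inj₂ (i∌ , _) = i∌ (A⊆C i∊)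
    ...     | inj₂ d   | inj₁ (i∊C , _) = d i i∊ i∊C
    ...     | inj₂ d   | inj₂ (_ , j∊C) = d j j∊ j∊C

  module _ {i j : Fin n} (g : G i j ≡ true) (unsep : ¬ Separated F₁ i j) where

    -- The block of the ordered partition that contains `i`: the vertices in exactly the same
    -- members of `F₁` as `i`.
    block : Subset n
    block = tabulate (λ x → does (¬? (separated? F₁ i x)))

    private
      block⁺ : ∀ {x} → ¬ Separated F₁ i x → x ∊ block
      block⁺ = ∊-tabulate⁺ (λ x → ¬? (separated? F₁ i x))
      block⁻ : ∀ {x} → x ∊ block → ¬ Separated F₁ i x
      block⁻ = ∊-tabulate⁻ (λ x → ¬? (separated? F₁ i x))

    -- The block is compatible with every refinement: the vertices of a member of `F₀` are mutually
    -- unseparated, so a member that meets the block lies in it. The block itself qualifies as a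
    -- cluster because it contains the edge from `i` to `j`.
    refines-toggle : ∀ F₀ → Refines G F₁ F₀ → Refines G F₁ (toggle block F₀)
    refines-toggle F₀ (mkRefines edge laminar inBlock) = mkRefines
      (λ A A∈ → edge' A (down A A∈))
      (λ A B A∈ B∈ → laminar' A B (down A A∈) (down B B∈))
      (λ A C A∈ → inBlock' A C (down A A∈))
      where
      down : ∀ A → A ∈ᶠ toggle block F₀ → A ≡ block ⊎ A ∈ᶠ F₀
      down A A∈ with A ≟ˢ block
      ... | yes eq = inj₁ eq
      ... | no  ne = inj₂ (toggle-∈ block A ne A∈)
      edge' : ∀ A → A ≡ block ⊎ A ∈ᶠ F₀ → ContainsEdge G A
      edge' A (inj₁ refl) = i , j , block⁺ sep-irrefl , block⁺ unsep , g
      edge' A (inj₂ A∈)   = edge A A∈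
      together : ∀ A → A ∈ᶠ F₀ → ∀ {x y} → x ∊ A → y ∊ A → ¬ Separated F₁ x y
      together A A∈ {x} {y} x∊ y∊ (C , C∈ , s) with inBlock A C A∈ C∈ | s
      ... | inj₁ A⊆C | inj₁ (_ , y∌)  = y∌ (A⊆C y∊)
      ... | inj₁ A⊆C | inj₂ (x∌ , _)  = x∌ (A⊆C x∊)
      ... | inj₂ d   | inj₁ (x∊C , _) = d x x∊ x∊C
      ... | inj₂ d   | inj₂ (_ , y∊C) = d y y∊ y∊C
      with-block : ∀ A → A ∈ᶠ F₀ → Laminar A block
      with-block A A∈ with Finₚ.any? (λ x → (x ∊? A) ×-dec (x ∊? block))
      ... | no none = inj₂ (inj₂ (λ x x∊A x∊b → none (x , x∊A , x∊b)))
      ... | yes (x , x∊A , x∊b) = inj₁ (λ {y} y∊A → block⁺ (λ s →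
              [ block⁻ x∊b , together A A∈ x∊A y∊A ]′ (sep-trans s)))
      laminar' : ∀ A B → A ≡ block ⊎ A ∈ᶠ F₀ → B ≡ block ⊎ B ∈ᶠ F₀ → Laminar A B
      laminar' A B (inj₁ refl) (inj₁ refl) = inj₁ (λ x → x)
      laminar' A B (inj₁ refl) (inj₂ B∈)   = laminar-sym (with-block B B∈)
      laminar' A B (inj₂ A∈)   (inj₁ refl) = with-block A A∈
      laminar' A B (inj₂ A∈)   (inj₂ B∈)   = laminar A B A∈ B∈
      inBlock' : ∀ A C → A ≡ block ⊎ A ∈ᶠ F₀ → C ∈ᶠ F₁ → A ⊆ C ⊎ Disjoint A C
      inBlock' A C (inj₂ A∈) C∈ = inBlock A C A∈ C∈
      inBlock' A C (inj₁ refl) C∈ with i ∊? C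
      ... | no i∌C = inj₂ (λ x x∊b x∊C → block⁻ x∊b (C , C∈ , inj₂ (i∌C , x∊C)))
      ... | yes i∊C = inj₁ (λ {x} x∊b → inside x∊b (x ∊? C))
        where
        inside : ∀ {x} → x ∊ block → Dec (x ∊ C) → x ∊ C
        inside x∊b (yes x∊C) = x∊C
        inside x∊b (no x∌C)  = ⊥-elim (block⁻ x∊b (C , C∈ , inj₁ (i∊C , x∌C)))

  -- If an edge is not separated, adding or removing the block of that edge cancels all terms.
  refinementSum : ∑ Fs (λ F₀ → ⟦ refines? G F₁ F₀ ⟧ *ℤ sgn F₀) ≡ ⟦ separatesEdges? G ⊤ F₁ ⟧
  refinementSum = cases (separatesEdges? G ⊤ F₁)
    where
    cases : Dec (SeparatesEdges G ⊤ F₁) →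
      ∑ Fs (λ F₀ → ⟦ refines? G F₁ F₀ ⟧ *ℤ sgn F₀) ≡ ⟦ separatesEdges? G ⊤ F₁ ⟧
    cases (yes sep) = trans
      (∑-indicator-unique (Fam-finite n) (refines? G F₁) ∅ᶠ refines-∅ (separated⇒∅ sep) sgn)
      (trans (sgn-∅ᶠ n) (sym (⟦⟧-true (separatesEdges? G ⊤ F₁) sep)))
    cases (no ¬sep) = trans (cancel unseparated) (sym (⟦⟧-false (separatesEdges? G ⊤ F₁) ¬sep))
      where
      unseparated : ∃ λ i → ∃ λ j → G i j ≡ true × ¬ Separated F₁ i j
      unseparated with Finₚ.any? (λ i → Finₚ.any? (λ j → (G i j Boolₚ.≟ true) ×-dec ¬? (separated? F₁ i j)))
      ... | yes w = w
      ... | no none = ⊥-elim (¬sep λ i j _ _ g → decide i j g (separated? F₁ i j))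
        where
        decide : ∀ i j → G i j ≡ true → Dec (Separated F₁ i j) → Separated F₁ i j
        decide i j g (yes s) = s
        decide i j g (no ¬s) = ⊥-elim (none (i , j , g , ¬s))
      cancel : (∃ λ i → ∃ λ j → G i j ≡ true × ¬ Separated F₁ i j) →
        ∑ Fs (λ F₀ → ⟦ refines? G F₁ F₀ ⟧ *ℤ sgn F₀) ≡ + 0
      cancel (i , j , g , unsep) = ∑-reversing (Fam-finite n) (toggle B) (toggle-involutive B) _ λ F₀ →
        trans (cong₂ _*ℤ_
          (⟦⟧-cong (refines? G F₁ (toggle B F₀)) (refines? G F₁ F₀)
            (λ r → subst (Refines G F₁) (toggle-involutive B F₀) (refines-toggle g unsep (toggle B F₀) r))
            (refines-toggle g unsep F₀))
          (sgn-toggle B F₀))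
        (sym (ℤₚ.neg-distribʳ-* ⟦ refines? G F₁ F₀ ⟧ (sgn F₀)))
        where
        B = block g unsep

-- Splitting off the clusters that contain Q

deleteZero : ∀ {n} → (Fin (suc n) → Fin (suc n) → Bool) → Fin n → Fin n → Bool
deleteZero G i j = G (suc i) (suc j)

module _ {n : ℕ} (1≤n : 1 ≤ n) (H : Fin (suc n) → Fin (suc n) → Bool) (simple : IsSimpleGraph H)
         (dominating : IsDominating H zero) where

  private
    G : Fin n → Fin n → Bool
    G = deleteZero H
    ⊤-nonempty : ∀ {m} → 1 ≤ m → Nonempty (⊤ {m})
    ⊤-nonempty (s≤s _) = zero , here
    clash : ∀ {b} → b ≡ true → b ≢ false
    clash refl ()

  -- Two clusters with the common vertex zero are never disjoint, so laminarity makes them a chain.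
  -- Their traces are nonempty because there is no loop at zero.
  nested⁻ : ∀ F₀ F₁ → IsNested H (F₀ , F₁) → IsChain ⊤ F₁ × Refines G F₁ F₀
  nested⁻ F₀ F₁ (mkNested ground edge laminar) =
    mkChain ne (λ _ _ _ → Subₚ.∈⊤) cmp (λ _ → ground) ,
    mkRefines (λ A A∈ → edge₀ A (edge (false ∷ A) A∈))
      (λ A B A∈ B∈ → drop A B (laminar (false ∷ A) (false ∷ B) A∈ B∈))
      (λ A C A∈ C∈ → cross A C (laminar (false ∷ A) (true ∷ C) A∈ C∈))
    where
    ne : ∀ C → C ∈ᶠ F₁ → Nonempty C
    ne C C∈ with edge (true ∷ C) C∈
    ... | zero  , zero  , _ , _ , h = ⊥-elim (clash h (proj₂ simple zero))
    ... | suc i , _     , there i∊ , _ , _ = i , i∊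
    ... | zero  , suc j , _ , there j∊ , _ = j , j∊
    cmp : ∀ C D → C ∈ᶠ F₁ → D ∈ᶠ F₁ → Comparable C D
    cmp C D C∈ D∈ with laminar (true ∷ C) (true ∷ D) C∈ D∈
    ... | inj₁ sub        = inj₁ (Subₚ.drop-∷-⊆ sub)
    ... | inj₂ (inj₁ sub) = inj₂ (Subₚ.drop-∷-⊆ sub)
    ... | inj₂ (inj₂ d)   = ⊥-elim (d zero here here)
    edge₀ : ∀ A → ContainsEdge H (false ∷ A) → ContainsEdge G A
    edge₀ A (suc i , suc j , there i∊ , there j∊ , h) = i , j , i∊ , j∊ , h
    drop : ∀ A B → Laminar (false ∷ A) (false ∷ B) → Laminar A B
    drop A B (inj₁ sub)        = inj₁ (Subₚ.drop-∷-⊆ sub)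
    drop A B (inj₂ (inj₁ sub)) = inj₂ (inj₁ (Subₚ.drop-∷-⊆ sub))
    drop A B (inj₂ (inj₂ d))   = inj₂ (inj₂ (λ x x∊A x∊B → d (suc x) (there x∊A) (there x∊B)))
    cross : ∀ A C → Laminar (false ∷ A) (true ∷ C) → A ⊆ C ⊎ Disjoint A C
    cross A C (inj₁ sub)        = inj₁ (Subₚ.drop-∷-⊆ sub)
    cross A C (inj₂ (inj₁ sub)) with sub {zero} here
    ... | ()
    cross A C (inj₂ (inj₂ d))   = inj₂ (λ x x∊A x∊C → d (suc x) (there x∊A) (there x∊C))

  -- A cluster through zero gets its edge for free: zero is adjacent to any vertex of the nonempty
  -- set `C`.
  nested⁺ : ∀ F₀ F₁ → IsChain ⊤ F₁ → Refines G F₁ F₀ → IsNested H (F₀ , F₁)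
  nested⁺ F₀ F₁ ch (mkRefines edge laminar inBlock) =
    mkNested (top ch (⊤-nonempty 1≤n)) edge' laminar'
    where
    edge' : ∀ A → A ∈ᶠ (F₀ , F₁) → ContainsEdge H A
    edge' (false ∷ A) A∈ = let (i , j , i∊ , j∊ , g) = edge A A∈ in suc i , suc j , there i∊ , there j∊ , g
    edge' (true ∷ C)  C∈ = let (c , c∊) = nonempty ch C C∈ in
      zero , suc c , here , there c∊ , dominating (suc c) (λ ())
    lift : ∀ A B → Laminar A B → Laminar (false ∷ A) (false ∷ B)
    lift A B (inj₁ sub)        = inj₁ (Subₚ.s⊆s sub)
    lift A B (inj₂ (inj₁ sub)) = inj₂ (inj₁ (Subₚ.s⊆s sub))
    lift A B (inj₂ (inj₂ d))   = inj₂ (inj₂ λ { (suc x) (there p) (there q) → d x p q })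
    cross : ∀ A C → A ⊆ C ⊎ Disjoint A C → Laminar (false ∷ A) (true ∷ C)
    cross A C (inj₁ sub) = inj₁ (Subₚ.out⊆ sub)
    cross A C (inj₂ d)   = inj₂ (inj₂ λ { (suc x) (there p) (there q) → d x p q })
    laminar' : ∀ A B → A ∈ᶠ (F₀ , F₁) → B ∈ᶠ (F₀ , F₁) → Laminar A B
    laminar' (false ∷ A) (false ∷ B) A∈ B∈ = lift A B (laminar A B A∈ B∈)
    laminar' (false ∷ A) (true ∷ C)  A∈ C∈ = cross A C (inBlock A C A∈ C∈)
    laminar' (true ∷ C)  (false ∷ A) C∈ A∈ = laminar-sym (cross A C (inBlock A C A∈ C∈))
    laminar' (true ∷ C)  (true ∷ D)  C∈ D∈ with comparable ch C D C∈ D∈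
    ... | inj₁ sub = inj₁ (Subₚ.s⊆s sub)
    ... | inj₂ sub = inj₂ (inj₁ (Subₚ.s⊆s sub))

  -- The components of a pair in `Fam (suc n)` are the clusters without and with zero, and the sign
  -- is multiplicative over them. Summing over `F₀` first leaves only the chains that separate all
  -- edges.
  nestedSum : ∑ (elements (Fam-finite (suc n))) (λ F → ⟦ isNested? H F ⟧ *ℤ sgn F) ≡ colouringSum G ⊤
  nestedSum = begin
    ∑ (cartesianProduct Fs Fs) (λ F → ⟦ isNested? H F ⟧ *ℤ sgn F)
      ≡⟨ ∑-cartesianProduct Fs Fs _ ⟩
    ∑ Fs (λ F₀ → ∑ Fs (λ F₁ → ⟦ isNested? H (F₀ , F₁) ⟧ *ℤ sgn {suc n} (F₀ , F₁)))
      ≡⟨ ∑-swap Fs Fs (λ F₀ F₁ → ⟦ isNested? H (F₀ , F₁) ⟧ *ℤ sgn {suc n} (F₀ , F₁)) ⟩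
    ∑ Fs (λ F₁ → ∑ Fs (λ F₀ → ⟦ isNested? H (F₀ , F₁) ⟧ *ℤ sgn {suc n} (F₀ , F₁)))
      ≡⟨ ∑-cong Fs (λ F₁ → ∑-cong Fs (λ F₀ → factor F₀ F₁)) ⟩
    ∑ Fs (λ F₁ → ∑ Fs (λ F₀ → (⟦ isChain? ⊤ F₁ ⟧ *ℤ sgn F₁) *ℤ (⟦ refines? G F₁ F₀ ⟧ *ℤ sgn F₀)))
      ≡⟨ ∑-cong Fs (λ F₁ → trans (∑-*ˡ (⟦ isChain? ⊤ F₁ ⟧ *ℤ sgn F₁) Fs (λ F₀ → ⟦ refines? G F₁ F₀ ⟧ *ℤ sgn F₀))
           (cong ((⟦ isChain? ⊤ F₁ ⟧ *ℤ sgn F₁) *ℤ_) (refinementSum G F₁))) ⟩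
    ∑ Fs (λ F₁ → (⟦ isChain? ⊤ F₁ ⟧ *ℤ sgn F₁) *ℤ ⟦ separatesEdges? G ⊤ F₁ ⟧)
      ≡⟨ ∑-cong Fs (λ F₁ → trans (*-rotate ⟦ isChain? ⊤ F₁ ⟧ (sgn F₁) ⟦ separatesEdges? G ⊤ F₁ ⟧)
           (cong (_*ℤ sgn F₁) (⟦⟧-× (isChain? ⊤ F₁) (separatesEdges? G ⊤ F₁) (isColouring? G ⊤ F₁) _,_ id))) ⟩
    colouringSum G ⊤ ∎
    where
    open ≡-Reasoning
    Fs = elements (Fam-finite n)
    *-rotate : ∀ a b c → (a *ℤ b) *ℤ c ≡ (a *ℤ c) *ℤ b
    *-rotate a b c = trans (ℤₚ.*-assoc a b c) (trans (cong (a *ℤ_) (ℤₚ.*-comm b c)) (sym (ℤₚ.*-assoc a c b)))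
    factor : ∀ F₀ F₁ → ⟦ isNested? H (F₀ , F₁) ⟧ *ℤ sgn {suc n} (F₀ , F₁) ≡
      (⟦ isChain? ⊤ F₁ ⟧ *ℤ sgn F₁) *ℤ (⟦ refines? G F₁ F₀ ⟧ *ℤ sgn F₀)
    factor F₀ F₁ = begin
      ⟦ isNested? H (F₀ , F₁) ⟧ *ℤ sgn {suc n} (F₀ , F₁)
        ≡⟨ cong₂ _*ℤ_ (sym (⟦⟧-× (isChain? ⊤ F₁) (refines? G F₁ F₀) (isNested? H (F₀ , F₁))
             (nested⁺ F₀ F₁) (nested⁻ F₀ F₁))) (sgn-pair F₀ F₁) ⟩
      (⟦ isChain? ⊤ F₁ ⟧ *ℤ ⟦ refines? G F₁ F₀ ⟧) *ℤ (sgn F₀ *ℤ sgn F₁)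
        ≡⟨ cong ((⟦ isChain? ⊤ F₁ ⟧ *ℤ ⟦ refines? G F₁ F₀ ⟧) *ℤ_) (ℤₚ.*-comm (sgn F₀) (sgn F₁)) ⟩
      (⟦ isChain? ⊤ F₁ ⟧ *ℤ ⟦ refines? G F₁ F₀ ⟧) *ℤ (sgn F₁ *ℤ sgn F₀)
        ≡⟨ ℤₚ.*-assoc (⟦ isChain? ⊤ F₁ ⟧ *ℤ ⟦ refines? G F₁ F₀ ⟧) (sgn F₁) (sgn F₀) ⟨
      ((⟦ isChain? ⊤ F₁ ⟧ *ℤ ⟦ refines? G F₁ F₀ ⟧) *ℤ sgn F₁) *ℤ sgn F₀
        ≡⟨ cong (_*ℤ sgn F₀) (*-rotate ⟦ isChain? ⊤ F₁ ⟧ ⟦ refines? G F₁ F₀ ⟧ (sgn F₁)) ⟩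
      ((⟦ isChain? ⊤ F₁ ⟧ *ℤ sgn F₁) *ℤ ⟦ refines? G F₁ F₀ ⟧) *ℤ sgn F₀
        ≡⟨ ℤₚ.*-assoc (⟦ isChain? ⊤ F₁ ⟧ *ℤ sgn F₁) ⟦ refines? G F₁ F₀ ⟧ (sgn F₀) ⟩
      (⟦ isChain? ⊤ F₁ ⟧ *ℤ sgn F₁) *ℤ (⟦ refines? G F₁ F₀ ⟧ *ℤ sgn F₀) ∎

-- Trees rooted at the leaf zero

root : ∀ {N K} → Fin (suc N) ⊎ Fin K
root = inj₁ zero

_≟ᵥ_ : ∀ {N K} → DecidableEquality (Fin N ⊎ Fin K)
_≟ᵥ_ = Sumₚ.≡-dec Finₚ._≟_ Finₚ._≟_

-- `depth` is any rank that drops toward the root: the distance for a given tree, the number of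
-- missing leaves for the tree of a family. `height` makes descents terminate, and `par root` is
-- arbitrary.
record Rooted {N} (T : LTree (suc N)) : Set where
  field
    par       : Vtx T → Vtx T
    depth     : Vtx T → ℕ
    height    : ℕ
    depth≤    : ∀ v → depth v ≤ height
    par-depth : ∀ {v} → v ≢ root → depth (par v) < depth v
    par-adj   : ∀ {v} → v ≢ root → Adj (E T) v (par v)
    adj-par   : ∀ {u v} → Adj (E T) u v → (u ≢ root × par u ≡ v) ⊎ (v ≢ root × par v ≡ u)
    adj-sym   : ∀ {u v} → Adj (E T) u v → Adj (E T) v u

module Descent {N} {T : LTree (suc N)} (R : Rooted T) where
  open Rooted R

  infix 4 _⊑_

  data _⊑_ : Vtx T → Vtx T → Set where
    stop : ∀ {v} → v ⊑ v
    up   : ∀ {v u} → v ≢ root → par v ⊑ u → v ⊑ u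

  ⊑-trans : ∀ {u v w} → u ⊑ v → v ⊑ w → u ⊑ w
  ⊑-trans stop     q = q
  ⊑-trans (up n p) q = up n (⊑-trans p q)

  ⊑-depth : ∀ {v u} → v ⊑ u → depth u ≤ depth v
  ⊑-depth stop     = ℕₚ.≤-refl
  ⊑-depth (up n p) = ℕₚ.≤-trans (⊑-depth p) (ℕₚ.<⇒≤ (par-depth n))

  ⊑-antisym : ∀ {v u} → v ⊑ u → u ⊑ v → v ≡ u
  ⊑-antisym stop     q = refl
  ⊑-antisym (up n p) q = ⊥-elim (ℕₚ.<⇒≱ (par-depth n) (ℕₚ.≤-trans (⊑-depth q) (⊑-depth p)))

  ⊑-up : ∀ {v u} → v ⊑ u → v ≢ u → v ≢ root × par v ⊑ u
  ⊑-up stop     ne = ⊥-elim (ne refl)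
  ⊑-up (up n p) ne = n , p

  root⊑ : ∀ {u} → root ⊑ u → u ≡ root
  root⊑ stop     = refl
  root⊑ (up n p) = ⊥-elim (n refl)

  ⊑-root : ∀ v → v ⊑ root
  ⊑-root v₀ = go (suc (depth v₀)) v₀ ℕₚ.≤-refl
    where
    -- A parent is not structurally smaller, so the recursion runs on a bound for the depth.
    go : ∀ m v → depth v < m → v ⊑ root
    go (suc m) v (s≤s le) with v ≟ᵥ root
    ... | yes refl = stop
    ... | no  n    = up n (go m (par v) (ℕₚ.<-≤-trans (par-depth n) le))

  ⊑-chain : ∀ {v u w} → v ⊑ u → v ⊑ w → u ⊑ w ⊎ w ⊑ u
  ⊑-chain stop     q        = inj₁ q
  ⊑-chain (up n p) stop     = inj₂ (up n p)
  ⊑-chain (up n p) (up _ q) = ⊑-chain p q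

  _⊑?_ : ∀ v u → Dec (v ⊑ u)
  v₀ ⊑? u = go (suc (depth v₀)) v₀ ℕₚ.≤-refl
    where
    go : ∀ m v → depth v < m → Dec (v ⊑ u)
    go (suc m) v (s≤s le) with v ≟ᵥ u
    ... | yes refl = yes stop
    ... | no  v≢u with v ≟ᵥ root
    ...   | yes refl = no (λ p → v≢u (sym (root⊑ p)))
    ...   | no  n    = map′ (up n) (λ p → proj₂ (⊑-up p v≢u)) (go m (par v) (ℕₚ.<-≤-trans (par-depth n) le))

  childToward : ∀ {v u} → v ⊑ u → v ≢ u → ∃ λ c → c ≢ root × par c ≡ u × v ⊑ c
  childToward stop ne = ⊥-elim (ne refl)
  childToward {v} {u} (up n p) ne with par v ≟ᵥ u
  ... | yes eq = v , n , eq , stop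
  ... | no ne' = let (c , c≢ , eq , q) = childToward p ne' in c , c≢ , eq , up n q

  par⋢ : ∀ {c u} → c ≢ root → par c ≡ u → ¬ (u ⊑ c)
  par⋢ n refl p = ℕₚ.<⇒≱ (par-depth n) (⊑-depth p)

  siblings⋢ : ∀ {c c' u} → c ≢ root → par c ≡ u → c' ≢ root → par c' ≡ u → c ≢ c' → ¬ (c ⊑ c')
  siblings⋢ {c} {c'} n eq n' eq' c≢c' p =
    par⋢ n' eq' (subst (_⊑ c') eq (proj₂ (⊑-up p c≢c')))

  abstract
    cluster : Vtx T → Subset N
    cluster v = tabulate (λ a → does (inj₁ (suc a) ⊑? v))

    cluster⁺ : ∀ {v a} → inj₁ (suc a) ⊑ v → a ∊ cluster v
    cluster⁺ {v} = ∊-tabulate⁺ (λ a → inj₁ (suc a) ⊑? v)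

    cluster⁻ : ∀ {v a} → a ∊ cluster v → inj₁ (suc a) ⊑ v
    cluster⁻ {v} = ∊-tabulate⁻ (λ a → inj₁ (suc a) ⊑? v)

  -- A relation rather than a function of the tree, so that a family computed from a tree and a
  -- family from which a tree was built are treated alike.
  Codes : Fam N → Set
  Codes F = (∀ x → cluster (inj₂ x) ∈ᶠ F) × (∀ A → A ∈ᶠ F → ∃ λ x → cluster (inj₂ x) ≡ A)

-- The degree conditions in rooted form: no children at the other leaves, one child `apex` at the
-- root leaf, two or more at each internal vertex.
record Shape {N} {T : LTree (suc N)} (R : Rooted T) : Set where
  open Rooted R
  field
    childless   : ∀ a {v} → v ≢ root → par v ≢ inj₁ (suc a)
    apex        : Fin (k T)
    apex-par    : par (inj₂ apex) ≡ root
    apex-unique : ∀ {v} → v ≢ root → par v ≡ root → v ≡ inj₂ apex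
    twoChildren : ∀ x → ∃ λ c → ∃ λ c' → c ≢ c' ×
      (c ≢ root × par c ≡ inj₂ x) × (c' ≢ root × par c' ≡ inj₂ x)

module Clusters {N} {T : LTree (suc N)} {R : Rooted T} (S : Shape R) where
  open Rooted R
  open Descent R
  open Shape S

  -- Passing to a child of an internal vertex raises the depth, which `height` bounds; the descent
  -- can stop only at a leaf.
  leafBelow : ∀ v → v ≢ root → ∃ λ a → inj₁ (suc a) ⊑ v
  leafBelow v₀ = go (suc height) v₀ (ℕₚ.m≤m+n (suc height) (depth v₀))
    where
    go : ∀ m v → height < m + depth v → v ≢ root → ∃ λ a → inj₁ (suc a) ⊑ v
    go zero    v lt n = ⊥-elim (ℕₚ.<⇒≱ lt (depth≤ v))
    go (suc m) (inj₁ zero)    lt n = ⊥-elim (n refl)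
    go (suc m) (inj₁ (suc a)) lt n = a , stop
    go (suc m) (inj₂ x) lt n with twoChildren x
    ... | c , _ , _ , (c≢ , eq) , _ = let (a , p) = go m c lt' c≢ in a , ⊑-trans p (up c≢ (subst (par c ⊑_) eq stop))
      where
      lt' : height < m + depth c
      lt' = ℕₚ.<-≤-trans lt (subst (_≤ m + depth c) (ℕₚ.+-suc m (depth (inj₂ x)))
        (ℕₚ.+-monoʳ-≤ m (subst (λ u → depth u < depth c) eq (par-depth c≢))))

  cluster-mono : ∀ {u v} → u ⊑ v → cluster u ⊆ cluster v
  cluster-mono p a∊ = cluster⁺ (⊑-trans (cluster⁻ a∊) p)

  otherChild : ∀ {c u} → c ≢ root → u ≢ root → par c ≡ u → ∃ λ c' → c ≢ c' × c' ≢ root × par c' ≡ u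
  otherChild {u = inj₁ zero}    n u≢ eq = ⊥-elim (u≢ refl)
  otherChild {u = inj₁ (suc a)} n u≢ eq = ⊥-elim (childless a n eq)
  otherChild {c} {inj₂ x} n u≢ eq with twoChildren x
  ... | d , d' , d≢d' , (nd , ed) , (nd' , ed') with c ≟ᵥ d
  ...   | yes refl = d' , d≢d' , nd' , ed'
  ...   | no  c≢d  = d , c≢d , nd , ed

  -- Some leaf lies below both vertices, so they are comparable. If `v` were strictly below `u`, a
  -- leaf under a child of `u` not leading to `v` would lie below `u` but not below `v`; such a
  -- child exists because `u` has two.
  cluster-reflect : ∀ {u v} → u ≢ root → cluster u ⊆ cluster v → u ⊑ v
  cluster-reflect {u} {v} n sub with leafBelow u n
  ... | a , a⊑u with ⊑-chain a⊑u (cluster⁻ (sub (cluster⁺ a⊑u)))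
  ...   | inj₁ u⊑v = u⊑v
  ...   | inj₂ v⊑u with v ≟ᵥ u
  ...     | yes refl = stop
  ...     | no v≢u with childToward v⊑u v≢u
  ...       | c , nc , ec , v⊑c with otherChild nc n ec
  ...         | c' , c≢c' , nc' , ec' with leafBelow c' nc'
  ...           | b , b⊑c' with ⊑-chain b⊑c' (⊑-trans (cluster⁻ (sub (cluster⁺ b⊑u))) v⊑c)
    where
    b⊑u : inj₁ (suc b) ⊑ u
    b⊑u = ⊑-trans b⊑c' (up nc' (subst (par c' ⊑_) ec' stop))
  ...             | inj₁ c'⊑c = ⊥-elim (siblings⋢ nc' ec' nc ec (c≢c' ∘ sym) c'⊑c)
  ...             | inj₂ c⊑c' = ⊥-elim (siblings⋢ nc ec nc' ec' c≢c' c⊑c')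

  cluster-injective : ∀ {u v} → u ≢ root → v ≢ root → cluster u ≡ cluster v → u ≡ v
  cluster-injective nu nv eq = ⊑-antisym
    (cluster-reflect nu (Subₚ.⊆-reflexive eq)) (cluster-reflect nv (Subₚ.⊆-reflexive (sym eq)))

  cluster-laminar : ∀ u v → Laminar (cluster u) (cluster v)
  cluster-laminar u v with Finₚ.any? (λ a → (a ∊? cluster u) ×-dec (a ∊? cluster v))
  ... | no none = inj₂ (inj₂ (λ a p q → none (a , p , q)))
  ... | yes (a , p , q) with ⊑-chain (cluster⁻ p) (cluster⁻ q)
  ...   | inj₁ u⊑v = inj₁ (cluster-mono u⊑v)
  ...   | inj₂ v⊑u = inj₂ (inj₁ (cluster-mono v⊑u))

  leaf⊑leaf : ∀ {a b} → inj₁ (suc b) ⊑ inj₁ (suc a) → b ≡ a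
  leaf⊑leaf {a} {b} p with b Finₚ.≟ a
  ... | yes eq = eq
  ... | no ne with childToward p (λ { refl → ne refl })
  ...   | c , n , eq , _ = ⊥-elim (childless a n eq)

  ⊑-apex : ∀ {v} → v ≢ root → v ⊑ inj₂ apex
  ⊑-apex {v} n with childToward (⊑-root v) n
  ... | c , nc , eq , p = subst (v ⊑_) (apex-unique nc eq) p

  cluster-apex : cluster (inj₂ apex) ≡ ⊤
  cluster-apex = Subₚ.⊆-antisym Subₚ.⊆⊤ (λ _ → cluster⁺ (⊑-apex (λ ())))

-- Two trees with the same code

module Match {N} {T T' : LTree (suc N)} {R : Rooted T} {R' : Rooted T'} (S : Shape R) (S' : Shape R')
             {F : Fam N} (codes : Descent.Codes R F) (codes' : Descent.Codes R' F) where
  private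
    module D = Descent R
    module D' = Descent R'
    module C = Clusters S
    module C' = Clusters S'

  image : Vtx T → Vtx T'
  image (inj₁ a) = inj₁ a
  image (inj₂ x) = inj₂ (proj₁ (proj₂ codes' _ (proj₁ codes x)))

  image-root : ∀ {v} → v ≢ root → image v ≢ root
  image-root {inj₁ a} n = λ { refl → n refl }
  image-root {inj₂ x} n = λ ()

  image-cluster : ∀ {v} → v ≢ root → D'.cluster (image v) ≡ D.cluster v
  image-cluster {inj₁ zero}    n = ⊥-elim (n refl)
  image-cluster {inj₁ (suc a)} n = Subₚ.⊆-antisym
    (λ b∊ → D.cluster⁺ (subst (λ b → inj₁ (suc b) D.⊑ inj₁ (suc a)) (sym (C'.leaf⊑leaf (D'.cluster⁻ b∊))) D.stop))
    (λ b∊ → D'.cluster⁺ (subst (λ b → inj₁ (suc b) D'.⊑ inj₁ (suc a)) (sym (C.leaf⊑leaf (D.cluster⁻ b∊))) D'.stop))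
  image-cluster {inj₂ x} n = proj₂ (proj₂ codes' _ (proj₁ codes x))

  -- Ancestry is inclusion of clusters, and `image` preserves clusters. The root is treated apart
  -- because it has the same cluster as the apex.
  image-⊑ : ∀ {u v} → u D.⊑ v → image u D'.⊑ image v
  image-⊑ {u} {v} p with v ≟ᵥ root | u ≟ᵥ root
  ... | yes refl | _ = D'.⊑-root (image u)
  ... | no nv | yes refl = ⊥-elim (nv (D.root⊑ p))
  ... | no nv | no nu = C'.cluster-reflect (image-root nu)
    (λ a∊ → subst (_ ∊_) (sym (image-cluster nv))
      (C.cluster-mono p (subst (_ ∊_) (image-cluster nu) a∊)))

module MatchInverse {N} {T T' : LTree (suc N)} {R : Rooted T} {R' : Rooted T'} (S : Shape R) (S' : Shape R')
             {F : Fam N} (codes : Descent.Codes R F) (codes' : Descent.Codes R' F) where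
  private
    module C = Clusters S
    module M = Match S S' codes codes'
    module M' = Match S' S codes' codes

  image-inverse : ∀ v → M'.image (M.image v) ≡ v
  image-inverse (inj₁ a) = refl
  image-inverse (inj₂ x) = C.cluster-injective (λ ()) (λ ())
    (trans (M'.image-cluster {M.image (inj₂ x)} (λ ())) (M.image-cluster {inj₂ x} (λ ())))

module MatchAdjacency {N} {T T' : LTree (suc N)} {R : Rooted T} {R' : Rooted T'} (S : Shape R) (S' : Shape R')
             {F : Fam N} (codes : Descent.Codes R F) (codes' : Descent.Codes R' F) where
  private
    module R = Rooted R
    module R' = Rooted R'
    module D = Descent R
    module D' = Descent R'
    module M = Match S S' codes codes'
    module M' = Match S' S codes' codes
    module I = MatchInverse S S' codes codes'
    module I' = MatchInverse S' S codes' codes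

  -- The parent is the least vertex strictly above, so order isomorphisms preserve it.
  image-par : ∀ {v} → v ≢ root → R'.par (M.image v) ≡ M.image (R.par v)
  image-par {v} n = D'.⊑-antisym
    (proj₂ (D'.⊑-up (M.image-⊑ (D.up n D.stop)) distinct))
    (subst (M.image (R.par v) D'.⊑_) (I'.image-inverse _)
      (M.image-⊑ (proj₂ (D.⊑-up
        (subst (D._⊑ M'.image (R'.par (M.image v))) (I.image-inverse v)
          (M'.image-⊑ (D'.up (M.image-root n) D'.stop)))
        distinct'))))
    where
    distinct : M.image v ≢ M.image (R.par v)
    distinct eq = D.par⋢ n refl (subst (D._⊑ v)
      (trans (sym (I.image-inverse v)) (trans (cong M'.image eq) (I.image-inverse _))) D.stop)
    distinct' : v ≢ M'.image (R'.par (M.image v))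
    distinct' eq = D'.par⋢ (M.image-root n) refl (subst (D'._⊑ M.image v)
      (trans (cong M.image eq) (I'.image-inverse _)) D'.stop)

  image-adj : ∀ {u v} → Adj (E T) u v → Adj (E T') (M.image u) (M.image v)
  image-adj {u} {v} e with R.adj-par e
  ... | inj₁ (n , refl) = subst (Adj (E T') (M.image u)) (image-par n) (R'.par-adj (M.image-root n))
  ... | inj₂ (n , refl) = R'.adj-sym (subst (Adj (E T') (M.image v)) (image-par n) (R'.par-adj (M.image-root n)))

sameCode⇒≅ : ∀ {N} {T T' : LTree (suc N)} {R : Rooted T} {R' : Rooted T'} → Shape R → Shape R' →
  ∀ {F} → Descent.Codes R F → Descent.Codes R' F → T ≅ T'
sameCode⇒≅ {T = T} {T'} S S' c c' =
  mk↔ₛ′ M.image M'.image I'.image-inverse I.image-inverse ,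
  (λ a → refl) ,
  (λ u v → ⇔-true
    (λ e → subst₂ (Adj (E T)) (I.image-inverse u) (I.image-inverse v) (J'.image-adj e))
    J.image-adj)
  where
  module M = Match S S' c c'
  module M' = Match S' S c' c
  module I = MatchInverse S S' c c'
  module I' = MatchInverse S' S c' c
  module J = MatchAdjacency S S' c c'
  module J' = MatchAdjacency S' S c' c

-- Isomorphic trees have the same code

≅-sym : ∀ {m} {T T' : LTree m} → T ≅ T' → T' ≅ T
≅-sym {T = T} {T'} (φ , leaf , adj) =
  mk↔ₛ′ (Inverse.from φ) (Inverse.to φ) (Inverse.strictlyInverseʳ φ) (Inverse.strictlyInverseˡ φ) ,
  (λ a → trans (cong (Inverse.from φ) (sym (leaf a))) (Inverse.strictlyInverseʳ φ (inj₁ a))) ,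
  (λ u v → trans (sym (adj (Inverse.from φ u) (Inverse.from φ v)))
    (cong₂ (E T') (Inverse.strictlyInverseˡ φ u) (Inverse.strictlyInverseˡ φ v)))

module _ {N} {T T' : LTree (suc N)} (R : Rooted T) (R' : Rooted T') (iso : T ≅ T') where
  private
    module R = Rooted R
    module R' = Rooted R'
    module D = Descent R
    module D' = Descent R'
    φ : Vtx T → Vtx T'
    φ = Inverse.to (proj₁ iso)
    ψ : Vtx T' → Vtx T
    ψ = Inverse.from (proj₁ iso)
    ψφ : ∀ v → ψ (φ v) ≡ v
    ψφ = Inverse.strictlyInverseʳ (proj₁ iso)
    φ-leaf : ∀ a → φ (inj₁ a) ≡ inj₁ a
    φ-leaf = proj₁ (proj₂ iso)
    φ-injective : ∀ {u v} → φ u ≡ φ v → u ≡ v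
    φ-injective {u} {v} eq = trans (sym (ψφ u)) (trans (cong ψ eq) (ψφ v))
    φ-root : ∀ {v} → v ≢ root → φ v ≢ root
    φ-root n eq = n (φ-injective (trans eq (sym (φ-leaf zero))))
    φ-root⁻ : ∀ {v} → φ v ≢ root → v ≢ root
    φ-root⁻ n refl = n (φ-leaf zero)
    φ-par : ∀ {v} → v ≢ root → R'.par (φ v) ≡ φ (R.par v)
    φ-par {v₀} = go (suc (R.depth v₀)) v₀ ℕₚ.≤-refl
      where
      go : ∀ m v → R.depth v < m → v ≢ root → R'.par (φ v) ≡ φ (R.par v)
      go (suc m) v (s≤s le) n with R'.adj-par (trans (proj₂ (proj₂ iso) v (R.par v)) (R.par-adj n))
      ... | inj₁ (_ , eq) = eq
      -- If the isomorphism reversed this edge, induction at `R.par v` would make `v` the parent of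
      -- its own parent.
      ... | inj₂ (n' , eq) = ⊥-elim (ℕₚ.<-asym (R.par-depth n) (subst (λ u → R.depth u < R.depth (R.par v))
              (φ-injective (trans (sym (go m (R.par v) (ℕₚ.<-≤-trans (R.par-depth n) le) (φ-root⁻ n'))) eq))
              (R.par-depth (φ-root⁻ n'))))

  iso-⊑ : ∀ {u v} → u D.⊑ v → φ u D'.⊑ φ v
  iso-⊑ D.stop = D'.stop
  iso-⊑ {u} {v} (D.up n p) = D'.up (φ-root n) (subst (D'._⊑ φ v) (sym (φ-par n)) (iso-⊑ p))

  iso-internal : ∀ x → ∃ λ y → φ (inj₂ x) ≡ inj₂ y
  iso-internal x with φ (inj₂ x) in eq
  ... | inj₂ y = y , refl
  ... | inj₁ a with φ-injective {inj₂ x} {inj₁ a} (trans eq (sym (φ-leaf a)))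
  ...   | ()

  iso-cluster⊆ : ∀ v → D.cluster v ⊆ D'.cluster (φ v)
  iso-cluster⊆ v {a} a∊ = D'.cluster⁺ (subst (D'._⊑ φ v) (φ-leaf (suc a)) (iso-⊑ (D.cluster⁻ a∊)))

module _ {N} {T T' : LTree (suc N)} (R : Rooted T) (R' : Rooted T') (iso : T ≅ T') where

  iso-cluster : ∀ v → Descent.cluster R v ≡ Descent.cluster R' (Inverse.to (proj₁ iso) v)
  iso-cluster v = Subₚ.⊆-antisym (iso-cluster⊆ R R' iso v)
    (λ a∊ → subst (λ u → _ ∊ Descent.cluster R u) (Inverse.strictlyInverseʳ (proj₁ iso) v)
      (iso-cluster⊆ R' R (≅-sym iso) (Inverse.to (proj₁ iso) v) a∊))

  iso-code⊆ : ∀ {F F'} → Descent.Codes R F → Descent.Codes R' F' → ∀ A → A ∈ᶠ F → A ∈ᶠ F'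
  iso-code⊆ {F' = F'} (_ , sur) (mem' , _) A A∈ with sur A A∈
  ... | x , refl with iso-internal R R' iso x
  ...   | y , eq = subst (_∈ᶠ F') (sym (trans (iso-cluster (inj₂ x)) (cong (Descent.cluster R') eq))) (mem' y)

≅⇒sameCode : ∀ {N} {T T' : LTree (suc N)} (R : Rooted T) (R' : Rooted T') → T ≅ T' →
  ∀ {F F'} → Descent.Codes R F → Descent.Codes R' F' → F ≡ F'
≅⇒sameCode R R' iso c c' =
  fam-ext-⇔ (iso-code⊆ R R' iso c c') (iso-code⊆ R' R (≅-sym iso) c' c)

-- Graph-theoretic trees are rooted

∃-vtx? : ∀ {M K} {P : Fin M ⊎ Fin K → Set} → (∀ v → Dec (P v)) → Dec (∃ P)
∃-vtx? P? = map′
  (λ { (inj₁ (a , p)) → inj₁ a , p ; (inj₂ (x , p)) → inj₂ x , p })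
  (λ { (inj₁ a , p) → inj₁ (a , p) ; (inj₂ x , p) → inj₂ (x , p) })
  (Finₚ.any? (P? ∘ inj₁) ⊎-dec Finₚ.any? (P? ∘ inj₂))

allVtx-complete : ∀ {m} (T : LTree m) v → v ∈ allVtx T
allVtx-complete T (inj₁ a) = ∈-++⁺ˡ (∈-map⁺ inj₁ (allFin-complete a))
allVtx-complete {m} T (inj₂ x) = ∈-++⁺ʳ (map inj₁ (allFin m)) (∈-map⁺ inj₂ (allFin-complete x))

allVtx-unique : ∀ {m} (T : LTree m) → Unique (allVtx T)
allVtx-unique {m} T = Uniqueₚ.++⁺
  (Uniqueₚ.map⁺ Sumₚ.inj₁-injective (allFin-unique m))
  (Uniqueₚ.map⁺ Sumₚ.inj₂-injective (allFin-unique (k T)))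
  disjoint
  where
  disjoint : ∀ {v} → ¬ (v ∈ map inj₁ (allFin m) × v ∈ map inj₂ (allFin (k T)))
  disjoint (p , q) with ∈-map⁻ inj₁ p | ∈-map⁻ inj₂ q
  ... | _ , _ , refl | _ , _ , ()

neighbours : ∀ {m} (T : LTree m) → Vtx T → List (Vtx T)
neighbours T v = filterᵇ (E T v) (allVtx T)

∈-neighbours⁺ : ∀ {m} (T : LTree m) {v w} → Adj (E T) v w → w ∈ neighbours T v
∈-neighbours⁺ T {v} {w} e = ∈-filter⁺ (Boolₚ.T? ∘ E T v) (allVtx-complete T w) (from Boolₚ.T-≡ e)

∈-neighbours⁻ : ∀ {m} (T : LTree m) {v w} → w ∈ neighbours T v → Adj (E T) v w
∈-neighbours⁻ T {v} w∈ = to Boolₚ.T-≡ (proj₂ (∈-filter⁻ (Boolₚ.T? ∘ E T v) {xs = allVtx T} w∈))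

neighbours-unique : ∀ {m} (T : LTree m) v → Unique (neighbours T v)
neighbours-unique T v = Uniqueₚ.filter⁺ (Boolₚ.T? ∘ E T v) (allVtx-unique T)

data Path {V : Set} (R : V → V → Set) (w : V) : V → List V → Set where
  []  : Path R w w []
  _∷_ : ∀ {u u' vs} → R u u' → Path R w u' vs → Path R w u (u' ∷ vs)

module _ {V : Set} (_≟_ : DecidableEquality V) {R : V → V → Set} where

  open DecMembership _≟_ using (_∈?_)

  path-suffix : ∀ {P : V → Set} {w u v vs} → u ∈ v ∷ vs → Path R w v vs → Unique (v ∷ vs) → All P (v ∷ vs) →
    ∃ λ us → Path R w u us × Unique (u ∷ us) × All P (u ∷ us)
  path-suffix (here refl) p un ps = _ , p , un , ps
  path-suffix (there u∈) (_ ∷ p) (_ ∷ un) (_ ∷ ps) = path-suffix u∈ p un ps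

  -- Loop erasure: if the new first vertex already occurs on the path, only the part from that
  -- occurrence on is kept. `P` is carried along to record which vertex is avoided.
  simplePath : ∀ {P : V → Set} {u w} → Star (λ x y → R x y × P y) u w → P u →
    ∃ λ vs → Path R w u vs × Unique (u ∷ vs) × All P (u ∷ vs)
  simplePath ε pu = [] , [] , [] ∷ [] , pu ∷ []
  simplePath {u = u} (_◅_ {j = u'} (r , pu') rest) pu with simplePath rest pu'
  ... | vs , path , un , ps with u ∈? (u' ∷ vs)
  ...   | yes u∈ = path-suffix u∈ path un ps
  ...   | no  u∉ = u' ∷ vs , r ∷ path , Allₚ.¬Any⇒All¬ _ u∉ ∷ un , pu ∷ ps

  path-linked : ∀ {w u vs z} → Path R w u vs → R w z → Linked R ((u ∷ vs) ∷ʳ z)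
  path-linked []       r = r ∷ [-]
  path-linked (s ∷ p) r = s ∷ path-linked p r

  -- After loop erasure the walk from `u` to `w` is simple, still avoids `v` and has at least one
  -- step, so together with `v` there are three or more vertices.
  detour⇒cycle : ∀ {v u w} → R v u → R w v → u ≢ v → u ≢ w →
    Star (λ x y → R x y × y ≢ v) u w → HasCycle R 3
  detour⇒cycle {v} {u} r s u≢v u≢w star with simplePath star u≢v
  ... | [] , [] , _ , _ = ⊥-elim (u≢w refl)
  ... | x ∷ vs , path , un , avoid =
    v , u ∷ x ∷ vs , All.map (λ ne eq → ne (sym eq)) avoid ∷ un , s≤s (s≤s (s≤s z≤n)) , r ∷ path-linked path s

module _ {N} (T : LTree (suc N)) (tree : IsTree T) where

  private
    e-sym : ∀ {u v} → Adj (E T) u v → Adj (E T) v u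
    e-sym {u} {v} = trans (proj₁ (proj₁ tree) v u)
    e-irrefl : ∀ {u} → ¬ Adj (E T) u u
    e-irrefl {u} e with trans (sym e) (proj₂ (proj₁ tree) u)
    ... | ()

    -- The ball of radius `n` about the root. Membership is decidable, so the walk supplied by
    -- connectedness can be improved to a least radius, the distance.
    Within : ℕ → Vtx T → Set
    Within zero    v = v ≡ root
    Within (suc n) v = Within n v ⊎ ∃ λ w → Adj (E T) v w × Within n w

    within? : ∀ n v → Dec (Within n v)
    within? zero    v = v ≟ᵥ root
    within? (suc n) v = within? n v ⊎-dec ∃-vtx? (λ w → (E T v w Boolₚ.≟ true) ×-dec within? n w)

    within-mono : ∀ {m n v} → m ≤ n → Within m v → Within n v
    within-mono {n = n} le p = go (ℕₚ.≤⇒≤′ le) p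
      where
      go : ∀ {m n v} → m ≤′ n → Within m v → Within n v
      go (≤′-reflexive refl) p = p
      go (≤′-step le) p = inj₁ (go le p)

    star-within : ∀ {v} → Star (Adj (E T)) v root → ∃ λ n → Within n v
    star-within ε = zero , refl
    star-within (e ◅ s) = let (n , p) = star-within s in suc n , inj₂ (_ , e , p)

    least : ∀ n {v} → Within n v → ∃ λ d → Within d v × (∀ m → Within m v → d ≤ m)
    least zero p = zero , p , λ _ _ → z≤n
    least (suc n) {v} p with within? n v
    ... | yes q = least n q
    ... | no ¬q = suc n , p , λ m r → ℕₚ.≰⇒> (λ m≤n → ¬q (within-mono m≤n r))

    distance : ∀ v → ∃ λ d → Within d v × (∀ m → Within m v → d ≤ m)
    distance v = let (n , p) = star-within (proj₁ (proj₂ tree) v root) in least n p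

    depth : Vtx T → ℕ
    depth v = proj₁ (distance v)

    depth-root : depth root ≡ 0
    depth-root = ℕₚ.n≤0⇒n≡0 (proj₂ (proj₂ (distance root)) 0 refl)

    closer : ∀ v → v ≢ root → ∃ λ w → Adj (E T) v w × depth w < depth v
    closer v n with distance v
    ... | zero  , p , _ = ⊥-elim (n p)
    ... | suc d , inj₁ p , least-d = ⊥-elim (ℕₚ.<⇒≱ ℕₚ.≤-refl (least-d d p))
    ... | suc d , inj₂ (w , e , p) , _ = w , e , s≤s (proj₂ (proj₂ (distance w)) d p)

    parent : ∀ v → Dec (v ≡ root) → Vtx T
    parent v (yes _) = root
    parent v (no n)  = proj₁ (closer v n)

    par : Vtx T → Vtx T
    par v = parent v (v ≟ᵥ root)

    par-spec : ∀ {v} → v ≢ root → Adj (E T) v (par v) × depth (par v) < depth v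
    par-spec {v} n with v ≟ᵥ root
    ... | yes eq = ⊥-elim (n eq)
    ... | no n'  = proj₂ (closer v n')

    -- Geodesics to the root avoid every other vertex that is at least as far away.
    toRoot : ∀ v u → depth u ≤ depth v → u ≢ v →
      Star (λ x y → (Adj (E T) x y × x ≢ v) × y ≢ v) u root
    toRoot v u₀ = go (suc (depth u₀)) u₀ ℕₚ.≤-refl
      where
      go : ∀ m u → depth u < m → depth u ≤ depth v → u ≢ v →
        Star (λ x y → (Adj (E T) x y × x ≢ v) × y ≢ v) u root
      go (suc m) u (s≤s lt) le u≢v with u ≟ᵥ root
      ... | yes refl = ε
      ... | no n = ((proj₁ s , u≢v) , par≢v) ◅ go m (par u) (ℕₚ.<-≤-trans (proj₂ s) lt) (ℕₚ.<⇒≤ par<v) par≢v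
        where
        s = par-spec n
        par<v : depth (par u) < depth v
        par<v = ℕₚ.<-≤-trans (proj₂ s) le
        par≢v : par u ≢ v
        par≢v eq = ℕₚ.<-irrefl (cong depth eq) par<v

    closer-unique : ∀ {v u w} → Adj (E T) v u → Adj (E T) v w → depth u ≤ depth v → depth w ≤ depth v → u ≡ w
    closer-unique {v} {u} {w} e f le le' with u ≟ᵥ w
    ... | yes eq = eq
    ... | no ne = ⊥-elim (proj₂ (proj₂ tree) (detour⇒cycle _≟ᵥ_ e (e-sym f) (≢v e) ne
          (Star.map (λ ((a , _) , c) → a , c) (toRoot v u le (≢v e)) ◅◅
           Star.reverse (λ ((a , b) , _) → e-sym a , b) (toRoot v w le' (≢v f)))))
      where
      ≢v : ∀ {x} → Adj (E T) v x → x ≢ v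
      ≢v e refl = e-irrefl e

    lower-nonroot : ∀ {u v} → Adj (E T) u v → depth v ≤ depth u → u ≢ root
    lower-nonroot {u} {v} e le refl with v ≟ᵥ root
    ... | yes refl = e-irrefl e
    ... | no n = ℕₚ.<⇒≱ (ℕₚ.≤-<-trans z≤n (proj₂ (par-spec n))) (ℕₚ.≤-trans le (ℕₚ.≤-reflexive depth-root))

    adj-par : ∀ {u v} → Adj (E T) u v → (u ≢ root × par u ≡ v) ⊎ (v ≢ root × par v ≡ u)
    adj-par {u} {v} e with ℕₚ.≤-total (depth v) (depth u)
    ... | inj₁ le = let n = lower-nonroot e le ; s = par-spec n in
      inj₁ (n , closer-unique (proj₁ s) e (ℕₚ.<⇒≤ (proj₂ s)) le)
    ... | inj₂ le = let n = lower-nonroot (e-sym e) le ; s = par-spec n in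
      inj₂ (n , closer-unique (proj₁ s) (e-sym e) (ℕₚ.<⇒≤ (proj₂ s)) le)

  abstract
    tree⇒rooted : Rooted T
    tree⇒rooted = record
      { par       = par
      ; depth     = depth
      ; height    = max 0 (map depth (allVtx T))
      ; depth≤    = λ v → All.lookup (xs≤max 0 (map depth (allVtx T))) (∈-map⁺ depth (allVtx-complete T v))
      ; par-depth = λ n → proj₂ (par-spec n)
      ; par-adj   = λ n → proj₁ (par-spec n)
      ; adj-par   = adj-par
      ; adj-sym   = e-sym
      }

-- Degree conditions in rooted form

length≡1⇒≡ : {A : Set} {xs : List A} {x y : A} → length xs ≡ 1 → x ∈ xs → y ∈ xs → x ≡ y
length≡1⇒≡ {xs = _ ∷ []} _ (here refl) (here refl) = refl

length≡1⇒∃ : {A : Set} {xs : List A} → length xs ≡ 1 → ∃ λ x → x ∈ xs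
length≡1⇒∃ {xs = x ∷ []} _ = x , here refl

module _ {N} (2≤N : 2 ≤ N) (T : LTree (suc N)) (R : Rooted T)
         (irrefl : ∀ u → ¬ Adj (E T) u u)
         (leafDegree : ∀ a → degree T (inj₁ a) ≡ 1) (innerDegree : ∀ x → 3 ≤ degree T (inj₂ x)) where
  open Rooted R
  open Descent R

  private
    another : ∀ {m} → 2 ≤ m → (a : Fin m) → ∃ λ b → b ≢ a
    another (s≤s (s≤s _)) zero    = suc zero , λ ()
    another (s≤s (s≤s _)) (suc a) = zero , λ ()

    -- The only neighbour of this leaf is its parent, so a child would be its parent too, against
    -- the depths.
    childless : ∀ a {v} → v ≢ root → par v ≢ inj₁ (suc a)
    childless a {v} n eq = ℕₚ.<-asym (subst (λ u → depth u < depth v) eq (par-depth n))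
      (subst (λ u → depth u < depth (inj₁ (suc a))) (sym v≡) (par-depth (λ ())))
      where
      v≡ : v ≡ par (inj₁ (suc a))
      v≡ = length≡1⇒≡ (leafDegree (suc a))
        (∈-neighbours⁺ T (adj-sym (subst (Adj (E T) v) eq (par-adj n))))
        (∈-neighbours⁺ T (par-adj (λ ())))

    rootNeighbour : ∃ λ y → y ∈ neighbours T root
    rootNeighbour = length≡1⇒∃ (leafDegree zero)

    rootChild : ∀ {v} → v ≢ root → par v ≡ root → v ≡ proj₁ rootNeighbour
    rootChild {v} n eq = length≡1⇒≡ (leafDegree zero)
      (∈-neighbours⁺ T (adj-sym (subst (Adj (E T) v) eq (par-adj n)))) (proj₂ rootNeighbour)

    rootNeighbour-par : ∀ {y} → y ∈ neighbours T root → par y ≡ root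
    rootNeighbour-par y∈ with adj-par (∈-neighbours⁻ T y∈)
    ... | inj₁ (n , _) = ⊥-elim (n refl)
    ... | inj₂ (_ , eq) = eq

    -- If the root were joined to a leaf, every further leaf would descend through that leaf, which
    -- has no children. A further leaf exists because there are at least three in all.
    apex : ∃ λ x → proj₁ rootNeighbour ≡ inj₂ x
    apex with proj₁ rootNeighbour in eq
    ... | inj₂ x = x , refl
    ... | inj₁ zero = ⊥-elim (irrefl root (∈-neighbours⁻ T (subst (_∈ neighbours T root) eq (proj₂ rootNeighbour))))
    ... | inj₁ (suc a) = ⊥-elim (lone (another 2≤N a))
      where
      lone : ¬ ∃ λ b → b ≢ a
      lone (b , b≢a) with childToward (⊑-root (inj₁ (suc b))) (λ ())
      ... | c , n , c-par , b⊑c with trans (rootChild n c-par) eq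
      ...   | refl with childToward b⊑c (λ { refl → b≢a refl })
      ...     | _ , n' , eq' , _ = childless a n' eq'

    child : ∀ {x w} → w ∈ neighbours T (inj₂ x) → par (inj₂ x) ≢ w → w ≢ root × par w ≡ inj₂ x
    child w∈ ne with adj-par (∈-neighbours⁻ T w∈)
    ... | inj₁ (_ , eq) = ⊥-elim (ne eq)
    ... | inj₂ c = c

    -- At most one of three neighbours is the parent; the other two are children.
    pick : ∀ {x} ws → 3 ≤ length ws → Unique ws → (∀ {w} → w ∈ ws → par (inj₂ x) ≢ w → w ≢ root × par w ≡ inj₂ x) →
      ∃ λ c → ∃ λ c' → c ≢ c' × (c ≢ root × par c ≡ inj₂ x) × (c' ≢ root × par c' ≡ inj₂ x)
    pick {x} (a ∷ b ∷ c ∷ _) _ ((a≢b ∷ a≢c ∷ _) ∷ (b≢c ∷ _) ∷ _) kid with par (inj₂ x) ≟ᵥ a | par (inj₂ x) ≟ᵥ b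
    ... | yes refl | _ = b , c , b≢c , kid (there (here refl)) a≢b , kid (there (there (here refl))) a≢c
    ... | no ne | yes refl = a , c , a≢c , kid (here refl) ne , kid (there (there (here refl))) b≢c
    ... | no ne | no ne' = a , b , a≢b , kid (here refl) ne , kid (there (here refl)) ne'
    pick (_ ∷ []) (s≤s ())
    pick (_ ∷ _ ∷ []) (s≤s (s≤s ()))

  degrees⇒shape : Shape R
  degrees⇒shape = record
    { childless   = childless
    ; apex        = proj₁ apex
    ; apex-par    = subst (λ y → par y ≡ root) (proj₂ apex) (rootNeighbour-par (proj₂ rootNeighbour))
    ; apex-unique = λ n eq → trans (rootChild n eq) (proj₂ apex)
    ; twoChildren = λ x → pick (neighbours T (inj₂ x)) (innerDegree x) (neighbours-unique T (inj₂ x)) child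
    }

-- Rooted trees are graph-theoretic trees

module _ {N} {T : LTree (suc N)} (R : Rooted T) where
  open Rooted R
  open Descent R

  rooted-irrefl : ∀ u → ¬ Adj (E T) u u
  rooted-irrefl u e with adj-par e
  ... | inj₁ (n , eq) = ℕₚ.<-irrefl (cong depth eq) (par-depth n)
  ... | inj₂ (n , eq) = ℕₚ.<-irrefl (cong depth eq) (par-depth n)

  private
    -- A walk without backtracking that has once gone down keeps going down.
    goingDown : ∀ {x} y zs v → y ≢ root → par y ≡ x → (∀ {w ws} → zs ∷ʳ v ≡ w ∷ ws → x ≢ w) →
      Unique (y ∷ (zs ∷ʳ v)) → Linked (Adj (E T)) (y ∷ (zs ∷ʳ v)) →
      depth x < depth v × ∃ λ p → p ∈ y ∷ zs × v ≢ root × par v ≡ p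
    goingDown y [] v n refl x≢ un (e ∷ [-]) with adj-par e
    ... | inj₁ (_ , eq) = ⊥-elim (x≢ refl eq)
    ... | inj₂ (n' , refl) = ℕₚ.<-trans (par-depth n) (par-depth n') , y , here refl , n' , refl
    goingDown y (z ∷ zs) v n refl x≢ ((_ ∷ y∉) ∷ un) (e ∷ l) with adj-par e
    ... | inj₁ (_ , eq) = ⊥-elim (x≢ refl eq)
    ... | inj₂ (n' , refl) =
      let (lt , p , p∈ , q) = goingDown z zs v n' refl (λ eq → All.head (subst (All (y ≢_)) eq y∉)) un l
      in ℕₚ.<-trans (par-depth n) lt , p , there p∈ , q

    -- A simple path climbs and then descends. Either it climbs to its end, or it enters its last
    -- vertex from that vertex's parent.
    upThenDown : ∀ x zs v → Unique (x ∷ (zs ∷ʳ v)) → Linked (Adj (E T)) (x ∷ (zs ∷ʳ v)) →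
      depth v < depth x ⊎ ∃ λ p → p ∈ x ∷ zs × v ≢ root × par v ≡ p
    upThenDown x [] v un (e ∷ [-]) with adj-par e
    ... | inj₁ (n , refl) = inj₁ (par-depth n)
    ... | inj₂ (n , eq)   = inj₂ (x , here refl , n , eq)
    upThenDown x (z ∷ zs) v ((_ ∷ x∉) ∷ un) (e ∷ l) with adj-par e
    ... | inj₂ (n , eq) = let (_ , p , p∈ , q) = goingDown z zs v n eq (λ eq → All.head (subst (All (x ≢_)) eq x∉)) un l
                          in inj₂ (p , there p∈ , q)
    ... | inj₁ (n , refl) with upThenDown (par x) zs v un l
    ...   | inj₁ lt = inj₁ (ℕₚ.<-trans lt (par-depth n))
    ...   | inj₂ (p , p∈ , q) = inj₂ (p , there p∈ , q)

    -- A cycle that starts downwards at `v` returns to `v` at greater depth. One that starts upwards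
    -- to `v₁` either returns at smaller depth or enters `v` at the end from its parent, so `v₁`
    -- would occur twice.
    acyclic : ¬ HasCycle (Adj (E T)) 3
    acyclic (v , [] , _ , s≤s () , _)
    acyclic (v , _ ∷ [] , _ , s≤s (s≤s ()) , _)
    acyclic (v , v₁ ∷ v₂ ∷ ws , (v∉@(_ ∷ v≢v₂ ∷ _) ∷ un) , _ , (e ∷ l@(e' ∷ l'))) = cases (adj-par e)
      where
      rotated : Unique (v₁ ∷ v₂ ∷ (ws ∷ʳ v))
      rotated = Uniqueₚ.++⁺ un ([] ∷ []) (λ { (p , here refl) → All.lookup v∉ p refl })
      tail! : ∀ {x xs} → Unique {A = Vtx T} (x ∷ xs) → Unique xs
      tail! (_ ∷ u) = u
      head∉ : ∀ {x xs} → Unique {A = Vtx T} (x ∷ xs) → All (x ≢_) xs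
      head∉ (x∉ ∷ _) = x∉
      v₁∉ : ∀ {p} → p ∈ v₂ ∷ ws → v₁ ≢ p
      v₁∉ = All.lookup (head∉ un)
      cases : _ → _
      cases (inj₂ (n , eq)) = ℕₚ.<-irrefl refl
        (proj₁ (goingDown v₁ (v₂ ∷ ws) v n eq (λ { refl → v≢v₂ }) rotated l))
      cases (inj₁ (n , refl)) with adj-par e'
      ... | inj₂ (n' , eq') =
        let (_ , p , p∈ , _ , q) = goingDown v₂ ws v n' eq'
              (λ eq → All.head (subst (All (v₁ ≢_)) eq (All.tail (head∉ rotated)))) (tail! rotated) l'
        in v₁∉ p∈ q
      ... | inj₁ (n' , refl) with upThenDown v₂ ws v (tail! rotated) l'
      ...   | inj₁ lt = ℕₚ.<-asym (ℕₚ.<-trans (par-depth n') (par-depth n)) lt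
      ...   | inj₂ (p , p∈ , _ , q) = v₁∉ p∈ q

    toRoot : ∀ {u v} → u ⊑ v → Star (Adj (E T)) u v
    toRoot stop     = ε
    toRoot (up n p) = par-adj n ◅ toRoot p

  rooted⇒tree : IsTree T
  rooted⇒tree =
    ((λ u v → ⇔-true adj-sym adj-sym) , (λ u → Boolₚ.¬-not (rooted-irrefl u))) ,
    (λ u v → toRoot (⊑-root u) ◅◅ Star.reverse adj-sym (toRoot (⊑-root v))) ,
    acyclic

unique-singleton : {A : Set} {xs : List A} {a : A} → Unique xs → a ∈ xs → (∀ {x} → x ∈ xs → x ≡ a) → length xs ≡ 1
unique-singleton {a = a} u a∈ all = ℕₚ.≤-antisym
  (unique-⊆-length {ys = a ∷ []} u (λ x∈ → here (all x∈)))
  (unique-⊆-length {xs = a ∷ []} ([] ∷ []) (λ { (here refl) → a∈ }))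

module _ {N} {T : LTree (suc N)} {R : Rooted T} (S : Shape R) where
  open Rooted R
  open Shape S

  shape-leafDegree : ∀ a → degree T (inj₁ a) ≡ 1
  shape-leafDegree zero = unique-singleton (neighbours-unique T root)
    (∈-neighbours⁺ T (adj-sym (subst (Adj (E T) (inj₂ apex)) apex-par (par-adj (λ ())))))
    (λ x∈ → only (adj-par (∈-neighbours⁻ T x∈)))
    where
    only : ∀ {x} → (root ≢ root × par root ≡ x) ⊎ (x ≢ root × par x ≡ root) → x ≡ inj₂ apex
    only (inj₁ (n , _))  = ⊥-elim (n refl)
    only (inj₂ (n , eq)) = apex-unique n eq
  shape-leafDegree (suc a) = unique-singleton (neighbours-unique T (inj₁ (suc a)))
    (∈-neighbours⁺ T (par-adj (λ ())))
    (λ x∈ → only (adj-par (∈-neighbours⁻ T x∈)))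
    where
    only : ∀ {x} → (inj₁ (suc a) ≢ root × par (inj₁ (suc a)) ≡ x) ⊎ (x ≢ root × par x ≡ inj₁ (suc a)) →
      x ≡ par (inj₁ (suc a))
    only (inj₁ (_ , eq)) = sym eq
    only (inj₂ (n , eq)) = ⊥-elim (childless a n eq)

  shape-innerDegree : ∀ x → 3 ≤ degree T (inj₂ x)
  shape-innerDegree x with twoChildren x
  ... | c , c' , c≢c' , (n , eq) , (n' , eq') = unique-⊆-length
    ((not-parent n eq ∷ not-parent n' eq' ∷ []) ∷ (c≢c' ∷ []) ∷ [] ∷ [])
    (λ { (here refl) → ∈-neighbours⁺ T (par-adj (λ ()))
       ; (there (here refl)) → ∈-neighbours⁺ T (adj-sym (subst (Adj (E T) c) eq (par-adj n)))
       ; (there (there (here refl))) → ∈-neighbours⁺ T (adj-sym (subst (Adj (E T) c') eq' (par-adj n'))) })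
    where
    not-parent : ∀ {c} → c ≢ root → par c ≡ inj₂ x → par (inj₂ x) ≢ c
    not-parent {c} n eq eq₂ = ℕₚ.<-asym (subst (λ u → depth u < depth c) eq (par-depth n))
      (subst (λ u → depth u < depth (inj₂ x)) eq₂ (par-depth (λ ())))

-- Removing an edge

module CutEdge {N} {T : LTree (suc N)} (R : Rooted T) (c : Vtx T) (c≢root : c ≢ root) where
  open Rooted R
  open Descent R

  -- The only edge that leaves the set of vertices below `c` joins `c` to its parent, and that edge
  -- is removed.
  below : ∀ {u v} → Star (T ∖edge c , par c) u v → u ⊑ c → v ⊑ c
  below ε p = p
  below (_◅_ {u} {w} (e , keep) s) p with adj-par e
  ... | inj₂ (n , eq) = below s (up n (subst (_⊑ c) (sym eq) p))
  ... | inj₁ (n , refl) with u ≟ᵥ c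
  ...   | yes refl = ⊥-elim (keep (inj₁ (refl , refl)))
  ...   | no  ne   = below s (proj₂ (⊑-up p ne))

  private
    kept : ∀ {v} → v ≢ root → v ≢ c → (T ∖edge c , par c) v (par v)
    kept {v} n v≢c = par-adj n , λ
      { (inj₁ (v≡c , _)) → v≢c v≡c
      ; (inj₂ (v≡ , eq)) → ℕₚ.<-asym (par-depth n)
          (subst₂ (λ a b → depth a < depth b) (sym v≡) (sym eq) (par-depth c≢root)) }

    cut-sym : ∀ {u v} → (T ∖edge c , par c) u v → (T ∖edge c , par c) v u
    cut-sym (e , keep) = adj-sym e , λ
      { (inj₁ (p , q)) → keep (inj₂ (q , p)) ; (inj₂ (p , q)) → keep (inj₁ (q , p)) }

    outside : ∀ {v u} → v ⊑ u → ¬ (v ⊑ c) → Star (T ∖edge c , par c) v u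
    outside stop     _  = ε
    outside (up n p) v⋢ = kept n (λ { refl → v⋢ stop }) ◅ outside p (v⋢ ∘ up n)

  reachBelow : ∀ {v} → v ⊑ c → Star (T ∖edge c , par c) c v
  reachBelow stop = ε
  reachBelow {v} (up n p) = reachBelow p ◅◅
    (cut-sym (kept n (λ { refl → par⋢ c≢root refl p })) ◅ ε)

  -- Neither `v` nor `par c` lies below `c`, so both climb to the root without the removed edge.
  reachOutside : ∀ {v} → ¬ (v ⊑ c) → Star (T ∖edge c , par c) (par c) v
  reachOutside {v} v⋢ = outside (⊑-root (par c)) (par⋢ c≢root refl) ◅◅
    Star.reverse cut-sym (outside (⊑-root v) v⋢)

cut-swap : ∀ {m} {T : LTree m} {x y u v} → (T ∖edge x , y) u v → (T ∖edge y , x) u v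
cut-swap (e , keep) = e , λ { (inj₁ p) → keep (inj₂ p) ; (inj₂ p) → keep (inj₁ p) }

-- Stability of the tree and edges in the clusters

module _ {N} {Γ : Fin (suc N) → Fin (suc N) → Bool} where

  stable⇒shape : 2 ≤ N → ∀ {T} → (st : IsStable Γ T) → Shape (tree⇒rooted T (proj₁ st))
  stable⇒shape 2≤N {T} (tree , leafDegree , innerDegree , _) =
    degrees⇒shape 2≤N T R (rooted-irrefl R) leafDegree innerDegree
    where
    R = tree⇒rooted T tree

  -- Stability at the edge from `x` to its parent, on the side of `x`, puts an edge into the cluster
  -- of `x`. The edge above the apex ends at a leaf and is not internal, so the cluster `⊤` receives
  -- its edge from the hypothesis.
  stable⇒nested : 2 ≤ N → ContainsEdge (deleteZero Γ) ⊤ → ∀ {T} (st : IsStable Γ T) →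
    ∃ λ F → IsNested (deleteZero Γ) F × Descent.Codes (tree⇒rooted T (proj₁ st)) F
  stable⇒nested 2≤N ⊤-edge {T} st@(tree , _ , _ , stab) = F ,
    mkNested
      (F⁺ (apex , cluster-apex))
      (λ A A∈ → let (x , eq) = F⁻ A A∈ in subst (ContainsEdge (deleteZero Γ)) eq (edge x))
      (λ A B A∈ B∈ → let (x , eq) = F⁻ A A∈ ; (y , eq') = F⁻ B B∈ in
        subst₂ Laminar eq eq' (cluster-laminar (inj₂ x) (inj₂ y))) ,
    (λ x → F⁺ (x , refl)) , F⁻
    where
    R = tree⇒rooted T tree
    S = stable⇒shape 2≤N st
    open Rooted R
    open Descent R
    open Shape S
    open Clusters S
    coded? : ∀ A → Dec (∃ λ x → cluster (inj₂ x) ≡ A)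
    coded? A = Finₚ.any? (λ x → cluster (inj₂ x) ≟ˢ A)
    F : Fam N
    F = comprehend (does ∘ coded?)
    F⁺ : ∀ {A} → (∃ λ x → cluster (inj₂ x) ≡ A) → A ∈ᶠ F
    F⁺ {A} w = trans (mem-comprehend _ A) (dec-true (coded? A) w)
    F⁻ : ∀ A → A ∈ᶠ F → ∃ λ x → cluster (inj₂ x) ≡ A
    F⁻ A A∈ with coded? A | trans (sym (mem-comprehend (does ∘ coded?) A)) A∈
    ... | yes w | _ = w
    ... | no _  | ()
    leafOf : ∀ {a x} → inj₁ a ⊑ inj₂ x → ∃ λ a' → a ≡ suc a' × a' ∊ cluster (inj₂ x)
    leafOf {zero}  p with root⊑ p
    ... | ()
    leafOf {suc a} p = a , refl , cluster⁺ p
    edge : ∀ x → ContainsEdge (deleteZero Γ) (cluster (inj₂ x))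
    edge x with par (inj₂ x) in eq
    ... | inj₁ zero = subst (ContainsEdge (deleteZero Γ))
      (sym (trans (cong cluster (apex-unique (λ ()) eq)) cluster-apex)) ⊤-edge
    ... | inj₁ (suc a) = ⊥-elim (childless a (λ ()) eq)
    ... | inj₂ y with stab x y (subst (Adj (E T) (inj₂ x)) eq (par-adj (λ ())))
    ...   | a , b , g , p , q with leafOf (reach p) | leafOf (reach q)
      where
      reach : ∀ {v} → Star (T ∖edge inj₂ x , inj₂ y) (inj₂ x) v → v ⊑ inj₂ x
      reach s = CutEdge.below R (inj₂ x) (λ ())
        (subst (λ w → Star (T ∖edge inj₂ x , w) (inj₂ x) _) (sym eq) s) stop
    ...     | a' , refl , a∊ | b' , refl , b∊ = a' , b' , a∊ , b∊ , g

  shape⇒stable : IsDominating Γ zero → ∀ {T} {R : Rooted T} (S : Shape R) →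
    (∀ x → ContainsEdge (deleteZero Γ) (Descent.cluster R (inj₂ x))) → IsStable Γ T
  shape⇒stable dominating {T} {R} S edge =
    rooted⇒tree R , shape-leafDegree S , shape-innerDegree S , stab
    where
    open Rooted R
    open Descent R
    open Shape S
    open Clusters S
    Witness : Fin (k T) → Fin (k T) → Set
    Witness x y = Σ (Fin (suc N)) λ a → Σ (Fin (suc N)) λ b → Adj Γ a b ×
      Star (T ∖edge inj₂ x , inj₂ y) (inj₂ x) (inj₁ a) ×
      Star (T ∖edge inj₂ x , inj₂ y) (inj₂ x) (inj₁ b)
    stab : ∀ x y → Adj (E T) (inj₂ x) (inj₂ y) → Witness x y
    stab x y e with adj-par e
    ... | inj₁ (n , eq) = let (a , b , a∊ , b∊ , g) = edge x in
        suc a , suc b , g , reach (cluster⁻ a∊) , reach (cluster⁻ b∊)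
      where
      reach : ∀ {v} → v ⊑ inj₂ x → Star (T ∖edge inj₂ x , inj₂ y) (inj₂ x) v
      reach p = subst (λ w → Star (T ∖edge inj₂ x , w) (inj₂ x) _) eq (CutEdge.reachBelow R (inj₂ x) n p)
    -- The upper side contains the dominating root leaf, so any second leaf there suffices. If none
    -- existed, the cluster of `y` would be everything and `y` the apex, whose parent is the root
    -- and not `x`.
    ... | inj₂ (n , eq) = let (b , _ , b∌) = ⊈⇒∃ proper in
        zero , suc b , dominating (suc b) (λ ()) , reach (λ p → root≢ (root⊑ p)) , reach (b∌ ∘ cluster⁺)
      where
      root≢ : inj₂ y ≢ root
      root≢ ()
      proper : ¬ (⊤ ⊆ cluster (inj₂ y))
      proper sub with trans (sym eq) (trans (cong par (⊑-antisym (⊑-apex (λ ()))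
        (cluster-reflect (λ ()) (λ a∊ → sub Subₚ.∈⊤)))) apex-par)
      ... | ()
      reach : ∀ {v} → ¬ (v ⊑ inj₂ y) → Star (T ∖edge inj₂ x , inj₂ y) (inj₂ x) v
      reach {v} p = subst (λ w → Star (T ∖edge w , inj₂ y) w v) eq
        (Star.map (cut-swap {T = T}) (CutEdge.reachOutside R (inj₂ y) n p))

-- The tree of a nested family

lookup-injective : {A : Set} {xs : List A} → Unique xs → ∀ {i j} → lookup xs i ≡ lookup xs j → i ≡ j
lookup-injective (_  ∷ _) {zero}  {zero}  _  = refl
lookup-injective (x∉ ∷ _) {zero}  {suc j} eq = ⊥-elim (All.lookup x∉ (∈-lookup j) eq)
lookup-injective (x∉ ∷ _) {suc i} {zero}  eq = ⊥-elim (All.lookup x∉ (∈-lookup i) (sym eq))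
lookup-injective (_  ∷ u) {suc i} {suc j} eq = cong suc (lookup-injective u eq)

module _ {N} (F : Fam N) where

  private
    V : Set
    V = Fin (suc N) ⊎ Fin (card F)

  -- The root leaf is counted as well, and only in the set of the root; this separates the root from
  -- the apex and puts it strictly above.
  leafSet : V → Subset (suc N)
  leafSet (inj₁ zero)    = ⊤
  leafSet (inj₁ (suc a)) = false ∷ ⁅ a ⁆
  leafSet (inj₂ x)       = false ∷ lookup (members F) x

  private
    -- An edgeless placeholder for enumerating the vertices: parents have to be found before the
    -- edges can be defined.
    vertices : LTree (suc N)
    vertices = record { k = card F ; E = λ _ _ → false }

  strictlyAbove : V → List V
  strictlyAbove u = filter (λ w → leafSet u Subₚ.⊂? leafSet w) (allVtx vertices)

  abstract
    -- Minimal size picks out the least leaf set strictly above, since laminarity makes all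
    -- candidates comparable. The default `root` is itself a candidate for every other vertex.
    parentOf : V → V
    parentOf u = argmin (λ w → ∥ leafSet w ∥) root (strictlyAbove u)

    parentOf-⊂ : ∀ {u} → leafSet u ⊂ ⊤ → leafSet u ⊂ leafSet (parentOf u)
    parentOf-⊂ {u} p = argmin-all (λ w → ∥ leafSet w ∥) {⊤ = root} {P = λ w → leafSet u ⊂ leafSet w} p
      (Allₚ.all-filter (λ w → leafSet u Subₚ.⊂? leafSet w) (allVtx vertices))

    parentOf-least : ∀ {u w} → leafSet u ⊂ leafSet w → ∥ leafSet (parentOf u) ∥ ≤ ∥ leafSet w ∥
    parentOf-least {u} {w} p = All.lookup (f[argmin]≤f[xs] root (strictlyAbove u))
      (∈-filter⁺ (λ w → leafSet u Subₚ.⊂? leafSet w) (allVtx-complete vertices w) p)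

  Arc : V → V → Set
  Arc u v = u ≢ root × parentOf u ≡ v

  arc? : ∀ u v → Dec (Arc u v)
  arc? u v = ¬? (u ≟ᵥ root) ×-dec (parentOf u ≟ᵥ v)

  familyTree : LTree (suc N)
  familyTree = record { k = card F ; E = λ u v → does (arc? u v ⊎-dec arc? v u) }

does⇒ : {A : Set} (d : Dec A) → does d ≡ true → A
does⇒ (yes a) _ = a

module FamilyTree {N} {H : Fin N → Fin N → Bool} (irrefl : ∀ a → H a a ≡ false)
                  {F : Fam N} (nested : IsNested H F) where
  open IsNested nested

  private
    T : LTree (suc N)
    T = familyTree F
    set : Vtx T → Subset (suc N)
    set = leafSet F
    par : Vtx T → Vtx T
    par = parentOf F

    member : ∀ x → lookup (members F) x ∈ᶠ F
    member x = ∈-members F _ (∈-lookup x)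

    set-zero : ∀ {v} → zero ∊ set v → v ≡ root
    set-zero {inj₁ zero}    _ = refl
    set-zero {inj₁ (suc a)} ()
    set-zero {inj₂ x}       ()

    set-⊂⊤ : ∀ {v} → v ≢ root → set v ⊂ ⊤
    set-⊂⊤ n = Subₚ.⊆⊤ , zero , Subₚ.∈⊤ , (λ z → n (set-zero z))

    set-nonempty : ∀ v → Nonempty (set v)
    set-nonempty (inj₁ zero)    = zero , here
    set-nonempty (inj₁ (suc a)) = suc a , there (Subₚ.x∈⁅x⁆ a)
    set-nonempty (inj₂ x) = let (a , _ , a∊ , _) = edge _ (member x) in suc a , there a∊

    -- A cluster contains an edge and there are no loops. Hence no internal vertex shares its leaf
    -- set with a leaf.
    not-singleton : ∀ x a → lookup (members F) x ≢ ⁅ a ⁆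
    not-singleton x a eq with edge _ (member x)
    ... | i , j , i∊ , j∊ , h with Subₚ.x∈⁅y⁆⇒x≡y a (subst (i ∊_) eq i∊) | Subₚ.x∈⁅y⁆⇒x≡y a (subst (j ∊_) eq j∊)
    ...   | refl | refl with trans (sym h) (irrefl a)
    ...     | ()

    set-injective : ∀ {u v} → set u ≡ set v → u ≡ v
    set-injective {inj₁ zero} {v} eq = sym (set-zero (subst (zero ∊_) eq here))
    set-injective {u} {inj₁ zero} eq = set-zero (subst (zero ∊_) (sym eq) here)
    set-injective {inj₁ (suc a)} {inj₁ (suc b)} eq =
      cong (inj₁ ∘ suc) (Subₚ.x∈⁅y⁆⇒x≡y b (subst (a ∊_) (Vecₚ.∷-injectiveʳ eq) (Subₚ.x∈⁅x⁆ a)))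
    set-injective {inj₁ (suc a)} {inj₂ y} eq = ⊥-elim (not-singleton y a (sym (Vecₚ.∷-injectiveʳ eq)))
    set-injective {inj₂ x} {inj₁ (suc b)} eq = ⊥-elim (not-singleton x b (Vecₚ.∷-injectiveʳ eq))
    set-injective {inj₂ x} {inj₂ y} eq =
      cong inj₂ (lookup-injective (members-unique F) (Vecₚ.∷-injectiveʳ eq))

    singleton-laminar : ∀ a (A : Subset N) → Laminar (false ∷ ⁅ a ⁆) (false ∷ A)
    singleton-laminar a A with a ∊? A
    ... | yes a∊ = inj₁ (λ { (there p) → there (subst (_∊ A) (sym (Subₚ.x∈⁅y⁆⇒x≡y a p)) a∊) })
    ... | no a∌ = inj₂ (inj₂ (λ { (suc x) (there p) (there q) → a∌ (subst (_∊ A) (Subₚ.x∈⁅y⁆⇒x≡y a p) q) }))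

    set-laminar : ∀ u v → Laminar (set u) (set v)
    set-laminar (inj₁ zero) v = inj₂ (inj₁ Subₚ.⊆⊤)
    set-laminar u (inj₁ zero) = inj₁ Subₚ.⊆⊤
    set-laminar (inj₁ (suc a)) (inj₁ (suc b)) = singleton-laminar a ⁅ b ⁆
    set-laminar (inj₁ (suc a)) (inj₂ y) = singleton-laminar a _
    set-laminar (inj₂ x) (inj₁ (suc b)) = laminar-sym (singleton-laminar b _)
    set-laminar (inj₂ x) (inj₂ y) with laminar _ _ (member x) (member y)
    ... | inj₁ sub        = inj₁ (Subₚ.s⊆s sub)
    ... | inj₂ (inj₁ sub) = inj₂ (inj₁ (Subₚ.s⊆s sub))
    ... | inj₂ (inj₂ d)   = inj₂ (inj₂ (λ { (suc a) (there p) (there q) → d a p q }))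

    par-⊂ : ∀ {u} → u ≢ root → set u ⊂ set (par u)
    par-⊂ n = parentOf-⊂ F (set-⊂⊤ n)

    -- Both sets contain the nonempty set of `u`, so they are comparable, and the parent has minimal
    -- size.
    par-⊆ : ∀ {u w} → u ≢ root → set u ⊂ set w → set (par u) ⊆ set w
    par-⊆ {u} {w} n u⊂w with set-laminar (par u) w
    ... | inj₁ sub = sub
    ... | inj₂ (inj₂ d) = ⊥-elim (let (x , x∊) = set-nonempty u in
            d x (proj₁ (par-⊂ n) x∊) (proj₁ u⊂w x∊))
    ... | inj₂ (inj₁ sub) with set w ≟ˢ set (par u)
    ...   | yes eq = Subₚ.⊆-reflexive (sym eq)
    ...   | no ne = ⊥-elim (ℕₚ.<⇒≱ (Subₚ.p⊂q⇒∣p∣<∣q∣ (⊆∧≢⇒⊂ sub ne)) (parentOf-least F {u} {w} u⊂w))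

  rooted : Rooted T
  rooted = record
    { par       = par
    -- Leaf sets grow strictly toward the root, so the number of missing leaves is a rank, zero at
    -- the root.
    ; depth     = λ v → suc N ∸ ∥ set v ∥
    ; height    = suc N
    ; depth≤    = λ v → ℕₚ.m∸n≤m (suc N) ∥ set v ∥
    ; par-depth = λ {v} n → ℕₚ.∸-monoʳ-< (Subₚ.p⊂q⇒∣p∣<∣q∣ (par-⊂ n)) (Subₚ.∣p∣≤n (set (par v)))
    ; par-adj   = λ {v} n → dec-true (arc? F v (par v) ⊎-dec arc? F (par v) v) (inj₁ (n , refl))
    ; adj-par   = λ {u} {v} e → does⇒ (arc? F u v ⊎-dec arc? F v u) e
    ; adj-sym   = λ {u} {v} e → dec-true (arc? F v u ⊎-dec arc? F u v)
        ([ inj₂ , inj₁ ]′ (does⇒ (arc? F u v ⊎-dec arc? F v u) e))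
    }

  open Rooted rooted using (depth; par-depth)
  open Descent rooted

  private
    ⊑⇒⊆ : ∀ {u v} → u ⊑ v → set u ⊆ set v
    ⊑⇒⊆ stop     x∊ = x∊
    ⊑⇒⊆ (up n p) x∊ = ⊑⇒⊆ p (proj₁ (par-⊂ n) x∊)

    ⊆⇒⊑ : ∀ {u v} → set u ⊆ set v → u ⊑ v
    ⊆⇒⊑ {u₀} {v} = go (suc (depth u₀)) u₀ ℕₚ.≤-refl
      where
      go : ∀ m u → depth u < m → set u ⊆ set v → u ⊑ v
      go (suc m) u (s≤s le) sub with u ≟ᵥ v
      ... | yes refl = stop
      ... | no u≢v = up n (go m (par u) (ℕₚ.<-≤-trans (par-depth n) le)
              (par-⊆ {u} {v} n (⊆∧≢⇒⊂ sub (u≢v ∘ set-injective))))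
        where
        n : u ≢ root
        n refl = u≢v (sym (set-zero (sub {zero} here)))

    leaf-⊆ : ∀ {a v} → suc a ∊ set v → set (inj₁ (suc a)) ⊆ set v
    leaf-⊆ {a} {v} a∊ {suc b} (there b∊) = subst (λ b → suc b ∊ set v) (sym (Subₚ.x∈⁅y⁆⇒x≡y a b∊)) a∊

    leaf⊑ : ∀ {a v} → suc a ∊ set v → inj₁ (suc a) ⊑ v
    leaf⊑ {a} {v} a∊ = ⊆⇒⊑ (leaf-⊆ {a} {v} a∊)

  cluster-member : ∀ x → cluster (inj₂ x) ≡ lookup (members F) x
  cluster-member x = Subₚ.⊆-antisym
    (λ {a} a∊ → Subₚ.drop-there (⊑⇒⊆ (cluster⁻ a∊) {suc a} (there (Subₚ.x∈⁅x⁆ a))))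
    (λ a∊ → cluster⁺ (leaf⊑ (there a∊)))

  codes : Codes F
  codes = (λ x → subst (_∈ᶠ F) (sym (cluster-member x)) (member x)) ,
    (λ A A∈ → let A∈' = members-∈ F A A∈ in
      index A∈' , trans (cluster-member (index A∈')) (sym (lookup-index A∈')))

  private
    apex : Fin (card F)
    apex = index (members-∈ F ⊤ ground)

    set-apex : set (inj₂ apex) ≡ false ∷ ⊤
    set-apex = cong (false ∷_) (sym (lookup-index (members-∈ F ⊤ ground)))

    apex-par : par (inj₂ apex) ≡ root
    apex-par with par-⊂ {inj₂ apex} (λ ())
    ... | _ , zero  , z∊ , _ = set-zero z∊
    ... | _ , suc a , _ , a∌ = ⊥-elim (a∌ (subst (suc a ∊_) (sym set-apex) (there Subₚ.∈⊤)))

    set-⊆apex : ∀ {v} → v ≢ root → set v ⊆ set (inj₂ apex)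
    set-⊆apex n {zero}  z∊ = ⊥-elim (n (set-zero z∊))
    set-⊆apex n {suc a} _  = subst (suc a ∊_) (sym set-apex) (there Subₚ.∈⊤)

    apex-unique : ∀ {v} → v ≢ root → par v ≡ root → v ≡ inj₂ apex
    apex-unique {v} n eq with v ≟ᵥ inj₂ apex
    ... | yes v≡ = v≡
    ... | no ne with set-zero {inj₂ apex} (par-⊆ {v} {inj₂ apex} n (⊆∧≢⇒⊂ (set-⊆apex n) (ne ∘ set-injective))
                       (subst (λ w → zero ∊ set w) (sym eq) here))
    ...   | ()

    childless : ∀ a {v} → v ≢ root → par v ≢ inj₁ (suc a)
    childless a {v} n eq with subst (λ w → set v ⊂ set w) eq (par-⊂ n)
    ... | sub , suc b , there b∊ , b∌ = let (x , x∊) = set-nonempty v in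
      b∌ (subst (λ z → suc z ∊ set v) (sym (Subₚ.x∈⁅y⁆⇒x≡y a b∊)) (only x x∊ (sub x∊)))
      where
      only : ∀ x → x ∊ set v → x ∊ false ∷ ⁅ a ⁆ → suc a ∊ set v
      only (suc y) y∊ (there p) = subst (λ z → suc z ∊ set v) (Subₚ.x∈⁅y⁆⇒x≡y a p) y∊

    -- A leaf `a` in the set of `x` leads to a child `c`. The set of `c` is proper, and a leaf `b`
    -- outside it leads to a different child.
    twoChildren : ∀ x → ∃ λ c → ∃ λ c' → c ≢ c' ×
      (c ≢ root × par c ≡ inj₂ x) × (c' ≢ root × par c' ≡ inj₂ x)
    twoChildren x with set-nonempty (inj₂ x)
    ... | zero , ()
    ... | suc a , a∊ with childToward (leaf⊑ {a} {inj₂ x} a∊) (λ ())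
    ...   | c , n , eq , _ with subst (λ w → set c ⊂ set w) eq (par-⊂ n)
    ...     | _ , zero , () , _
    ...     | _ , suc b , b∊ , b∌ with childToward (leaf⊑ {b} {inj₂ x} b∊) (λ ())
    ...       | c' , n' , eq' , b⊑ = c , c' ,
                (λ { refl → b∌ (⊑⇒⊆ b⊑ {suc b} (there (Subₚ.x∈⁅x⁆ b))) }) , (n , eq) , (n' , eq')

  shape : Shape rooted
  shape = record
    { childless   = childless
    ; apex        = apex
    ; apex-par    = apex-par
    ; apex-unique = apex-unique
    ; twoChildren = twoChildren
    }

  clusterEdge : ∀ x → ContainsEdge H (cluster (inj₂ x))
  clusterEdge x = subst (ContainsEdge H) (sym (cluster-member x)) (edge _ (member x))

-- Counting internal edges

cartesian-concatMap : {A B : Set} (xs : List A) (ys : List B) →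
  concatMap (λ x → map (λ y → x , y) ys) xs ≡ cartesianProduct xs ys
cartesian-concatMap []       ys = refl
cartesian-concatMap (x ∷ xs) ys = cong (map (x ,_) ys ++_) (cartesian-concatMap xs ys)

module _ {N} {T : LTree (suc N)} {R : Rooted T} (S : Shape R) where
  open Rooted R
  open Descent R
  open Shape S
  open Clusters S

  private
    K : ℕ
    K = k T

    isEdge : Fin K × Fin K → Bool
    isEdge p = if toℕ (proj₁ p) <ᵇ toℕ (proj₂ p) then E T (inj₂ (proj₁ p)) (inj₂ (proj₂ p)) else false

    edges : List (Fin K × Fin K)
    edges = filterᵇ isEdge (concatMap (λ x → map (λ y → x , y) (allFin K)) (allFin K))

    isEdge⁻ : ∀ {x y} → isEdge (x , y) ≡ true → toℕ x < toℕ y × Adj (E T) (inj₂ x) (inj₂ y)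
    isEdge⁻ {x} {y} e with toℕ x <ᵇ toℕ y in eq
    ... | true = ℕₚ.<ᵇ⇒< (toℕ x) (toℕ y) (from Boolₚ.T-≡ eq) , e

    isEdge⁺ : ∀ {x y} → toℕ x < toℕ y → Adj (E T) (inj₂ x) (inj₂ y) → isEdge (x , y) ≡ true
    isEdge⁺ lt e rewrite to Boolₚ.T-≡ (ℕₚ.<⇒<ᵇ lt) = e

    ∈-edges⁻ : ∀ {p} → p ∈ edges → isEdge p ≡ true
    ∈-edges⁻ {p} p∈ = to Boolₚ.T-≡ (proj₂ (∈-filter⁻ (Boolₚ.T? ∘ isEdge)
      {xs = concatMap (λ x → map (λ y → x , y) (allFin K)) (allFin K)} p∈))

    ∈-edges⁺ : ∀ {p} → isEdge p ≡ true → p ∈ edges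
    ∈-edges⁺ {x , y} e = ∈-filter⁺ (Boolₚ.T? ∘ isEdge)
      (subst ((x , y) ∈_) (sym (cartesian-concatMap (allFin K) (allFin K)))
        (∈-cartesianProduct⁺ (allFin-complete x) (allFin-complete y)))
      (from Boolₚ.T-≡ e)

    edges-unique : Unique edges
    edges-unique = Uniqueₚ.filter⁺ (Boolₚ.T? ∘ isEdge)
      (subst Unique (sym (cartesian-concatMap (allFin K) (allFin K)))
        (Uniqueₚ.cartesianProduct⁺ (allFin-unique K) (allFin-unique K)))

    -- Edges are listed with the smaller index first, regardless of the rooting; this selects the
    -- end that is the child.
    lower : Fin K × Fin K → Fin K
    lower (x , y) = if does (par (inj₂ x) ≟ᵥ inj₂ y) then x else y

    data Oriented : Fin K × Fin K → Set where
      rising  : ∀ {x y} → toℕ x < toℕ y → par (inj₂ x) ≡ inj₂ y → lower (x , y) ≡ x → Oriented (x , y)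
      falling : ∀ {x y} → toℕ x < toℕ y → par (inj₂ y) ≡ inj₂ x → lower (x , y) ≡ y → Oriented (x , y)

    oriented : ∀ {p} → p ∈ edges → Oriented p
    oriented {x , y} p∈ with isEdge⁻ (∈-edges⁻ p∈)
    ... | lt , e = orient' (adj-par e) (par (inj₂ x) ≟ᵥ inj₂ y)
      where
      orient' : _ → Dec (par (inj₂ x) ≡ inj₂ y) → Oriented (x , y)
      orient' _ (yes eq) = rising lt eq (cong (if_then x else y) (dec-true (par (inj₂ x) ≟ᵥ inj₂ y) eq))
      orient' (inj₁ (_ , eq)) (no ne) = ⊥-elim (ne eq)
      orient' (inj₂ (_ , eq)) (no ne) = falling lt eq (cong (if_then x else y) (dec-false (par (inj₂ x) ≟ᵥ inj₂ y) ne))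

    -- The child end determines the other end as its parent. In the mixed cases the same pair would
    -- be listed in both orders.
    lower-injective : ∀ {p q} → p ∈ edges → q ∈ edges → lower p ≡ lower q → p ≡ q
    lower-injective p∈ q∈ eq with oriented p∈ | oriented q∈
    ... | rising lt e l | rising lt' e' l' with trans (sym l) (trans eq l')
    ...   | refl = cong (_ ,_) (Sumₚ.inj₂-injective (trans (sym e) e'))
    lower-injective p∈ q∈ eq | rising lt e l | falling lt' e' l' with trans (sym l) (trans eq l')
    ...   | refl with Sumₚ.inj₂-injective (trans (sym e) e')
    ...     | refl = ⊥-elim (ℕₚ.<-asym lt lt')
    lower-injective p∈ q∈ eq | falling lt e l | rising lt' e' l' with trans (sym l) (trans eq l')
    ...   | refl with Sumₚ.inj₂-injective (trans (sym e) e')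
    ...     | refl = ⊥-elim (ℕₚ.<-asym lt lt')
    lower-injective p∈ q∈ eq | falling lt e l | falling lt' e' l' with trans (sym l) (trans eq l')
    ...   | refl = cong (_, _) (Sumₚ.inj₂-injective (trans (sym e) e'))

    lower-par : ∀ {p} → p ∈ edges → ∃ λ y → par (inj₂ (lower p)) ≡ inj₂ y
    lower-par p∈ with oriented p∈
    ... | rising  {x} {y} _ e l = y , trans (cong (par ∘ inj₂) l) e
    ... | falling {x} {y} _ e l = x , trans (cong (par ∘ inj₂) l) e

    lower-complete : ∀ z → z ≢ apex → z ∈ map lower edges
    lower-complete z z≢ with par (inj₂ z) in eq
    ... | inj₁ zero = ⊥-elim (z≢ (Sumₚ.inj₂-injective (apex-unique (λ ()) eq)))
    ... | inj₁ (suc a) = ⊥-elim (childless a (λ ()) eq)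
    ... | inj₂ w with Finₚ.<-cmp z w
    ...   | tri< lt _ _ = subst (_∈ map lower edges)
              (cong (if_then z else w) (dec-true (par (inj₂ z) ≟ᵥ inj₂ w) eq))
              (∈-map⁺ lower (∈-edges⁺ (isEdge⁺ lt (subst (Adj (E T) (inj₂ z)) eq (par-adj (λ ()))))))
    ...   | tri> _ _ gt = subst (_∈ map lower edges)
              (cong (if_then w else z) (dec-false (par (inj₂ w) ≟ᵥ inj₂ z) (λ eq' →
                par⋢ {inj₂ z} (λ ()) eq (up (λ ()) (subst (_⊑ inj₂ z) (sym eq') stop)))))
              (∈-map⁺ lower (∈-edges⁺ (isEdge⁺ gt (adj-sym (subst (Adj (E T) (inj₂ z)) eq (par-adj (λ ())))))))
    ...   | tri≈ _ refl _ = ⊥-elim (par⋢ {inj₂ z} (λ ()) eq stop)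

  -- Every internal vertex except the apex is the lower end of exactly one internal edge.
  suc-iE : suc (iE T) ≡ k T
  suc-iE = trans (cong suc (sym (Listₚ.length-map lower edges)))
    (trans (↭-length (unique-↭ (apex∉ ∷ map-unique edges-unique lower-injective) (allFin-unique K)
        (λ _ → allFin-complete _) (λ {z} _ → found z)))
      (length-allFin K))
    where
    apex∉ : All (apex ≢_) (map lower edges)
    apex∉ = Allₚ.map⁺ (All.tabulate ne)
      where
      ne : ∀ {p} → p ∈ edges → apex ≢ lower p
      ne p∈ eq with lower-par p∈
      ... | y , par≡ with trans (sym apex-par) (trans (cong (par ∘ inj₂) eq) par≡)
      ...   | ()
    found : ∀ z → z ∈ apex ∷ map lower edges
    found z with z Finₚ.≟ apex
    ... | yes refl = here refl
    ... | no  ne   = there (lower-complete z ne)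

  card-code : ∀ {F} → Codes F → k T ≡ card F
  card-code {F} (coded , sur) = trans (sym (length-allFin K))
    (trans (sym (Listₚ.length-map (λ x → cluster (inj₂ x)) (allFin K)))
      (↭-length (unique-↭
        (Uniqueₚ.map⁺ (λ eq → Sumₚ.inj₂-injective (cluster-injective (λ ()) (λ ()) eq)) (allFin-unique K))
        (members-unique F) into onto)))
    where
    into : ∀ {A} → A ∈ map (λ x → cluster (inj₂ x)) (allFin K) → A ∈ members F
    into A∈ with ∈-map⁻ (λ x → cluster (inj₂ x)) A∈
    ... | x , _ , refl = members-∈ F _ (coded x)
    onto : ∀ {A} → A ∈ members F → A ∈ map (λ x → cluster (inj₂ x)) (allFin K)
    onto {A} A∈ with sur A (∈-members F A A∈)
    ... | x , refl = ∈-map⁺ (λ x → cluster (inj₂ x)) (allFin-complete x)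

  -- The code has one member per internal vertex, one more than there are internal edges.
  sign-code : ∀ {F} → Codes F → signPow (iE T) ≡ -ℤ sgn F
  sign-code {F} c = trans (sym (ℤₚ.neg-involutive (signPow (iE T))))
    (cong (-ℤ_ ∘ signPow) (trans suc-iE (card-code c)))

-- Representative systems

≅-refl : ∀ {m} (T : LTree m) → T ≅ T
≅-refl T = mk↔ₛ′ id id (λ _ → refl) (λ _ → refl) , (λ _ → refl) , (λ _ _ → refl)

lookup-map-unique : {A B : Set} (f : A → B) (Q : B → Set) {xs : List A} {a : A} → Unique xs → a ∈ xs →
  Q (f a) → (∀ {x} → x ∈ xs → Q (f x) → x ≡ a) →
  Σ (Fin (length (map f xs))) λ i → Q (lookup (map f xs) i) × (∀ j → Q (lookup (map f xs) j) → j ≡ i)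
lookup-map-unique f Q {a ∷ xs} (a∉ ∷ u) (here refl) q only = zero , q , unique'
  where
  unique' : ∀ j → Q (lookup (map f (a ∷ xs)) j) → j ≡ zero
  unique' zero    _ = refl
  unique' (suc j) q' with ∈-map⁻ f (∈-lookup {xs = map f xs} j)
  ... | x , x∈ , eq = ⊥-elim (All.lookup a∉ x∈ (sym (only (there x∈) (subst Q eq q'))))
lookup-map-unique f Q {x ∷ xs} (x∉ ∷ u) (there a∈) q only
  with lookup-map-unique f Q u a∈ q (λ y∈ → only (there y∈))
... | i , qi , uniq = suc i , qi , unique'
  where
  unique' : ∀ j → Q (lookup (map f (x ∷ xs)) j) → j ≡ suc i
  unique' zero    q' = ⊥-elim (All.lookup x∉ a∈ (only (here refl) q'))
  unique' (suc j) q' = cong suc (uniq j q')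

signedSum-tabulate : ∀ {m N} (L : List (LTree m)) (code : Fin (length L) → Fam N) →
  (∀ i → signPow (iE (lookup L i)) ≡ -ℤ sgn (code i)) →
  signedSum L ≡ ∑ (Data.List.tabulate code) (λ F → -ℤ sgn F)
signedSum-tabulate []      code h = refl
signedSum-tabulate (T ∷ L) code h =
  cong₂ _+ℤ_ (h zero) (signedSum-tabulate L (code ∘ suc) (h ∘ suc))

module _ {N} (2≤N : 2 ≤ N) {Γ : Fin (suc N) → Fin (suc N) → Bool}
         (irrefl : ∀ a → Γ a a ≡ false) (dominating : IsDominating Γ zero)
         (⊤-edge : ContainsEdge (deleteZero Γ) ⊤) where

  private
    H : Fin N → Fin N → Bool
    H = deleteZero Γ

    module Tree {F : Fam N} (nested : IsNested H F) = FamilyTree (λ a → irrefl (suc a)) nested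

  nestedFamilies : List (Fam N)
  nestedFamilies = filter (isNested? H) (elements (Fam-finite N))

  private
    nestedFamilies-unique : Unique nestedFamilies
    nestedFamilies-unique = Uniqueₚ.filter⁺ (isNested? H) (unique (Fam-finite N))

    ∈-nestedFamilies : ∀ {F} → IsNested H F → F ∈ nestedFamilies
    ∈-nestedFamilies {F} nested = ∈-filter⁺ (isNested? H) (complete (Fam-finite N) F) nested

    familyTree-stable : ∀ {F} → IsNested H F → IsStable Γ (familyTree F)
    familyTree-stable nested = shape⇒stable dominating (Tree.shape nested) (Tree.clusterEdge nested)

    code : ∀ {T} → IsStable Γ T → Fam N
    code st = proj₁ (stable⇒nested 2≤N ⊤-edge st)

    code-nested : ∀ {T} (st : IsStable Γ T) → IsNested H (code st)
    code-nested st = proj₁ (proj₂ (stable⇒nested 2≤N ⊤-edge st))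

    code-codes : ∀ {T} (st : IsStable Γ T) → Descent.Codes (tree⇒rooted T (proj₁ st)) (code st)
    code-codes st = proj₂ (proj₂ (stable⇒nested 2≤N ⊤-edge st))

    ≅-familyTree : ∀ {T} (st : IsStable Γ T) → T ≅ familyTree (code st)
    ≅-familyTree st = sameCode⇒≅ (stable⇒shape 2≤N st) (Tree.shape (code-nested st))
      (code-codes st) (Tree.codes (code-nested st))

    code-unique : ∀ {T F} (st : IsStable Γ T) → IsNested H F → T ≅ familyTree F → F ≡ code st
    code-unique {T} st nested iso = sym (≅⇒sameCode (tree⇒rooted T (proj₁ st)) (Tree.rooted nested) iso
      (code-codes st) (Tree.codes nested))

    code-injective : ∀ {T T'} (st : IsStable Γ T) (st' : IsStable Γ T') → code st ≡ code st' → T ≅ T'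
    code-injective st st' eq = sameCode⇒≅ (stable⇒shape 2≤N st) (stable⇒shape 2≤N st')
      (code-codes st) (subst (Descent.Codes (tree⇒rooted _ (proj₁ st'))) (sym eq) (code-codes st'))

  -- Shows that representative systems exist. Uniqueness of the index holds because a family is
  -- recovered from the isomorphism class of its tree.
  familyTrees-represent : IsTreeRepSystem Γ (map familyTree nestedFamilies)
  familyTrees-represent =
    Allₚ.map⁺ (All.map familyTree-stable (Allₚ.all-filter (isNested? H) (elements (Fam-finite N)))) ,
    (λ T st → lookup-map-unique familyTree (T ≅_) nestedFamilies-unique (∈-nestedFamilies (code-nested st))
      (≅-familyTree st)
      (λ F∈ iso → code-unique st (proj₂ (∈-filter⁻ (isNested? H) {xs = elements (Fam-finite N)} F∈)) iso))

  -- Taking codes is a bijection from the positions of `L` to the nested families: equal codes mean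
  -- isomorphic trees, which occupy one position, and the tree of each nested family is represented
  -- somewhere.
  signedSum-nested : ∀ L → IsTreeRepSystem Γ L →
    signedSum L ≡ -ℤ ∑ (elements (Fam-finite N)) (λ F → ⟦ isNested? H F ⟧ *ℤ sgn F)
  signedSum-nested L (stable , represent) = begin
    signedSum L
      ≡⟨ signedSum-tabulate L codeAt (λ i → sign-code (stable⇒shape 2≤N (stableAt i)) (code-codes (stableAt i))) ⟩
    ∑ (Data.List.tabulate codeAt) (λ F → -ℤ sgn F)
      ≡⟨ ∑-↭ (λ F → -ℤ sgn F) perm ⟩
    ∑ nestedFamilies (λ F → -ℤ sgn F)
      ≡⟨ ∑-neg nestedFamilies sgn ⟩
    -ℤ ∑ nestedFamilies sgn
      ≡⟨ cong -ℤ_ (∑-filter (isNested? H) (elements (Fam-finite N)) sgn) ⟩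
    -ℤ ∑ (elements (Fam-finite N)) (λ F → ⟦ isNested? H F ⟧ *ℤ sgn F) ∎
    where
    open ≡-Reasoning
    stableAt : ∀ i → IsStable Γ (lookup L i)
    stableAt i = All.lookup stable (∈-lookup i)
    codeAt : Fin (length L) → Fam N
    codeAt i = code (stableAt i)
    codeAt-injective : ∀ {i j} → codeAt i ≡ codeAt j → i ≡ j
    codeAt-injective {i} {j} eq with represent (lookup L i) (stableAt i)
    ... | _ , _ , only = trans (only i (≅-refl _))
      (sym (only j (code-injective (stableAt i) (stableAt j) eq)))
    into : ∀ {F} → F ∈ Data.List.tabulate codeAt → F ∈ nestedFamilies
    into F∈ with ∈-tabulate⁻ F∈
    ... | i , refl = ∈-nestedFamilies (code-nested (stableAt i))
    onto : ∀ {F} → F ∈ nestedFamilies → F ∈ Data.List.tabulate codeAt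
    onto {F} F∈ =
      let nested        = proj₂ (∈-filter⁻ (isNested? H) {xs = elements (Fam-finite N)} F∈)
          (i , iso , _) = represent (familyTree F) (familyTree-stable nested)
      in subst (_∈ Data.List.tabulate codeAt)
           (sym (code-unique (stableAt i) nested (≅-sym iso))) (∈-tabulate⁺ i)
    perm : Data.List.tabulate codeAt ↭ nestedFamilies
    perm = unique-↭ (Uniqueₚ.tabulate⁺ codeAt-injective) nestedFamilies-unique into onto

-- The number of acyclic orientations, and the conclusion

isACO-cong : ∀ {n} {G G' : Fin n → Fin n → Bool} → (∀ i j → G i j ≡ G' i j) → ∀ O → IsACO G O → IsACO G' O
isACO-cong eq O ((sub , opp) , acyclic) =
  ((λ i j o → trans (sym (eq i j)) (sub i j o)) , (λ i j g → opp i j (trans (eq i j) g))) , acyclic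

module _ {n} (G : Fin n → Fin n → Bool) where

  acyclicOrientations : List (Matrix n)
  acyclicOrientations = filter (isACO? G) (elements (Matrix-finite n))

  private
    induced-⊤ : ∀ i j → induced G ⊤ i j ≡ G i j
    induced-⊤ i j = ⇔-true (λ e → proj₂ (proj₂ (induced⁻ G {⊤} {i} {j} e))) (induced⁺ G Subₚ.∈⊤ Subₚ.∈⊤)

    acyclicOrientations-unique : Unique acyclicOrientations
    acyclicOrientations-unique = Uniqueₚ.filter⁺ (isACO? G) (unique (Matrix-finite n))

    ∈-acyclicOrientations : ∀ {O} → IsACO G O → O ∈ acyclicOrientations
    ∈-acyclicOrientations {O} = ∈-filter⁺ (isACO? G) (complete (Matrix-finite n) O)

  hasCard-acyclicOrientations : HasCard (IsACO G) (length acyclicOrientations)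
  hasCard-acyclicOrientations = acyclicOrientations , acyclicOrientations-unique ,
    Allₚ.all-filter (isACO? G) (elements (Matrix-finite n)) , (λ _ → ∈-acyclicOrientations) , refl

  acoCount-⊤ : ∀ {c} → HasCard (IsACO G) c → acoCount G ⊤ ≡ + c
  acoCount-⊤ (L , L! , aco , complete-L , refl) = begin
    ∑ Os (λ O → ⟦ isACO? (induced G ⊤) O ⟧)
      ≡⟨ ∑-cong Os (λ O → trans (⟦⟧-cong (isACO? (induced G ⊤) O) (isACO? G O)
           (isACO-cong induced-⊤ O) (isACO-cong (λ i j → sym (induced-⊤ i j)) O)) (sym (ℤₚ.*-identityʳ _))) ⟩
    ∑ Os (λ O → ⟦ isACO? G O ⟧ *ℤ + 1)
      ≡⟨ ∑-filter (isACO? G) Os (λ _ → + 1) ⟨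
    ∑ acyclicOrientations (λ _ → + 1)
      ≡⟨ ∑-length acyclicOrientations ⟩
    + length acyclicOrientations
      ≡⟨ cong +_ (↭-length (unique-↭ acyclicOrientations-unique L!
           (λ {O} O∈ → complete-L O (proj₂ (∈-filter⁻ (isACO? G) {xs = Os} O∈)))
           (λ O∈ → ∈-acyclicOrientations (All.lookup aco O∈)))) ⟩
    + length L ∎
    where
    open ≡-Reasoning
    Os = elements (Matrix-finite n)

abs-signed : ∀ m {s a c} → s ≡ -ℤ (signPow m *ℤ a) → a ≡ + c → ∣ s ∣ ≡ c
abs-signed m {c = c} refl refl = begin
  ∣ -ℤ (signPow m *ℤ + c) ∣   ≡⟨ ℤₚ.∣-i∣≡∣i∣ (signPow m *ℤ + c) ⟩
  ∣ signPow m *ℤ + c ∣        ≡⟨ ℤₚ.abs-* (signPow m) (+ c) ⟩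
  ∣ signPow m ∣ * c           ≡⟨ cong (_* c) (signPow-abs m) ⟩
  1 * c                       ≡⟨ ℕₚ.*-identityˡ c ⟩
  c                           ∎
  where open ≡-Reasoning

theorem3p1 : (n : ℕ) → 1 ≤ n →
    (Γ : Fin (suc (suc n)) → Fin (suc (suc n)) → Bool) →
    IsSimpleGraph Γ → IsDominating Γ P → IsDominating Γ Q →
    (Σ (List (LTree (suc (suc n)))) λ L → IsTreeRepSystem Γ L) ×
    (Σ ℕ λ c → HasCard (IsACO (restrict Γ)) c) ×
    ((L : List (LTree (suc (suc n)))) → IsTreeRepSystem Γ L →
    (c : ℕ) → HasCard (IsACO (restrict Γ)) c →
    ∣ signedSum L ∣ ≡ c)
theorem3p1 n 1≤n Γ (Γ-sym , Γ-irrefl) domP domQ =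
  (_ , familyTrees-represent 2≤N Γ-irrefl domP ⊤-edge) ,
  (_ , hasCard-acyclicOrientations G) ,
  signed
  where
  G : Fin n → Fin n → Bool
  G = restrict Γ
  G-simple : IsSimpleGraph G
  G-simple = (λ i j → Γ-sym (emb i) (emb j)) , (λ i → Γ-irrefl (emb i))
  2≤N : 2 ≤ suc n
  2≤N = s≤s 1≤n
  -- With P deleted, Q has become the vertex zero.
  H-dominating : IsDominating (deleteZero Γ) zero
  H-dominating w w≢ = domQ (suc w) (λ eq → w≢ (Finₚ.suc-injective eq))
  ⊤-edge : ContainsEdge (deleteZero Γ) ⊤
  ⊤-edge = pick 1≤n
    where
    pick : 1 ≤ n → ContainsEdge (deleteZero Γ) ⊤
    -- The edge joins Q to the first vertex of [n].
    pick (s≤s _) = zero , suc zero , Subₚ.∈⊤ , Subₚ.∈⊤ , H-dominating (suc zero) (λ ())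
  signed : ∀ L → IsTreeRepSystem Γ L → ∀ c → HasCard (IsACO G) c → ∣ signedSum L ∣ ≡ c
  -- Both signs disappear here: the minus from counting clusters instead of internal edges, and
  -- (-1)^n from the chromatic recursion on all of [n].
  signed L rep c hc = abs-signed ∥ ⊤ {n} ∥
    (trans (signedSum-nested 2≤N Γ-irrefl domP ⊤-edge L rep)
      (cong -ℤ_ (trans (nestedSum 1≤n (deleteZero Γ)
          ((λ a b → Γ-sym (suc a) (suc b)) , (λ a → Γ-irrefl (suc a))) H-dominating)
        (colouringSum≡acoCount G G-simple ⊤))))
    (acoCount-⊤ G hc)
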